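{- Let $k\ge2$ be such that $r=2^k-1$ is prime, and let $q=2^k$. Then the integer group determinants of $GA(1,q)$ are exactly the integers of the form $$D=AB^{q-1},\qquad A,B\in\mathbb Z,$$ where either $r\nmid A$ or $r^2\mid A$, and $B\equiv A\pmod q$.
   Context: For a finite group $G=\{g_1,\dots,g_n\}$ and an element $\sum_{g\in G}a_g g$ of the group ring $\mathbb Z[G]$ (all $a_g\in\mathbb Z$), the group determinant is $D\left(\sum_{g\in G}a_g g\right)=\det\left(a_{g_ig_j^{ -1}}\right)_{i,j=1}^n$. An integer group determinant of $G$ is any integer of this form. The general affine group of degree one over $\mathbb F_q$ is $GA(1,q)=\left\{\begin{pmatrix} a & b\\ 0 & 1\end{pmatrix}: a\in\mathbb F_q^*,\ b\in\mathbb F_q\right\}$ under matrix multiplication. -}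

module Defs where

open import Algebra.Apartness.Bundles using (HeytingField)
import Algebra.Apartness.Properties.HeytingCommutativeRing as HeytingProperties
open import Algebra.Bundles using (CommutativeRing; Group)
import Algebra.Properties.Monoid.Sum as Sum
import Algebra.Properties.Ring as RingProperties
open import Data.Fin.Base using (Fin; zero; suc; toℕ)
open import Data.Integer.Base using (ℤ; 1ℤ; -1ℤ; _*_; _^_)
import Data.Integer.Properties as ℤ
open import Data.Nat.Base using (ℕ; zero; suc)
open import Data.Product.Base using (Σ-syntax; ∃-syntax; _×_; _,_; proj₁; proj₂)
open import Data.Vec.Functional using (Vector; removeAt)
open import Function.Bundles using (Func; Inverse)
open import Level using (_⊔_)
open import Relation.Binary.Bundles using (Setoid)
open import Relation.Binary.PropositionalEquality using (_≡_)
import Relation.Binary.PropositionalEquality as ≡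
import Relation.Binary.Reasoning.Setoid as SetoidReasoning

Matrix : ∀ {a} → Set a → ℕ → ℕ → Set a
Matrix A m n = Vector (Vector A n) m

-- Laplace expansion along the first row.
det : ∀ {n} → Matrix ℤ n n → ℤ
det {zero}  M = 1ℤ
det {suc n} M =
  Sum.sum ℤ.+-0-monoid λ j →
    -1ℤ ^ toℕ j * M zero j * det (λ i → removeAt (M (suc i)) j)

-- A listing of the elements of S, up to its equality, without repetition.
Enumeration : ∀ {c ℓ} → Setoid c ℓ → ℕ → Set (c ⊔ ℓ)
Enumeration S n = Inverse (≡.setoid (Fin n)) S

-- For finite G an element ∑ a_g g of ℤ[G] is its coefficient function g ↦ a_g.
ℤ[_] : ∀ {c ℓ} → Group c ℓ → Set (c ⊔ ℓ)
ℤ[ G ] = Func (Group.setoid G) (≡.setoid ℤ)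

module _ {c ℓ} (G : Group c ℓ) where
  open Group G using (setoid; _∙_; _⁻¹)

  groupDeterminant : ∀ {n} → Enumeration setoid n → ℤ[ G ] → ℤ
  groupDeterminant g a = det λ i j → Func.to a (Inverse.to g i ∙ Inverse.to g j ⁻¹)

  -- A simultaneous permutation of rows and columns leaves the determinant
  -- unchanged, so the choice of enumeration is immaterial.
  IsIntegerGroupDeterminant : ℤ → Set (c ⊔ ℓ)
  IsIntegerGroupDeterminant d =
    ∃[ n ] Σ[ g ∈ Enumeration setoid n ] ∃[ a ] d ≡ groupDeterminant {n} g a

module GeneralAffine {c ℓ₁ ℓ₂} (F : HeytingField c ℓ₁ ℓ₂) where
  private
    module F = HeytingField F
    open HeytingProperties F.heytingCommutativeRing
      using (x-0≈x; 1#0; x#0y#0→xy#0; invertibleˡ⇒#)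
    R : CommutativeRing c ℓ₁
    R = record { isCommutativeRing = F.isCommutativeRing }
    open RingProperties (CommutativeRing.ring R)
      using (-‿distribʳ-*)
    open SetoidReasoning F.setoid

  -- Represents the matrix with rows (a b) and (0 1). In a Heyting field a # 0# means that a is a unit,
  -- and when the field is finite this is the same as ¬ (a ≈ 0#).
  record Affine : Set (c ⊔ ℓ₂) where
    constructor affine
    field
      a   : F.Carrier
      b   : F.Carrier
      a#0 : a F.# F.0#

  open Affine

  toMatrix : Affine → Matrix F.Carrier 2 2
  toMatrix x zero       zero       = a x
  toMatrix x zero       (suc zero) = b x
  toMatrix x (suc zero) zero       = F.0#
  toMatrix x (suc zero) (suc zero) = F.1#

  infix 4 _≈_
  _≈_ : Affine → Affine → Set ℓ₁
  x ≈ y = (a x F.≈ a y) × (b x F.≈ b y)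

  infixl 7 _∙_
  _∙_ : Affine → Affine → Affine
  x ∙ y = affine (a x F.* a y) (a x F.* b y F.+ b x) (x#0y#0→xy#0 (a#0 x) (a#0 y))

  ε : Affine
  ε = affine F.1# F.0# 1#0

  private
    a⁻¹ : Affine → F.Carrier
    a⁻¹ x = proj₁ (F.#⇒invertible (a#0 x))

    a⁻¹-inverseˡ : ∀ x → a⁻¹ x F.* a x F.≈ F.1#
    a⁻¹-inverseˡ x = F.trans (F.*-congˡ (F.sym (x-0≈x (a x))))
      (proj₁ (proj₂ (F.#⇒invertible (a#0 x))))

    a⁻¹-inverseʳ : ∀ x → a x F.* a⁻¹ x F.≈ F.1#
    a⁻¹-inverseʳ x = F.trans (F.*-comm _ _) (a⁻¹-inverseˡ x)

    a⁻¹#0 : ∀ x → a⁻¹ x F.# F.0#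
    a⁻¹#0 x = invertibleˡ⇒#
      (a x , F.trans (F.*-congˡ (x-0≈x (a⁻¹ x))) (a⁻¹-inverseʳ x))

    a⁻¹-cong : ∀ {x y} → a x F.≈ a y → a⁻¹ x F.≈ a⁻¹ y
    a⁻¹-cong {x} {y} p = begin
      a⁻¹ x                        ≈⟨ F.*-identityʳ _ ⟨
      a⁻¹ x F.* F.1#               ≈⟨ F.*-congˡ (a⁻¹-inverseʳ y) ⟨
      a⁻¹ x F.* (a y F.* a⁻¹ y)    ≈⟨ F.*-assoc _ _ _ ⟨
      a⁻¹ x F.* a y F.* a⁻¹ y      ≈⟨ F.*-congʳ (F.*-congˡ p) ⟨
      a⁻¹ x F.* a x F.* a⁻¹ y      ≈⟨ F.*-congʳ (a⁻¹-inverseˡ x) ⟩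
      F.1# F.* a⁻¹ y               ≈⟨ F.*-identityˡ _ ⟩
      a⁻¹ y                        ∎

  infix 8 _⁻¹
  _⁻¹ : Affine → Affine
  x ⁻¹ = affine (a⁻¹ x) (F.- (a⁻¹ x F.* b x)) (a⁻¹#0 x)

  private
    assoc : ∀ x y z → (x ∙ y) ∙ z ≈ x ∙ (y ∙ z)
    assoc x y z = F.*-assoc _ _ _ , (begin
      a x F.* a y F.* b z F.+ (a x F.* b y F.+ b x)
        ≈⟨ F.+-assoc _ _ _ ⟨
      a x F.* a y F.* b z F.+ a x F.* b y F.+ b x
        ≈⟨ F.+-congʳ (F.+-congʳ (F.*-assoc _ _ _)) ⟩
      a x F.* (a y F.* b z) F.+ a x F.* b y F.+ b x
        ≈⟨ F.+-congʳ (F.distribˡ _ _ _) ⟨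
      a x F.* (a y F.* b z F.+ b y) F.+ b x ∎)

    identityˡ : ∀ x → ε ∙ x ≈ x
    identityˡ x = F.*-identityˡ _ , F.trans (F.+-identityʳ _) (F.*-identityˡ _)

    identityʳ : ∀ x → x ∙ ε ≈ x
    identityʳ x = F.*-identityʳ _ , F.trans (F.+-congʳ (F.zeroʳ _)) (F.+-identityˡ _)

    inverseˡ : ∀ x → x ⁻¹ ∙ x ≈ ε
    inverseˡ x = a⁻¹-inverseˡ x , F.-‿inverseʳ _

    inverseʳ : ∀ x → x ∙ x ⁻¹ ≈ ε
    inverseʳ x = a⁻¹-inverseʳ x , (begin
      a x F.* (F.- (a⁻¹ x F.* b x)) F.+ b x   ≈⟨ F.+-congʳ (-‿distribʳ-* _ _) ⟨
      F.- (a x F.* (a⁻¹ x F.* b x)) F.+ b x   ≈⟨ F.+-congʳ (F.-‿cong (F.*-assoc _ _ _)) ⟨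
      F.- (a x F.* a⁻¹ x F.* b x) F.+ b x     ≈⟨ F.+-congʳ (F.-‿cong (F.*-congʳ (a⁻¹-inverseʳ x))) ⟩
      F.- (F.1# F.* b x) F.+ b x              ≈⟨ F.+-congʳ (F.-‿cong (F.*-identityˡ _)) ⟩
      F.- b x F.+ b x                         ≈⟨ F.-‿inverseˡ _ ⟩
      F.0#                                    ∎)

  group : Group (c ⊔ ℓ₂) ℓ₁
  group = record
    { Carrier = Affine
    ; _≈_     = _≈_
    ; _∙_     = _∙_
    ; ε       = ε
    ; _⁻¹     = _⁻¹
    ; isGroup = record
      { isMonoid = record
        { isSemigroup = record
          { isMagma = record
            { isEquivalence = record
              { refl  = F.refl , F.refl
              ; sym   = λ p → F.sym (proj₁ p) , F.sym (proj₂ p)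
              ; trans = λ p q → F.trans (proj₁ p) (proj₁ q) , F.trans (proj₂ p) (proj₂ q)
              }
            ; ∙-cong = λ p q →
                F.*-cong (proj₁ p) (proj₁ q) ,
                F.+-cong (F.*-cong (proj₁ p) (proj₂ q)) (proj₂ p)
            }
          ; assoc = assoc
          }
        ; identity = identityˡ , identityʳ
        }
      ; inverse = inverseˡ , inverseʳ
      ; ⁻¹-cong = λ {x} {y} p →
          a⁻¹-cong {x} {y} (proj₁ p) ,
          F.-‿cong (F.*-cong (a⁻¹-cong {x} {y} (proj₁ p)) (proj₂ p))
      }
    }

  infixl 7 _⊗_
  _⊗_ : ∀ {l m n} → Matrix F.Carrier l m → Matrix F.Carrier m n → Matrix F.Carrier l n
  (M ⊗ N) i j = Sum.sum (CommutativeRing.+-monoid R) λ k → M i k F.* N k j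

  -- The group operation is matrix multiplication.
  toMatrix-homo : ∀ x y i j → toMatrix (x ∙ y) i j F.≈ (toMatrix x ⊗ toMatrix y) i j
  toMatrix-homo x y zero zero = F.sym (begin
    a x F.* a y F.+ (b x F.* F.0# F.+ F.0#) ≈⟨ F.+-congˡ (F.+-identityʳ _) ⟩
    a x F.* a y F.+ b x F.* F.0#            ≈⟨ F.+-congˡ (F.zeroʳ _) ⟩
    a x F.* a y F.+ F.0#                    ≈⟨ F.+-identityʳ _ ⟩
    a x F.* a y                             ∎)
  toMatrix-homo x y zero (suc zero) =
    F.sym (F.+-congˡ (F.trans (F.+-identityʳ _) (F.*-identityʳ _)))
  toMatrix-homo x y (suc zero) zero = F.sym (begin
    F.0# F.* a y F.+ (F.1# F.* F.0# F.+ F.0#) ≈⟨ F.+-cong (F.zeroˡ _) (F.+-identityʳ _) ⟩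
    F.0# F.+ F.1# F.* F.0#                    ≈⟨ F.+-identityˡ _ ⟩
    F.1# F.* F.0#                             ≈⟨ F.zeroʳ _ ⟩
    F.0#                                      ∎)
  toMatrix-homo x y (suc zero) (suc zero) = F.sym (begin
    F.0# F.* b y F.+ (F.1# F.* F.1# F.+ F.0#) ≈⟨ F.+-cong (F.zeroˡ _) (F.+-identityʳ _) ⟩
    F.0# F.+ F.1# F.* F.1#                    ≈⟨ F.+-identityˡ _ ⟩
    F.1# F.* F.1#                             ≈⟨ F.*-identityˡ _ ⟩
    F.1#                                      ∎)

GA₁ : ∀ {c ℓ₁ ℓ₂} → HeytingField c ℓ₁ ℓ₂ → Group (c ⊔ ℓ₂) ℓ₁
GA₁ = GeneralAffine.group

{-# OPTIONS --safe #-}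

-- GA(1,q) is the semidirect product of K, the additive group of the field, by a cyclic group of order
-- r = q - 1. Conjugated by the character table of K, the group matrix becomes block diagonal with one
-- r × r block M_d for each character d of K. The cyclic group permutes the nontrivial characters
-- transitively, so the determinant is A Bʳ with A = det M₀ and B = det M₁; here M₀ is a circulant.
--
-- Necessity. The entries of M_d are integer combinations of functions d ↦ χ_d(y). These are closed under
-- multiplication, and the values of each of them sum to a multiple of q, so q divides Σ_d det M_d = A + r B
-- and hence B - A. Let S be the sum of the coefficients of the circulant. As xʳ - 1 = (x - 1)ʳ modulo r,
-- the circulant is invertible modulo r unless r | S; if r | S, its row and column sums give r² | A.
--
-- Sufficiency. Fourier inversion realises M₀ = circ f and M₁ = circ f + q X for arbitrary f and X, so it is
-- enough that det (circ f + y X) = ± (A + y) for all y, with a sign independent of y that disappears in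
-- A Bʳ because r + 1 is even. For A = t + m r with 0 < t < r let f be m plus the indicator function of
-- 0, …, t - 1, and X the indicator of the first column; for A = m r² let f = δ₀ - δ₁ + m and X a matrix
-- unit. In both cases there are v and w with (circ f + y X) v = (A + y) w, and replacing one column of
-- circ f by w gives a unimodular matrix.
module Submission where

import Data.Integer.Properties as ℤ
open import Defs
import Algebra.Apartness.Properties.HeytingCommutativeRing as HeytingCommutativeRingProperties
open import Algebra.Apartness.Bundles using (HeytingField)
open import Algebra.Bundles using (AbelianGroup; CommutativeRing; Group)
import Algebra.Properties.AbelianGroup as AbelianGroupProperties
open import Algebra.Properties.AbelianGroup ℤ.+-0-abelianGroup using () renaming (∙-cancelˡ to +-cancelˡ)
import Algebra.Properties.Group as GroupProperties
import Algebra.Properties.Ring as RingProperties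
open import Algebra.Properties.Semiring.Sum ℤ.+-*-semiring
  using (sum; sum-cong-≗; sum-remove; sum-replicate-zero; *-distribˡ-sum; *-distribʳ-sum; ∑-distrib-+; ∑-comm; sum-permute)
open import Data.Bool.Base using (Bool; true; false; _∨_)
open import Data.Bool.Properties using (∨-zeroʳ)
open import Data.Fin.Base as Fin using (Fin; zero; suc; toℕ; punchIn; punchOut)
open import Data.Fin.Permutation using (permutation)
open import Data.Fin.Properties as Fin using (_≟_)
open import Data.Integer.Base as ℤ using (ℤ; +_; -[1+_]; 0ℤ; 1ℤ; -1ℤ; _+_; _*_; _^_; _-_; -_)
import Data.Integer.DivMod as ℤ
open import Data.Integer.Divisibility using (_∣_)
open import Data.Integer.Divisibility.Signed as Signed
  using (divides; ∣ᵤ⇒∣; ∣⇒∣ᵤ; ∣m∣n⇒∣m+n; ∣m∣n⇒∣m-n; ∣m⇒∣-m; ∣n⇒∣m*n; ∣m⇒∣m*n) renaming (_∣_ to _∣ₛ_)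
open import Data.Integer.Tactic.RingSolver using (solve-∀)
open import Data.Nat.Base as ℕ using (ℕ; zero; suc; _≤_; _∸_) renaming (_^_ to _^ℕ_)
open import Data.Nat.Coprimality using (coprime-Bézout; prime⇒coprime)
import Data.Nat.Divisibility as ℕ
import Data.Nat.DivMod as ℕ
open import Data.Nat.GCD using (module Bézout)
open import Data.Nat.Primality using (Prime; euclidsLemma; prime⇒nonZero)
import Data.Nat.Properties as ℕ
open import Data.Product.Base as Product using (∃-syntax; Σ-syntax; _×_; _,_; proj₁; proj₂)
open import Data.Sum.Base as Sum using (_⊎_; inj₁; inj₂)
open import Data.Vec.Functional using (Vector; _∷_; head; tail; removeAt)
open import Function.Base using (_∘_; id; const)
open import Function.Bundles using (_⇔_; mk⇔; Func; Inverse)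
open import Relation.Binary.Definitions using (tri<; tri≈; tri>)
open import Relation.Binary.PropositionalEquality hiding ([_])
open import Relation.Nullary.Decidable using (Dec; yes; no; does; dec-true; dec-false; map′)
open import Relation.Nullary.Negation using (¬_; contradiction)
open ≡-Reasoning

-- Determinants

-- Both choices of `f` can be read off from eigenvalues at the `r`-th roots of unity. For the
-- interval the trivial eigenvalue is `t + m r`, and the others are the cyclotomic units
-- `(ζᵗ - 1) / (ζ - 1)`, whose product is 1. For `δ₀ - δ₁ + m` the trivial eigenvalue is `m r`, and
-- the others, `1 - ζ`, have product `r`. None of this is available over ℤ, so no circulant is
-- diagonalised: the factor `A + y` is extracted with an integral vector, as in Cramer's rule, and
-- the remaining matrix is unimodular because its columns generate ℤʳ. Only the additive group is
-- treated by characters. Its characters take the values ±1, which keeps every matrix integral; the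
-- character table is not invertible over ℤ, but its determinant is nonzero and can be cancelled.
-- The field is given abstractly. As `r` is prime, every unit other than 1 generates the units,
-- which yields coordinates where multiplication is addition of exponents; addition is transported
-- to these coordinates and known only through its axioms.

private
  variable
    l m n : ℕ

infix 4 _≋_
_≋_ : Matrix ℤ m n → Matrix ℤ m n → Set
M ≋ N = ∀ i → M i ≗ N i

transpose : Matrix ℤ m n → Matrix ℤ n m
transpose M j i = M i j

δ : Fin n → Fin n → ℤ
δ zero    zero    = 1ℤ
δ zero    (suc j) = 0ℤ
δ (suc i) zero    = 0ℤ
δ (suc i) (suc j) = δ i j

δ-refl : (i : Fin n) → δ i i ≡ 1ℤ
δ-refl zero    = refl
δ-refl (suc i) = δ-refl i

δ-≢ : {i j : Fin n} → i ≢ j → δ i j ≡ 0ℤ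
δ-≢ {i = zero}  {zero}  i≢j = contradiction refl i≢j
δ-≢ {i = zero}  {suc j} i≢j = refl
δ-≢ {i = suc i} {zero}  i≢j = refl
δ-≢ {i = suc i} {suc j} i≢j = δ-≢ (i≢j ∘ cong suc)

δ-sym : (i j : Fin n) → δ i j ≡ δ j i
δ-sym zero    zero    = refl
δ-sym zero    (suc j) = refl
δ-sym (suc i) zero    = refl
δ-sym (suc i) (suc j) = δ-sym i j

δ-⇔ : ∀ {i j : Fin m} {k l : Fin n} → (i ≡ j → k ≡ l) → (k ≡ l → i ≡ j) → δ i j ≡ δ k l
δ-⇔ {i = i} {j} {k} {l} to from with i ≟ j
... | yes i≡j = trans (cong (δ i) (sym i≡j)) (trans (δ-refl i) (sym (trans (cong (δ k) (sym (to i≡j))) (δ-refl k))))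
... | no  i≢j = trans (δ-≢ i≢j) (sym (δ-≢ (i≢j ∘ from)))

sum-zero : {t : Vector ℤ n} → (∀ i → t i ≡ 0ℤ) → sum t ≡ 0ℤ
sum-zero {n} t≗0 = trans (sum-cong-≗ t≗0) (sum-replicate-zero n)

sum-δˡ : ∀ (i : Fin n) (t : Vector ℤ n) → sum (λ j → δ i j * t j) ≡ t i
sum-δˡ zero t = begin
  1ℤ * t zero + sum (λ j → 0ℤ * t (suc j)) ≡⟨ cong₂ _+_ (ℤ.*-identityˡ (t zero)) (sum-zero λ j → ℤ.*-zeroˡ (t (suc j))) ⟩
  t zero + 0ℤ                              ≡⟨ ℤ.+-identityʳ _ ⟩
  t zero                                   ∎
sum-δˡ (suc i) t = begin
  0ℤ * t zero + sum (λ j → δ i j * t (suc j)) ≡⟨ cong₂ _+_ (ℤ.*-zeroˡ (t zero)) (sum-δˡ i (t ∘ suc)) ⟩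
  0ℤ + t (suc i)                              ≡⟨ ℤ.+-identityˡ _ ⟩
  t (suc i)                                   ∎

sum-δʳ : ∀ (i : Fin n) (t : Vector ℤ n) → sum (λ j → t j * δ j i) ≡ t i
sum-δʳ i t = trans (sum-cong-≗ λ j → trans (ℤ.*-comm (t j) (δ j i)) (cong (_* t j) (δ-sym j i))) (sum-δˡ i t)

sum-linear : ∀ c (s t : Vector ℤ n) → sum (λ i → c * s i + t i) ≡ c * sum s + sum t
sum-linear c s t = trans (∑-distrib-+ (λ i → c * s i) t) (cong (_+ sum t) (sym (*-distribˡ-sum c s)))

sum-const : ∀ n (x : ℤ) → sum {n} (const x) ≡ + n * x
sum-const zero    x = sym (ℤ.*-zeroˡ x)
sum-const (suc n) x = trans (cong (λ z → x + z) (sum-const n x)) (step (+ n) x)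
  where
  step : ∀ n x → x + n * x ≡ (1ℤ + n) * x
  step = solve-∀

infixl 7 _⊡_
_⊡_ : Matrix ℤ l m → Matrix ℤ m n → Matrix ℤ l n
(M ⊡ N) i j = sum λ k → M i k * N k j

-- Alternating functions of the rows of a matrix

Adjacent : Fin n → Fin n → Set
Adjacent i j = toℕ j ≡ suc (toℕ i)

-- Vanishing is demanded for adjacent equal rows only, the form that an induction over Laplace
-- expansions delivers; `alternates` recovers the general case. Linearity compares three matrices
-- that agree off row `i`, which avoids an update operation. The matrices may be rectangular, so
-- that the first rows can be frozen one after the other.
record IsAlternating (f : Matrix ℤ m n → ℤ) : Set where
  field
    ≋-cong   : ∀ {M N} → M ≋ N → f M ≡ f N
    linear   : ∀ i c {L M N} → (∀ j → j ≢ i → L j ≗ M j) → (∀ j → j ≢ i → L j ≗ N j) →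
               (∀ k → L i k ≡ c * M i k + N i k) → f L ≡ c * f M + f N
    adjacent : ∀ i j {M} → Adjacent i j → M i ≗ M j → f M ≡ 0ℤ

open IsAlternating

head∷tail : (M : Matrix ℤ (suc m) n) → M ≋ head M ∷ tail M
head∷tail M zero    k = refl
head∷tail M (suc i) k = refl

∷-isAlternating : {f : Matrix ℤ (suc m) n → ℤ} → IsAlternating f → ∀ v → IsAlternating (λ M → f (v ∷ M))
∷-isAlternating alt v .≋-cong M≋N = ≋-cong alt λ { zero k → refl ; (suc i) → M≋N i }
∷-isAlternating alt v .linear i c L≗M L≗N Lᵢ = linear alt (suc i) c
  (λ { zero _ k → refl ; (suc j) j≢i → L≗M j (j≢i ∘ cong suc) })
  (λ { zero _ k → refl ; (suc j) j≢i → L≗N j (j≢i ∘ cong suc) })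
  Lᵢ
∷-isAlternating alt v .adjacent i j i~j Mᵢ≗Mⱼ = adjacent alt (suc i) (suc j) (cong suc i~j) Mᵢ≗Mⱼ

-- Polarisation: expand `f (w ∷ w ∷ M)`, which is zero, for `w = u + v`.
swap : {f : Matrix ℤ (suc (suc m)) n → ℤ} → IsAlternating f →
       ∀ u v M → f (u ∷ v ∷ M) ≡ - f (v ∷ u ∷ M)
swap {f = f} alt u v M = begin
  f (u ∷ v ∷ M)
    ≡⟨ move (f (w ∷ w ∷ M)) (f (u ∷ w ∷ M)) (f (v ∷ w ∷ M)) (f (u ∷ v ∷ M)) (f (v ∷ u ∷ M)) (f (u ∷ u ∷ M)) (f (v ∷ v ∷ M))
         (first w) (second u) (second v) (twice w) (twice u) (twice v) ⟩
  - f (v ∷ u ∷ M) ∎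
  where
  w : Vector ℤ _
  w k = 1ℤ * u k + v k
  first : ∀ x → f (w ∷ x ∷ M) ≡ 1ℤ * f (u ∷ x ∷ M) + f (v ∷ x ∷ M)
  first x = linear alt zero 1ℤ
    (λ { zero 0≢0 → contradiction refl 0≢0 ; (suc j) _ k → refl })
    (λ { zero 0≢0 → contradiction refl 0≢0 ; (suc j) _ k → refl }) (λ k → refl)
  second : ∀ x → f (x ∷ w ∷ M) ≡ 1ℤ * f (x ∷ u ∷ M) + f (x ∷ v ∷ M)
  second x = linear alt (suc zero) 1ℤ
    (λ { zero _ k → refl ; (suc zero) 1≢1 → contradiction refl 1≢1 ; (suc (suc j)) _ k → refl })
    (λ { zero _ k → refl ; (suc zero) 1≢1 → contradiction refl 1≢1 ; (suc (suc j)) _ k → refl }) (λ k → refl)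
  twice : ∀ x → f (x ∷ x ∷ M) ≡ 0ℤ
  twice x = adjacent alt zero (suc zero) refl (λ k → refl)
  move : ∀ ww uw vw uv vu uu vv → ww ≡ 1ℤ * uw + vw → uw ≡ 1ℤ * uu + uv → vw ≡ 1ℤ * vu + vv →
         ww ≡ 0ℤ → uu ≡ 0ℤ → vv ≡ 0ℤ → uv ≡ - vu
  move ww _ _ uv vu _ _ p refl refl ww≡0 refl refl = begin
    uv                                                    ≡⟨ reorder uv vu ⟩
    1ℤ * (1ℤ * 0ℤ + uv) + (1ℤ * vu + 0ℤ) + - vu           ≡⟨ cong (_+ - vu) (trans (sym p) ww≡0) ⟩
    0ℤ + - vu                                             ≡⟨ ℤ.+-identityˡ _ ⟩
    - vu                                                  ∎
    where
    reorder : ∀ x y → x ≡ 1ℤ * (1ℤ * 0ℤ + x) + (1ℤ * y + 0ℤ) + - y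
    reorder = solve-∀

-- Common leading rows are frozen. If the first row equals a row further down than the second, one
-- swap puts it below the other, which is then frozen in turn.
alternates-< : {f : Matrix ℤ m n → ℤ} → IsAlternating f →
               ∀ i j → i Fin.< j → ∀ {M} → M i ≗ M j → f M ≡ 0ℤ
alternates-< alt (suc i) (suc j) (ℕ.s≤s i<j) {M} Mᵢ≗Mⱼ =
  trans (≋-cong alt (head∷tail M)) (alternates-< (∷-isAlternating alt _) i j i<j Mᵢ≗Mⱼ)
alternates-< alt zero (suc zero) _ M₀≗M₁ = adjacent alt zero (suc zero) refl M₀≗M₁
alternates-< {f = f} alt zero (suc (suc j)) _ {M} M₀≗Mⱼ = begin
  f M                                      ≡⟨ ≋-cong alt (λ { zero k → refl ; (suc zero) k → refl ; (suc (suc i)) k → refl }) ⟩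
  f (M zero ∷ M (suc zero) ∷ tail (tail M)) ≡⟨ swap alt _ _ _ ⟩
  - f (M (suc zero) ∷ M zero ∷ tail (tail M))
    ≡⟨ cong -_ (alternates-< (∷-isAlternating alt _) zero (suc j) (ℕ.s≤s ℕ.z≤n) M₀≗Mⱼ) ⟩
  0ℤ ∎

alternates : {f : Matrix ℤ m n → ℤ} → IsAlternating f →
             ∀ {i j} → i ≢ j → ∀ {M} → M i ≗ M j → f M ≡ 0ℤ
alternates alt {i} {j} i≢j Mᵢ≗Mⱼ with Fin.<-cmp i j
... | tri< i<j _ _ = alternates-< alt i j i<j Mᵢ≗Mⱼ
... | tri≈ _ i≡j _ = contradiction i≡j i≢j
... | tri> _ _ j<i = alternates-< alt j i j<i (sym ∘ Mᵢ≗Mⱼ)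

⊡-isAlternating : {f : Matrix ℤ l n → ℤ} → IsAlternating f → (B : Matrix ℤ m n) → IsAlternating (λ M → f (M ⊡ B))
⊡-isAlternating alt B .≋-cong M≋N = ≋-cong alt λ i k → sum-cong-≗ λ j → cong (_* B j k) (M≋N i j)
⊡-isAlternating alt B .linear i c {L} {M} {N} L≗M L≗N Lᵢ = linear alt i c
  (λ j j≢i k → sum-cong-≗ λ a → cong (_* B a k) (L≗M j j≢i a))
  (λ j j≢i k → sum-cong-≗ λ a → cong (_* B a k) (L≗N j j≢i a))
  λ k → trans
    (sum-cong-≗ λ a → trans (cong (_* B a k) (Lᵢ a)) (expand c (M i a) (N i a) (B a k)))
    (sum-linear c (λ a → M i a * B a k) (λ a → N i a * B a k))
  where
  expand : ∀ c x y z → (c * x + y) * z ≡ c * (x * z) + y * z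
  expand = solve-∀
⊡-isAlternating alt B .adjacent i j i~j Mᵢ≗Mⱼ =
  adjacent alt i j i~j λ k → sum-cong-≗ λ a → cong (_* B a k) (Mᵢ≗Mⱼ a)

-- A row operation. A swap brings the second row to the front, where it is frozen while the
-- induction clears the rows below `u`; after swapping back, the multiple of `u` in the second row
-- contributes a matrix with two equal rows.
shear : {f : Matrix ℤ (suc m) n → ℤ} → IsAlternating f →
        ∀ u R (c : Vector ℤ m) → f (u ∷ λ i k → c i * u k + R i k) ≡ f (u ∷ R)
shear {zero}  alt u R c = ≋-cong alt λ { zero k → refl }
shear {suc m} {f = f} alt u R c = begin
  f (u ∷ λ i k → c i * u k + R i k)                 ≡⟨ ≋-cong alt (λ { zero k → refl ; (suc zero) k → refl ; (suc (suc i)) k → refl }) ⟩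
  f (u ∷ r ∷ λ i k → c (suc i) * u k + R (suc i) k) ≡⟨ swap alt u r _ ⟩
  - f (r ∷ u ∷ λ i k → c (suc i) * u k + R (suc i) k) ≡⟨ cong -_ (≋-cong alt λ { zero k → refl ; (suc zero) k → refl ; (suc (suc i)) k → refl }) ⟩
  - f (r ∷ (u ∷ λ i k → c (suc i) * u k + R (suc i) k)) ≡⟨ cong -_ (shear (∷-isAlternating alt r) u (tail R) (tail c)) ⟩
  - f (r ∷ u ∷ tail R)                              ≡⟨ swap alt u r _ ⟨
  f (u ∷ r ∷ tail R)                                ≡⟨ linear alt (suc zero) (c zero)
      (λ { zero _ k → refl ; (suc zero) 1≢1 → contradiction refl 1≢1 ; (suc (suc i)) _ k → refl })
      (λ { zero _ k → refl ; (suc zero) 1≢1 → contradiction refl 1≢1 ; (suc (suc i)) _ k → refl }) (λ k → refl) ⟩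
  c zero * f (u ∷ u ∷ tail R) + f (u ∷ R zero ∷ tail R)
    ≡⟨ cong₂ (λ x y → c zero * x + y) (adjacent alt zero (suc zero) refl (λ k → refl)) (≋-cong alt λ { zero k → refl ; (suc zero) k → refl ; (suc (suc i)) k → refl }) ⟩
  c zero * 0ℤ + f (u ∷ R)                           ≡⟨ cong (_+ f (u ∷ R)) (ℤ.*-zeroʳ (c zero)) ⟩
  0ℤ + f (u ∷ R)                                    ≡⟨ ℤ.+-identityˡ _ ⟩
  f (u ∷ R)                                         ∎
  where
  r : Vector ℤ _
  r k = c zero * u k + R zero k

move-to-front : {f : Matrix ℤ (suc m) n → ℤ} → IsAlternating f →
                ∀ j M → f (M j ∷ λ i → M (punchIn j i)) ≡ -1ℤ ^ toℕ j * f M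
move-to-front {f = f} alt zero M = trans (≋-cong alt λ { zero k → refl ; (suc i) k → refl }) (sym (ℤ.*-identityˡ (f M)))
move-to-front {m = suc m} {f = f} alt (suc j) M = begin
  f (M (suc j) ∷ λ i → M (punchIn (suc j) i))
    ≡⟨ ≋-cong alt (λ { zero k → refl ; (suc zero) k → refl ; (suc (suc i)) k → refl }) ⟩
  f (M (suc j) ∷ M zero ∷ λ i → M (suc (punchIn j i)))   ≡⟨ swap alt _ _ _ ⟩
  - f (M zero ∷ M (suc j) ∷ λ i → M (suc (punchIn j i))) ≡⟨ cong -_ (move-to-front (∷-isAlternating alt (M zero)) j (tail M)) ⟩
  - (-1ℤ ^ toℕ j * f (M zero ∷ tail M))                  ≡⟨ cong (λ x → - (-1ℤ ^ toℕ j * x)) (≋-cong alt (head∷tail M)) ⟨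
  - (-1ℤ ^ toℕ j * f M)                                  ≡⟨ reassoc (-1ℤ ^ toℕ j) (f M) ⟩
  -1ℤ * -1ℤ ^ toℕ j * f M                                ∎
  where
  reassoc : ∀ x y → - (x * y) ≡ -1ℤ * x * y
  reassoc = solve-∀

linear-expand : (φ : Vector ℤ n → ℤ) → (∀ {u v} → u ≗ v → φ u ≡ φ v) →
                (∀ c u v → φ (λ k → c * u k + v k) ≡ c * φ u + φ v) →
                ∀ v → φ v ≡ sum λ j → v j * φ (δ j)
-- All vectors of length zero agree, so additivity reads `φ v + φ v ≡ φ v`.
linear-expand {zero} φ φ-cong φ-linear v = +-cancelˡ (φ v) _ _ (begin
  φ v + φ v      ≡⟨ cong (_+ φ v) (ℤ.*-identityˡ (φ v)) ⟨
  1ℤ * φ v + φ v ≡⟨ φ-linear 1ℤ v v ⟨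
  φ _            ≡⟨ φ-cong (λ ()) ⟩
  φ v            ≡⟨ ℤ.+-identityʳ _ ⟨
  φ v + 0ℤ       ∎)
linear-expand {suc n} φ φ-cong φ-linear v = begin
  φ v                                                   ≡⟨ φ-cong split ⟩
  φ (λ k → v zero * δ zero k + (0ℤ ∷ tail v) k)         ≡⟨ φ-linear (v zero) (δ zero) (0ℤ ∷ tail v) ⟩
  v zero * φ (δ zero) + φ (0ℤ ∷ tail v)                 ≡⟨ cong (λ z → v zero * φ (δ zero) + z)
    (linear-expand (λ w → φ (0ℤ ∷ w)) (λ u≗v → φ-cong λ { zero → refl ; (suc k) → u≗v k })
      (λ c u w → trans (φ-cong λ { zero → sym (trans (ℤ.+-identityʳ _) (ℤ.*-zeroʳ c)) ; (suc k) → refl }) (φ-linear c _ _))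
      (tail v)) ⟩
  v zero * φ (δ zero) + sum (λ j → v (suc j) * φ (0ℤ ∷ δ j))
    ≡⟨ cong (λ z → v zero * φ (δ zero) + z) (sum-cong-≗ λ j → cong (v (suc j) *_) (φ-cong λ { zero → refl ; (suc k) → refl })) ⟩
  v zero * φ (δ zero) + sum (λ j → v (suc j) * φ (δ (suc j))) ∎
  where
  split : ∀ k → v k ≡ v zero * δ zero k + (0ℤ ∷ tail v) k
  split zero    = sym (trans (ℤ.+-identityʳ _) (ℤ.*-identityʳ _))
  split (suc k) = sym (trans (cong (_+ v (suc k)) (ℤ.*-zeroʳ (v zero))) (ℤ.+-identityˡ _))

minor : Fin (suc n) → Matrix ℤ (suc n) (suc n) → Matrix ℤ n n
minor j M i = removeAt (M (suc i)) j

-- Expand the first row in unit vectors, clear column `j` below the entry by `shear`, and apply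
-- induction to the minor. Only `f` has to be alternating, nothing is assumed of `det`; hence the
-- alternation of `det` itself can later be drawn from this. Multiplicativity, transposition,
-- reindexing and block sums all follow by checking alternation and comparing values at `δ`.
determinant-unique : {f : Matrix ℤ n n → ℤ} → IsAlternating f → ∀ M → f M ≡ det M * f δ
determinant-unique {zero} {f} alt M = trans (≋-cong alt λ ()) (sym (ℤ.*-identityˡ (f δ)))
determinant-unique {suc n} {f} alt M = begin
  f M                                ≡⟨ ≋-cong alt (head∷tail M) ⟩
  f (M zero ∷ tail M)                ≡⟨ linear-expand (λ v → f (v ∷ tail M))
      (λ u≗v → ≋-cong alt λ { zero → u≗v ; (suc i) k → refl })
      (λ c u v → linear alt zero c (λ { zero 0≢0 → contradiction refl 0≢0 ; (suc i) _ k → refl })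
                                   (λ { zero 0≢0 → contradiction refl 0≢0 ; (suc i) _ k → refl }) (λ k → refl))
      (M zero) ⟩
  sum (λ j → M zero j * f (δ j ∷ tail M)) ≡⟨ sum-cong-≗ (λ j → trans (cong (M zero j *_) (cofactor j)) (reorder (M zero j) (det (minor j M)) (-1ℤ ^ toℕ j) (f δ))) ⟩
  sum (λ j → -1ℤ ^ toℕ j * M zero j * det (minor j M) * f δ) ≡⟨ *-distribʳ-sum (f δ) (λ j → -1ℤ ^ toℕ j * M zero j * det (minor j M)) ⟨
  det M * f δ ∎
  where
  reorder : ∀ m d s x → m * (d * (s * x)) ≡ s * m * d * x
  reorder = solve-∀
  -- Multiplying by this on the right puts a zero column back at position `j`, where `minor` removed
  -- one.
  insertion : Fin (suc n) → Matrix ℤ n (suc n)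
  insertion j l = δ (punchIn j l)
  cofactor : ∀ j → f (δ j ∷ tail M) ≡ det (minor j M) * (-1ℤ ^ toℕ j * f δ)
  cofactor j = begin
    f (δ j ∷ tail M)                                              ≡⟨ ≋-cong alt (λ { zero k → refl ; (suc i) k → row (M (suc i)) k }) ⟩
    f (δ j ∷ λ i k → M (suc i) j * δ j k + (minor j M ⊡ insertion j) i k) ≡⟨ shear alt (δ j) _ (λ i → M (suc i) j) ⟩
    f (δ j ∷ minor j M ⊡ insertion j)                             ≡⟨ determinant-unique (⊡-isAlternating (∷-isAlternating alt (δ j)) (insertion j)) (minor j M) ⟩
    det (minor j M) * f (δ j ∷ δ ⊡ insertion j)                   ≡⟨ cong (det (minor j M) *_) (≋-cong alt λ { zero k → refl ; (suc i) k → sum-δˡ i (λ l → insertion j l k) }) ⟩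
    det (minor j M) * f (δ j ∷ λ i → δ (punchIn j i))             ≡⟨ cong (det (minor j M) *_) (move-to-front alt j δ) ⟩
    det (minor j M) * (-1ℤ ^ toℕ j * f δ)                         ∎
    where
    row : ∀ v k → v k ≡ v j * δ j k + sum (λ l → v (punchIn j l) * δ (punchIn j l) k)
    row v k = trans (sym (sum-δʳ k v)) (sum-remove {i = j} (λ l → v l * δ l k))

-- Transposition, multiplicativity and reindexing

det-cong : {M N : Matrix ℤ n n} → M ≋ N → det M ≡ det N
det-cong {zero}  M≋N = refl
det-cong {suc n} M≋N = sum-cong-≗ λ j →
  cong₂ (λ x y → -1ℤ ^ toℕ j * x * y) (M≋N zero j) (det-cong λ i k → M≋N (suc i) (punchIn j k))

det-δ : ∀ n → det (δ {n}) ≡ 1ℤ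
det-δ zero    = refl
det-δ (suc n) = begin
  1ℤ * 1ℤ * det (minor zero (δ {suc n})) + sum {n} (λ j → -1ℤ ^ toℕ (suc j) * 0ℤ * det (minor (suc j) (δ {suc n})))
    ≡⟨ cong₂ (λ x y → 1ℤ * 1ℤ * x + y) (det-δ n) (sum-zero {n} λ j → vanish (-1ℤ ^ toℕ (suc j)) (det (minor (suc j) (δ {suc n})))) ⟩
  1ℤ ∎
  where
  vanish : ∀ x y → x * 0ℤ * y ≡ 0ℤ
  vanish = solve-∀

punchOut-adjacent : ∀ (k i j : Fin (suc n)) (k≢i : k ≢ i) (k≢j : k ≢ j) →
                    Adjacent i j → Adjacent (punchOut k≢i) (punchOut k≢j)
punchOut-adjacent zero zero j k≢i k≢j i~j = contradiction refl k≢i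
punchOut-adjacent zero (suc i) (suc j) k≢i k≢j i~j = ℕ.suc-injective i~j
punchOut-adjacent {suc n} (suc k) zero (suc zero) k≢i k≢j i~j with k
... | zero  = contradiction refl k≢j
... | suc _ with n | k
... | suc _ | _ = refl
punchOut-adjacent {suc n} (suc k) (suc i) (suc j) k≢i k≢j i~j =
  cong suc (punchOut-adjacent k i j (k≢i ∘ cong suc) (k≢j ∘ cong suc) (ℕ.suc-injective i~j))

-- Consequently the minors omitting one or the other of two equal adjacent rows coincide, and their
-- cofactor signs are opposite.
punchIn-adjacent : ∀ (i j : Fin (suc n)) → Adjacent i j → ∀ k →
                   punchIn i k ≡ punchIn j k ⊎ (punchIn i k ≡ j × punchIn j k ≡ i)
punchIn-adjacent zero (suc zero) i~j zero = inj₂ (refl , refl)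
punchIn-adjacent zero (suc zero) i~j (suc k) = inj₁ refl
punchIn-adjacent (suc i) (suc j) i~j zero = inj₁ refl
punchIn-adjacent (suc i) (suc j) i~j (suc k) with punchIn-adjacent i j (ℕ.suc-injective i~j) k
... | inj₁ eq = inj₁ (cong suc eq)
... | inj₂ (eq₁ , eq₂) = inj₂ (cong suc eq₁ , cong suc eq₂)

sum-adjacent : ∀ (i j : Fin n) → Adjacent i j → (t : Vector ℤ n) →
               (∀ k → k ≢ i → k ≢ j → t k ≡ 0ℤ) → t i + t j ≡ 0ℤ → sum t ≡ 0ℤ
sum-adjacent zero (suc zero) i~j t t≡0 cancel = begin
  t zero + (t (suc zero) + sum (tail (tail t))) ≡⟨ ℤ.+-assoc (t zero) _ _ ⟨
  t zero + t (suc zero) + sum (tail (tail t))   ≡⟨ cong₂ _+_ cancel (sum-zero λ k → t≡0 (suc (suc k)) (λ ()) (λ ())) ⟩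
  0ℤ                                            ∎
sum-adjacent (suc i) (suc j) i~j t t≡0 cancel = cong₂ _+_ (t≡0 zero (λ ()) (λ ()))
  (sum-adjacent i j (ℕ.suc-injective i~j) (tail t)
    (λ k k≢i k≢j → t≡0 (suc k) (k≢i ∘ Fin.suc-injective) (k≢j ∘ Fin.suc-injective)) cancel)

-- Laplace expansion along a row makes alternation in the columns accessible: two minors cancel, the others
-- vanish by induction. Alternation in the rows follows since a determinant is unique.
det-transpose-isAlternating : ∀ n → IsAlternating (λ (C : Matrix ℤ n n) → det (transpose C))
det-transpose-isAlternating n .≋-cong M≋N = det-cong λ i j → M≋N j i
det-transpose-isAlternating (suc n) .linear i c {L} {M} {N} L≗M L≗N Lᵢ = trans
  (sum-cong-≗ term)
  (sum-linear c (λ j → -1ℤ ^ toℕ j * M j zero * det (minor j (transpose M))) (λ j → -1ℤ ^ toℕ j * N j zero * det (minor j (transpose N))))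
  where
  at-i : ∀ c s x y d → s * (c * x + y) * d ≡ c * (s * x * d) + s * y * d
  at-i = solve-∀
  off-i : ∀ c s x d e → s * x * (c * d + e) ≡ c * (s * x * d) + s * x * e
  off-i = solve-∀
  term : ∀ j → -1ℤ ^ toℕ j * L j zero * det (minor j (transpose L)) ≡
         c * (-1ℤ ^ toℕ j * M j zero * det (minor j (transpose M))) + -1ℤ ^ toℕ j * N j zero * det (minor j (transpose N))
  term j with j ≟ i
  ... | yes refl = begin
    s * L i zero * det (minor i (transpose L))                    ≡⟨ cong (λ x → s * x * det (minor i (transpose L))) (Lᵢ zero) ⟩
    s * (c * M i zero + N i zero) * det (minor i (transpose L))   ≡⟨ at-i c s (M i zero) (N i zero) _ ⟩
    c * (s * M i zero * det (minor i (transpose L))) + s * N i zero * det (minor i (transpose L))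
      ≡⟨ cong₂ (λ d e → c * (s * M i zero * d) + s * N i zero * e)
           (det-cong λ a b → L≗M (punchIn i b) (Fin.punchInᵢ≢i i b) (suc a))
           (det-cong λ a b → L≗N (punchIn i b) (Fin.punchInᵢ≢i i b) (suc a)) ⟩
    c * (s * M i zero * det (minor i (transpose M))) + s * N i zero * det (minor i (transpose N)) ∎
    where
    s : ℤ
    s = -1ℤ ^ toℕ i
  ... | no j≢i = begin
    s * L j zero * det (minor j (transpose L))
      ≡⟨ cong (s * L j zero *_) (linear (det-transpose-isAlternating n) (punchOut j≢i) c
           (λ b b≢ k → L≗M (punchIn j b) (b≢ ∘ avoid b) (suc k))
           (λ b b≢ k → L≗N (punchIn j b) (b≢ ∘ avoid b) (suc k))
           (λ k → subst (λ z → L z (suc k) ≡ c * M z (suc k) + N z (suc k)) (sym (Fin.punchIn-punchOut j≢i)) (Lᵢ (suc k)))) ⟩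
    s * L j zero * (c * det (minor j (transpose M)) + det (minor j (transpose N)))
      ≡⟨ off-i c s (L j zero) _ _ ⟩
    c * (s * L j zero * det (minor j (transpose M))) + s * L j zero * det (minor j (transpose N))
      ≡⟨ cong₂ (λ x y → c * (s * x * det (minor j (transpose M))) + s * y * det (minor j (transpose N))) (L≗M j j≢i zero) (L≗N j j≢i zero) ⟩
    c * (s * M j zero * det (minor j (transpose M))) + s * N j zero * det (minor j (transpose N)) ∎
    where
    s : ℤ
    s = -1ℤ ^ toℕ j
    avoid : ∀ b → punchIn j b ≡ i → b ≡ punchOut j≢i
    avoid b eq = Fin.punchIn-injective j b _ (trans eq (sym (Fin.punchIn-punchOut j≢i)))
det-transpose-isAlternating (suc n) .adjacent i j {M} i~j Mᵢ≗Mⱼ =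
  sum-adjacent i j i~j _ off (begin
    -1ℤ ^ toℕ i * M i zero * det (minor i (transpose M)) + -1ℤ ^ toℕ j * M j zero * det (minor j (transpose M))
      ≡⟨ cong₂ (λ x y → -1ℤ ^ toℕ i * x * det (minor i (transpose M)) + y)
           (Mᵢ≗Mⱼ zero) (cong₂ (λ x y → x * M j zero * y) (cong (-1ℤ ^_) i~j) (det-cong λ a b → sym (same-minor a b))) ⟩
    -1ℤ ^ toℕ i * M j zero * det (minor i (transpose M)) + -1ℤ * -1ℤ ^ toℕ i * M j zero * det (minor i (transpose M))
      ≡⟨ opposite (-1ℤ ^ toℕ i) (M j zero) (det (minor i (transpose M))) ⟩
    0ℤ ∎)
  where
  opposite : ∀ s x d → s * x * d + -1ℤ * s * x * d ≡ 0ℤ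
  opposite = solve-∀
  same-minor : ∀ a b → M (punchIn i b) (suc a) ≡ M (punchIn j b) (suc a)
  same-minor a b with punchIn-adjacent i j i~j b
  ... | inj₁ eq = cong (λ z → M z (suc a)) eq
  ... | inj₂ (eq₁ , eq₂) = begin
    M (punchIn i b) (suc a) ≡⟨ cong (λ z → M z (suc a)) eq₁ ⟩
    M j (suc a)             ≡⟨ Mᵢ≗Mⱼ (suc a) ⟨
    M i (suc a)             ≡⟨ cong (λ z → M z (suc a)) eq₂ ⟨
    M (punchIn j b) (suc a) ∎
  off : ∀ k → k ≢ i → k ≢ j → -1ℤ ^ toℕ k * M k zero * det (minor k (transpose M)) ≡ 0ℤ
  off k k≢i k≢j = trans
    (cong (-1ℤ ^ toℕ k * M k zero *_)
      (adjacent (det-transpose-isAlternating n) (punchOut k≢i) (punchOut k≢j) (punchOut-adjacent k i j k≢i k≢j i~j)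
        λ a → subst₂ (λ x y → M x (suc a) ≡ M y (suc a)) (sym (Fin.punchIn-punchOut k≢i)) (sym (Fin.punchIn-punchOut k≢j)) (Mᵢ≗Mⱼ (suc a))))
    (ℤ.*-zeroʳ (-1ℤ ^ toℕ k * M k zero))

det-transpose : (M : Matrix ℤ n n) → det (transpose M) ≡ det M
det-transpose {n} M = begin
  det (transpose M)           ≡⟨ determinant-unique (det-transpose-isAlternating n) M ⟩
  det M * det (transpose (δ {n})) ≡⟨ cong (det M *_) (trans (det-cong {M = transpose (δ {n})} {δ} λ i j → δ-sym j i) (det-δ n)) ⟩
  det M * 1ℤ                  ≡⟨ ℤ.*-identityʳ _ ⟩
  det M                       ∎

det-isAlternating : ∀ n → IsAlternating (det {n})
det-isAlternating n .≋-cong = det-cong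
det-isAlternating n .linear i c {L} {M} {N} L≗M L≗N Lᵢ = begin
  det L                 ≡⟨ det-transpose L ⟨
  det (transpose L)     ≡⟨ linear (det-transpose-isAlternating n) i c L≗M L≗N Lᵢ ⟩
  c * det (transpose M) + det (transpose N) ≡⟨ cong₂ (λ x y → c * x + y) (det-transpose M) (det-transpose N) ⟩
  c * det M + det N     ∎
det-isAlternating n .adjacent i j {M} i~j Mᵢ≗Mⱼ =
  trans (sym (det-transpose M)) (adjacent (det-transpose-isAlternating n) i j i~j Mᵢ≗Mⱼ)

det-⊡ : (M N : Matrix ℤ n n) → det (M ⊡ N) ≡ det M * det N
det-⊡ {n} M N = trans (determinant-unique (⊡-isAlternating (det-isAlternating n) N) M)
  (cong (det M *_) (det-cong {M = δ ⊡ N} {N} λ i k → sum-δˡ i λ j → N j k))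

-- The left side alternates in the rows of `M` and is 1 at `δ`. The two sizes are kept apart because
-- an arbitrary listing of a group has a length that is not definitionally the size of the
-- coordinate set.
det-reindex : (σ : Fin m → Fin n) (σ⁻¹ : Fin n → Fin m) → (∀ i → σ⁻¹ (σ i) ≡ i) → (∀ j → σ (σ⁻¹ j) ≡ j) →
              ∀ M → det (λ i j → M (σ i) (σ j)) ≡ det M
det-reindex {m} {n} σ σ⁻¹ σ⁻¹∘σ σ∘σ⁻¹ M = begin
  det (λ i j → M (σ i) (σ j))         ≡⟨ determinant-unique alt M ⟩
  det M * det (λ i j → δ (σ i) (σ j)) ≡⟨ cong (det M *_) (trans (det-cong σ-δ) (det-δ m)) ⟩
  det M * 1ℤ                          ≡⟨ ℤ.*-identityʳ _ ⟩
  det M                               ∎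
  where
  σ-injective : ∀ {i j} → σ i ≡ σ j → i ≡ j
  σ-injective {i} {j} eq = trans (sym (σ⁻¹∘σ i)) (trans (cong σ⁻¹ eq) (σ⁻¹∘σ j))
  σ⁻¹-injective : ∀ {i j} → σ⁻¹ i ≡ σ⁻¹ j → i ≡ j
  σ⁻¹-injective {i} {j} eq = trans (sym (σ∘σ⁻¹ i)) (trans (cong σ eq) (σ∘σ⁻¹ j))
  σ-δ : ∀ i j → δ (σ i) (σ j) ≡ δ i j
  σ-δ i j with i ≟ j
  ... | yes refl = trans (δ-refl (σ i)) (sym (δ-refl i))
  ... | no i≢j   = trans (δ-≢ (i≢j ∘ σ-injective)) (sym (δ-≢ i≢j))
  alt : IsAlternating (λ M → det (λ i j → M (σ i) (σ j)))
  alt .≋-cong M≋N = det-cong λ i j → M≋N (σ i) (σ j)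
  alt .linear i c {L} {M} {N} L≗M L≗N Lᵢ = linear (det-isAlternating m) (σ⁻¹ i) c
    (λ j j≢ k → L≗M (σ j) (λ eq → j≢ (trans (sym (σ⁻¹∘σ j)) (cong σ⁻¹ eq))) (σ k))
    (λ j j≢ k → L≗N (σ j) (λ eq → j≢ (trans (sym (σ⁻¹∘σ j)) (cong σ⁻¹ eq))) (σ k))
    (λ k → subst (λ z → L z (σ k) ≡ c * M z (σ k) + N z (σ k)) (sym (σ∘σ⁻¹ i)) (Lᵢ (σ k)))
  alt .adjacent i j {M} i~j Mᵢ≗Mⱼ =
    -- Adjacent rows may be moved far apart by `σ⁻¹`, hence the general form of alternation.
    alternates (det-isAlternating m) {i = σ⁻¹ i} {σ⁻¹ j}
      (λ eq → ℕ.1+n≢n (sym (trans (cong toℕ (σ⁻¹-injective eq)) i~j)))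
      (λ k → subst₂ (λ x y → M x (σ k) ≡ M y (σ k)) (sym (σ∘σ⁻¹ i)) (sym (σ∘σ⁻¹ j)) (Mᵢ≗Mⱼ (σ k)))

-- Replacing rows and columns

setRow : Fin m → Vector ℤ n → Matrix ℤ m n → Matrix ℤ m n
setRow b w M i with i ≟ b
... | yes _ = w
... | no  _ = M i

setRow-≡ : ∀ (b : Fin m) (w : Vector ℤ n) M → setRow b w M b ≗ w
setRow-≡ b w M j with b ≟ b
... | yes _  = refl
... | no b≢b = contradiction refl b≢b

setRow-≢ : ∀ (b : Fin m) (w : Vector ℤ n) M {i} → i ≢ b → setRow b w M i ≗ M i
setRow-≢ b w M {i} i≢b j with i ≟ b
... | yes i≡b = contradiction i≡b i≢b
... | no _    = refl

-- Cramer's rule. Both sides are linear in `v`; at the unit vector `δ i` the new matrix is `M` if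
-- `i` is `b` and has two equal rows otherwise.
det-replace-row : ∀ (b : Fin n) (v : Vector ℤ n) (M N : Matrix ℤ n n) → (∀ i → i ≢ b → N i ≗ M i) →
                  (∀ j → N b j ≡ sum λ i → v i * M i j) → det N ≡ v b * det M
det-replace-row {n} b v M N N≗M N[b] = begin
  det N                                   ≡⟨ det-cong N≋ ⟩
  φ v                                     ≡⟨ linear-expand φ φ-cong φ-linear v ⟩
  sum (λ i → v i * φ (δ i))               ≡⟨ sum-cong-≗ (λ i → trans (cong (v i *_) (φ-δ i)) (sym (ℤ.*-assoc (v i) (δ i b) (det M)))) ⟩
  sum (λ i → v i * δ i b * det M)         ≡⟨ *-distribʳ-sum (det M) (λ i → v i * δ i b) ⟨
  sum (λ i → v i * δ i b) * det M         ≡⟨ cong (_* det M) (sum-δʳ b v) ⟩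
  v b * det M                             ∎
  where
  combination : Vector ℤ n → Vector ℤ n
  combination w j = sum λ i → w i * M i j
  replaced : Vector ℤ n → Matrix ℤ n n
  replaced w = setRow b (combination w) M
  φ : Vector ℤ n → ℤ
  φ w = det (replaced w)
  N≋ : N ≋ replaced v
  N≋ i j with i ≟ b
  ... | yes refl = N[b] j
  ... | no i≢b   = N≗M i i≢b j
  φ-cong : ∀ {u w} → u ≗ w → φ u ≡ φ w
  φ-cong {u} {w} u≗w = det-cong λ i j → eq i j
    where
    eq : replaced u ≋ replaced w
    eq i j with i ≟ b
    ... | yes _ = sum-cong-≗ λ i → cong (_* M i j) (u≗w i)
    ... | no  _ = refl
  φ-linear : ∀ c u w → φ (λ k → c * u k + w k) ≡ c * φ u + φ w
  φ-linear c u w = linear (det-isAlternating n) b c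
    (λ i i≢b k → trans (setRow-≢ b (combination (λ i → c * u i + w i)) M i≢b k) (sym (setRow-≢ b (combination u) M i≢b k)))
    (λ i i≢b k → trans (setRow-≢ b (combination (λ i → c * u i + w i)) M i≢b k) (sym (setRow-≢ b (combination w) M i≢b k)))
    λ k → trans (setRow-≡ b (combination (λ i → c * u i + w i)) M k) (trans
      (trans (sum-cong-≗ λ i → expand c (u i) (w i) (M i k)) (sum-linear c (λ i → u i * M i k) (λ i → w i * M i k)))
      (sym (cong₂ (λ x y → c * x + y) (setRow-≡ b (combination u) M k) (setRow-≡ b (combination w) M k))))
    where
    expand : ∀ c x y z → (c * x + y) * z ≡ c * (x * z) + y * z
    expand = solve-∀
  φ-δ : ∀ i → φ (δ i) ≡ δ i b * det M
  φ-δ i with i ≟ b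
  ... | yes refl = trans (det-cong eq) (sym (trans (cong (_* det M) (δ-refl i)) (ℤ.*-identityˡ (det M))))
    where
    eq : replaced (δ i) ≋ M
    eq a j with a ≟ i
    ... | yes refl = sum-δˡ i (λ k → M k j)
    ... | no _     = refl
  ... | no i≢b = trans
    (alternates (det-isAlternating n) i≢b λ k →
      trans (setRow-≢ b (combination (δ i)) M i≢b k) (sym (trans (setRow-≡ b (combination (δ i)) M k) (sum-δˡ i (λ a → M a k)))))
    (sym (trans (cong (_* det M) (δ-≢ i≢b)) (ℤ.*-zeroˡ (det M))))

det-replace-column : ∀ (b : Fin n) (v : Vector ℤ n) (M N : Matrix ℤ n n) → (∀ i j → j ≢ b → N i j ≡ M i j) →
                     (∀ i → N i b ≡ sum λ j → M i j * v j) → det N ≡ v b * det M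
det-replace-column b v M N N≗M N[b] = begin
  det N                   ≡⟨ det-transpose N ⟨
  det (transpose N)       ≡⟨ det-replace-row b v (transpose M) (transpose N) (λ j j≢b i → N≗M i j j≢b)
                               (λ i → trans (N[b] i) (sum-cong-≗ λ j → ℤ.*-comm (M i j) (v j))) ⟩
  v b * det (transpose M) ≡⟨ cong (v b *_) (det-transpose M) ⟩
  v b * det M             ∎

-- This extracts a known factor without division. The intermediate matrix `N` has column `b` equal
-- to `c w`: it arises from `M` as the combination of columns given by `v`, and from the matrix with
-- column `w` by scaling.
det-column-image : ∀ (b : Fin n) (v : Vector ℤ n) (c : ℤ) (w : Vector ℤ n) (M : Matrix ℤ n n) →
                   v b ≡ 1ℤ → (∀ i → sum (λ j → M i j * v j) ≡ c * w i) →
                   det M ≡ c * det (transpose (setRow b w (transpose M)))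
det-column-image {n} b v c w M v[b] Mv = begin
  det M             ≡⟨ ℤ.*-identityˡ (det M) ⟨
  1ℤ * det M        ≡⟨ cong (_* det M) v[b] ⟨
  v b * det M       ≡⟨ det-replace-column b v M N (λ i j j≢b → setRow-≢ b (λ i → c * w i) (transpose M) j≢b i)
                         (λ i → trans (setRow-≡ b (λ i → c * w i) (transpose M) i) (sym (Mv i))) ⟨
  det N             ≡⟨ det-replace-column b (λ j → c * δ j b) M′ N
                         (λ i j j≢b → trans (setRow-≢ b (λ i → c * w i) (transpose M) j≢b i) (sym (setRow-≢ b w (transpose M) j≢b i)))
                         (λ i → trans (setRow-≡ b (λ i → c * w i) (transpose M) i) (sym (column i))) ⟩
  c * δ b b * det M′ ≡⟨ cong (_* det M′) (trans (cong (c *_) (δ-refl b)) (ℤ.*-identityʳ c)) ⟩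
  c * det M′        ∎
  where
  N M′ : Matrix ℤ n n
  N = transpose (setRow b (λ i → c * w i) (transpose M))
  M′ = transpose (setRow b w (transpose M))
  column : ∀ i → sum (λ j → M′ i j * (c * δ j b)) ≡ c * w i
  column i = begin
    sum (λ j → M′ i j * (c * δ j b)) ≡⟨ sum-cong-≗ (λ j → sym (ℤ.*-assoc (M′ i j) c (δ j b))) ⟩
    sum (λ j → M′ i j * c * δ j b)   ≡⟨ sum-δʳ b (λ j → M′ i j * c) ⟩
    M′ i b * c                       ≡⟨ cong (_* c) (setRow-≡ b w (transpose M) i) ⟩
    w i * c                          ≡⟨ ℤ.*-comm (w i) c ⟩
    c * w i                          ∎

det-scalar : ∀ n c → det {n} (λ i j → c * δ i j) ≡ c ^ n
det-scalar zero    c = refl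
det-scalar (suc n) c = begin
  1ℤ * (c * 1ℤ) * det {n} (λ i j → c * δ i j) + sum {n} (λ j → -1ℤ ^ toℕ (suc j) * (c * 0ℤ) * det (minor (suc j) (λ i k → c * δ {suc n} i k)))
    ≡⟨ cong₂ (λ x y → 1ℤ * (c * 1ℤ) * x + y) (det-scalar n c)
         (sum-zero {n} λ j → vanish c (-1ℤ ^ toℕ (suc j)) (det (minor (suc j) (λ i k → c * δ {suc n} i k)))) ⟩
  1ℤ * (c * 1ℤ) * c ^ n + 0ℤ ≡⟨ tidy c (c ^ n) ⟩
  c * c ^ n ∎
  where
  vanish : ∀ c x y → x * (c * 0ℤ) * y ≡ 0ℤ
  vanish = solve-∀
  tidy : ∀ x y → 1ℤ * (x * 1ℤ) * y + 0ℤ ≡ x * y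
  tidy = solve-∀

-- Block-diagonal matrices

blocks : Matrix ℤ m m → Matrix ℤ n n → Fin m ⊎ Fin n → Fin m ⊎ Fin n → ℤ
blocks X Y (inj₁ i) (inj₁ j) = X i j
blocks X Y (inj₁ i) (inj₂ j) = 0ℤ
blocks X Y (inj₂ i) (inj₁ j) = 0ℤ
blocks X Y (inj₂ i) (inj₂ j) = Y i j

infixr 6 _⊕_
_⊕_ : Matrix ℤ m m → Matrix ℤ n n → Matrix ℤ (m ℕ.+ n) (m ℕ.+ n)
_⊕_ {m} X Y i j = blocks X Y (Fin.splitAt m i) (Fin.splitAt m j)

det-δ⊕ : ∀ m (Y : Matrix ℤ n n) → det (δ {m} ⊕ Y) ≡ det Y
det-δ⊕ zero    Y = det-cong {M = δ {zero} ⊕ Y} {Y} λ i j → refl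
det-δ⊕ {n} (suc m) Y = begin
  1ℤ * 1ℤ * det (minor zero (δ {suc m} ⊕ Y)) + sum {m ℕ.+ n} (λ j → -1ℤ ^ toℕ (suc j) * (δ {suc m} ⊕ Y) zero (suc j) * det (minor (suc j) (δ {suc m} ⊕ Y)))
    ≡⟨ cong₂ (λ x y → 1ℤ * 1ℤ * x + y)
        (trans (det-cong inner) (det-δ⊕ m Y))
        (sum-zero {m ℕ.+ n} λ j → trans (cong (λ x → -1ℤ ^ toℕ (suc j) * x * det (minor (suc j) (δ {suc m} ⊕ Y))) (off j))
                                        (vanish (-1ℤ ^ toℕ (suc j)) (det (minor (suc j) (δ {suc m} ⊕ Y))))) ⟩
  1ℤ * 1ℤ * det Y + 0ℤ ≡⟨ tidy (det Y) ⟩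
  det Y ∎
  where
  vanish : ∀ x y → x * 0ℤ * y ≡ 0ℤ
  vanish = solve-∀
  tidy : ∀ y → 1ℤ * 1ℤ * y + 0ℤ ≡ y
  tidy = solve-∀
  off : ∀ j → (δ {suc m} ⊕ Y) zero (suc j) ≡ 0ℤ
  off j with Fin.splitAt m j
  ... | inj₁ _ = refl
  ... | inj₂ _ = refl
  inner : minor zero (δ {suc m} ⊕ Y) ≋ δ {m} ⊕ Y
  inner i j with Fin.splitAt m i | Fin.splitAt m j
  ... | inj₁ _ | inj₁ _ = refl
  ... | inj₁ _ | inj₂ _ = refl
  ... | inj₂ _ | inj₁ _ = refl
  ... | inj₂ _ | inj₂ _ = refl

-- For fixed `Y` the left side is alternating in `X`, so uniqueness leaves only the case `X = δ`.
det-⊕ : ∀ (X : Matrix ℤ m m) (Y : Matrix ℤ n n) → det (X ⊕ Y) ≡ det X * det Y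
det-⊕ {m} {n} X Y = trans (determinant-unique alt X) (cong (det X *_) (det-δ⊕ m Y))
  where
  row-agree : ∀ (i : Fin m) {X X′ : Matrix ℤ m m} → (∀ j → j ≢ i → X j ≗ X′ j) →
              ∀ j → j ≢ i Fin.↑ˡ n → (X ⊕ Y) j ≗ (X′ ⊕ Y) j
  row-agree i agree j j≢i k with Fin.splitAt m j in eq | Fin.splitAt m k
  ... | inj₁ j′ | inj₁ k′ = agree j′ (λ { refl → j≢i (sym (Fin.splitAt⁻¹-↑ˡ eq)) }) k′
  ... | inj₁ _ | inj₂ _ = refl
  ... | inj₂ _ | inj₁ _ = refl
  ... | inj₂ _ | inj₂ _ = refl
  alt : IsAlternating (λ X → det (X ⊕ Y))
  alt .≋-cong {X} {X′} X≋X′ = det-cong eq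
    where
    eq : X ⊕ Y ≋ X′ ⊕ Y
    eq i j with Fin.splitAt m i | Fin.splitAt m j
    ... | inj₁ i | inj₁ j = X≋X′ i j
    ... | inj₁ _ | inj₂ _ = refl
    ... | inj₂ _ | inj₁ _ = refl
    ... | inj₂ _ | inj₂ _ = refl
  alt .linear i c {L} {M} {N} L≗M L≗N Lᵢ = linear (det-isAlternating (m ℕ.+ n)) (i Fin.↑ˡ n) c
    (row-agree i L≗M) (row-agree i L≗N) row
    where
    row : ∀ k → (L ⊕ Y) (i Fin.↑ˡ n) k ≡ c * (M ⊕ Y) (i Fin.↑ˡ n) k + (N ⊕ Y) (i Fin.↑ˡ n) k
    row k rewrite Fin.splitAt-↑ˡ m i n with Fin.splitAt m k
    ... | inj₁ k = Lᵢ k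
    ... | inj₂ _ = sym (trans (ℤ.+-identityʳ (c * 0ℤ)) (ℤ.*-zeroʳ c))
  alt .adjacent i j {M} i~j Mᵢ≗Mⱼ = adjacent (det-isAlternating (m ℕ.+ n)) (i Fin.↑ˡ n) (j Fin.↑ˡ n)
    (trans (Fin.toℕ-↑ˡ j n) (trans i~j (cong suc (sym (Fin.toℕ-↑ˡ i n))))) row
    where
    row : ∀ k → (M ⊕ Y) (i Fin.↑ˡ n) k ≡ (M ⊕ Y) (j Fin.↑ˡ n) k
    row k rewrite Fin.splitAt-↑ˡ m i n | Fin.splitAt-↑ˡ m j n with Fin.splitAt m k
    ... | inj₁ k = Mᵢ≗Mⱼ k
    ... | inj₂ _ = refl

flatten : (Fin m × Fin n → Fin m × Fin n → ℤ) → Matrix ℤ (m ℕ.* n) (m ℕ.* n)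
flatten {m} {n} M i j = M (Fin.remQuot {m} n i) (Fin.remQuot {m} n j)

blockDiagonal : (Fin m → Matrix ℤ n n) → Fin m × Fin n → Fin m × Fin n → ℤ
blockDiagonal X (d , i) (e , j) = δ d e * X d i j

-- `remQuot` makes the first coordinate the slow one, so the block of `zero` occupies the leading
-- `n` rows and columns.
det-blockDiagonal-∷ : (X : Fin (suc m) → Matrix ℤ n n) →
  det (flatten (blockDiagonal X)) ≡ det (X zero) * det (flatten (blockDiagonal (X ∘ suc)))
det-blockDiagonal-∷ {m} {n} X = trans (det-cong eq) (det-⊕ (X zero) (flatten (blockDiagonal (X ∘ suc))))
  where
  eq : flatten (blockDiagonal X) ≋ X zero ⊕ flatten (blockDiagonal (X ∘ suc))
  eq i j with Fin.splitAt n i | Fin.splitAt n j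
  ... | inj₁ i | inj₁ j = ℤ.*-identityˡ (X zero i j)
  ... | inj₁ i | inj₂ j = ℤ.*-zeroˡ (X zero i (proj₂ (Fin.remQuot {m} n j)))
  ... | inj₂ i | inj₁ j = ℤ.*-zeroˡ (X (suc (proj₁ (Fin.remQuot {m} n i))) (proj₂ (Fin.remQuot {m} n i)) j)
  ... | inj₂ _ | inj₂ _ = refl

det-blockDiagonal-const : (X : Fin m → Matrix ℤ n n) (c : ℤ) → (∀ d → det (X d) ≡ c) →
                          det (flatten (blockDiagonal X)) ≡ c ^ m
det-blockDiagonal-const {zero}  X c det≡c = refl
det-blockDiagonal-const {suc m} X c det≡c = trans (det-blockDiagonal-∷ X)
  (cong₂ _*_ (det≡c zero) (det-blockDiagonal-const (X ∘ suc) c (det≡c ∘ suc)))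

sum-splitAt : ∀ m {n} (h : Fin m ⊎ Fin n → ℤ) →
              sum (λ i → h (Fin.splitAt m i)) ≡ sum (λ i → h (inj₁ i)) + sum (λ j → h (inj₂ j))
sum-splitAt zero    h = sym (ℤ.+-identityˡ _)
sum-splitAt (suc m) {n} h = trans
  (cong (λ z → h (inj₁ zero) + z) (trans (sum-cong-≗ (λ i → cong h (refl {x = Fin.splitAt (suc m) (suc i)})))
    (sum-splitAt m (h ∘ Sum.map suc id))))
  (sym (ℤ.+-assoc (h (inj₁ zero)) _ _))

sum-remQuot : (h : Fin m × Fin n → ℤ) →
              sum (λ p → h (Fin.remQuot {m} n p)) ≡ sum (λ i → sum (λ j → h (i , j)))
sum-remQuot {zero}  h = refl
sum-remQuot {suc m} {n} h = begin
  sum (λ p → h (Fin.remQuot {suc m} n p))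
    ≡⟨ sum-splitAt n (λ s → h (Product.swap (Sum.[ (_, zero) , Product.map₂ suc ∘ Fin.quotRem {m} n ]′ s))) ⟩
  sum (λ j → h (zero , j)) + sum (λ p → h′ (Fin.remQuot {m} n p))
    ≡⟨ cong (λ z → sum (λ j → h (zero , j)) + z) (sum-remQuot h′) ⟩
  sum (λ j → h (zero , j)) + sum (λ i → sum (λ j → h (suc i , j))) ∎
  where
  h′ : Fin m × Fin n → ℤ
  h′ p = h (suc (proj₁ p) , proj₂ p)

δ-remQuot : ∀ (p q : Fin (m ℕ.* n)) →
            δ p q ≡ δ (proj₁ (Fin.remQuot {m} n p)) (proj₁ (Fin.remQuot {m} n q)) * δ (proj₂ (Fin.remQuot {m} n p)) (proj₂ (Fin.remQuot {m} n q))
δ-remQuot {m} {n} p q with p ≟ q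
... | yes refl = trans (δ-refl p) (sym (cong₂ _*_ (δ-refl (proj₁ (Fin.remQuot {m} n p))) (δ-refl (proj₂ (Fin.remQuot {m} n p)))))
... | no p≢q with proj₁ (Fin.remQuot {m} n p) ≟ proj₁ (Fin.remQuot {m} n q)
...   | no  b≢c = trans (δ-≢ p≢q) (sym (cong (_* δ (proj₂ (Fin.remQuot {m} n p)) (proj₂ (Fin.remQuot {m} n q))) (δ-≢ b≢c)))
...   | yes b≡c = trans (δ-≢ p≢q) (sym (trans
  (cong (δ (proj₁ (Fin.remQuot {m} n p)) (proj₁ (Fin.remQuot {m} n q)) *_) (δ-≢ λ a≡e → p≢q
    (trans (sym (Fin.combine-remQuot {m} n p)) (trans (cong₂ Fin.combine b≡c a≡e) (Fin.combine-remQuot {m} n q)))))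
  (ℤ.*-zeroʳ (δ (proj₁ (Fin.remQuot {m} n p)) (proj₁ (Fin.remQuot {m} n q))))))

sum-reindex : (σ : Fin m → Fin n) (σ⁻¹ : Fin n → Fin m) → (∀ i → σ⁻¹ (σ i) ≡ i) → (∀ j → σ (σ⁻¹ j) ≡ j) →
              ∀ t → sum (λ i → t (σ i)) ≡ sum t
sum-reindex σ σ⁻¹ σ⁻¹∘σ σ∘σ⁻¹ t = sym (sum-permute t (permutation σ σ⁻¹ σ∘σ⁻¹ σ⁻¹∘σ))

-- Addition modulo r on Fin r

module Cyclic (r : ℕ) .{{_ : ℕ.NonZero r}} where

  [_] : ℕ → Fin r
  [ n ] = n ℕ.mod r

  toℕ-[] : ∀ n → toℕ [ n ] ≡ n ℕ.% r
  toℕ-[] n = Fin.toℕ-fromℕ< (ℕ.m%n<n n r)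

  []-≡ : ∀ {a b} → a ℕ.% r ≡ b ℕ.% r → [ a ] ≡ [ b ]
  []-≡ {a} {b} eq = Fin.toℕ-injective (trans (toℕ-[] a) (trans eq (sym (toℕ-[] b))))

  [toℕ] : ∀ i → [ toℕ i ] ≡ i
  [toℕ] i = Fin.toℕ-injective (trans (toℕ-[] (toℕ i)) (ℕ.m<n⇒m%n≡m (Fin.toℕ<n i)))

  infixl 6 _⊹_ _⊖_
  infix 8 ⊝_

  _⊹_ : Fin r → Fin r → Fin r
  i ⊹ j = [ toℕ i ℕ.+ toℕ j ]

  ⊝_ : Fin r → Fin r
  ⊝ i = [ r ∸ toℕ i ]

  _⊖_ : Fin r → Fin r → Fin r
  i ⊖ j = i ⊹ ⊝ j

  ⓪ : Fin r
  ⓪ = [ 0 ]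

  []-+ : ∀ a b → [ a ] ⊹ [ b ] ≡ [ a ℕ.+ b ]
  []-+ a b = []-≡ (trans (cong₂ (λ x y → (x ℕ.+ y) ℕ.% r) (toℕ-[] a) (toℕ-[] b)) (sym (ℕ.%-distribˡ-+ a b r)))

  [r]≡⓪ : [ r ] ≡ ⓪
  [r]≡⓪ = []-≡ (trans (ℕ.n%n≡0 r) (sym (ℕ.m*n%n≡0 0 r)))

  ⊹-comm : ∀ i j → i ⊹ j ≡ j ⊹ i
  ⊹-comm i j = cong [_] (ℕ.+-comm (toℕ i) (toℕ j))

  ⊹-assoc : ∀ i j k → (i ⊹ j) ⊹ k ≡ i ⊹ (j ⊹ k)
  ⊹-assoc i j k = begin
    (i ⊹ j) ⊹ k                         ≡⟨ cong ((i ⊹ j) ⊹_) ([toℕ] k) ⟨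
    (i ⊹ j) ⊹ [ toℕ k ]                 ≡⟨ []-+ _ _ ⟩
    [ toℕ i ℕ.+ toℕ j ℕ.+ toℕ k ]       ≡⟨ cong [_] (ℕ.+-assoc (toℕ i) _ _) ⟩
    [ toℕ i ℕ.+ (toℕ j ℕ.+ toℕ k) ]     ≡⟨ []-+ _ _ ⟨
    [ toℕ i ] ⊹ (j ⊹ k)                 ≡⟨ cong (_⊹ (j ⊹ k)) ([toℕ] i) ⟩
    i ⊹ (j ⊹ k)                         ∎

  ⊹-identityʳ : ∀ i → i ⊹ ⓪ ≡ i
  ⊹-identityʳ i = begin
    i ⊹ ⓪               ≡⟨ cong (_⊹ ⓪) ([toℕ] i) ⟨
    [ toℕ i ] ⊹ [ 0 ]   ≡⟨ []-+ _ _ ⟩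
    [ toℕ i ℕ.+ 0 ]     ≡⟨ cong [_] (ℕ.+-identityʳ _) ⟩
    [ toℕ i ]           ≡⟨ [toℕ] i ⟩
    i                   ∎

  ⊹-inverseʳ : ∀ i → i ⊖ i ≡ ⓪
  ⊹-inverseʳ i = begin
    i ⊹ ⊝ i                     ≡⟨ cong (_⊹ ⊝ i) ([toℕ] i) ⟨
    [ toℕ i ] ⊹ [ r ∸ toℕ i ]   ≡⟨ []-+ _ _ ⟩
    [ toℕ i ℕ.+ (r ∸ toℕ i) ]   ≡⟨ cong [_] (ℕ.m+[n∸m]≡n (ℕ.<⇒≤ (Fin.toℕ<n i))) ⟩
    [ r ]                       ≡⟨ [r]≡⓪ ⟩
    ⓪                           ∎

  ⊹-abelianGroup : AbelianGroup _ _
  ⊹-abelianGroup = record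
    { Carrier = Fin r ; _≈_ = _≡_ ; _∙_ = _⊹_ ; ε = ⓪ ; _⁻¹ = ⊝_
    ; isAbelianGroup = record
      { isGroup = record
        { isMonoid = record
          { isSemigroup = record
            { isMagma = record { isEquivalence = isEquivalence ; ∙-cong = cong₂ _⊹_ }
            ; assoc = ⊹-assoc
            }
          ; identity = (λ i → trans (⊹-comm ⓪ i) (⊹-identityʳ i)) , ⊹-identityʳ
          }
        ; inverse = (λ i → trans (⊹-comm (⊝ i) i) (⊹-inverseʳ i)) , ⊹-inverseʳ
        ; ⁻¹-cong = cong ⊝_
        }
      ; comm = ⊹-comm
      }
    }

  open AbelianGroup ⊹-abelianGroup public using () renaming (identityˡ to ⊹-identityˡ; inverseˡ to ⊹-inverseˡ)
  open AbelianGroupProperties ⊹-abelianGroup public using ()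
    renaming (∙-cancelʳ to ⊹-cancelʳ; ∙-cancelˡ to ⊹-cancelˡ; ⁻¹-involutive to ⊝-involutive; ⁻¹-∙-comm to ⊝-⊹-comm; ε⁻¹≈ε to ⊝-⓪)

  ⊖-⊹-cancel : ∀ i j → i ⊖ j ⊹ j ≡ i
  ⊖-⊹-cancel i j = trans (⊹-assoc i (⊝ j) j) (trans (cong (i ⊹_) (⊹-inverseˡ j)) (⊹-identityʳ i))

  ⊹-⊖-cancel : ∀ i j → i ⊹ j ⊖ j ≡ i
  ⊹-⊖-cancel i j = trans (⊹-assoc i j (⊝ j)) (trans (cong (i ⊹_) (⊹-inverseʳ j)) (⊹-identityʳ i))

  ⊝-⊖ : ∀ i j → ⊝ (i ⊖ j) ≡ j ⊖ i
  ⊝-⊖ i j = trans (sym (⊝-⊹-comm i (⊝ j))) (trans (cong (⊝ i ⊹_) (⊝-involutive j)) (⊹-comm (⊝ i) j))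

  ⊖-⊖ : ∀ i j → i ⊖ (i ⊖ j) ≡ j
  ⊖-⊖ i j = trans (cong (i ⊹_) (⊝-⊖ i j)) (trans (⊹-comm i (j ⊖ i)) (⊖-⊹-cancel j i))

  ⊹-⊖-⊹ : ∀ i j k → (i ⊹ k) ⊖ (j ⊹ k) ≡ i ⊖ j
  ⊹-⊖-⊹ i j k = ⊹-cancelʳ (j ⊹ k) _ _ (begin
    (i ⊹ k) ⊖ (j ⊹ k) ⊹ (j ⊹ k) ≡⟨ ⊖-⊹-cancel (i ⊹ k) (j ⊹ k) ⟩
    i ⊹ k                       ≡⟨ cong (_⊹ k) (⊖-⊹-cancel i j) ⟨
    i ⊖ j ⊹ j ⊹ k               ≡⟨ ⊹-assoc (i ⊖ j) j k ⟩
    i ⊖ j ⊹ (j ⊹ k)             ∎)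

  sum-⊹ : ∀ k (t : Vector ℤ r) → sum (λ i → t (i ⊹ k)) ≡ sum t
  sum-⊹ k = sum-reindex (_⊹ k) (_⊖ k) (λ i → ⊹-⊖-cancel i k) (λ i → ⊖-⊹-cancel i k)

  sum-⊖ˡ : ∀ k (t : Vector ℤ r) → sum (λ i → t (k ⊖ i)) ≡ sum t
  sum-⊖ˡ k = sum-reindex (k ⊖_) (k ⊖_) (⊖-⊖ k) (⊖-⊖ k)

  sum-⊖ʳ : ∀ k (t : Vector ℤ r) → sum (λ i → t (i ⊖ k)) ≡ sum t
  sum-⊖ʳ k = sum-⊹ (⊝ k)

  circulant : Vector ℤ r → Matrix ℤ r r
  circulant s x a = s (x ⊖ a)

-- Characters of elementary abelian 2-groups

module ElementaryAbelian {n} (_⊞_ : Fin n → Fin n → Fin n) (⓪ : Fin n)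
  (⊞-comm : ∀ x y → x ⊞ y ≡ y ⊞ x) (⊞-assoc : ∀ x y z → (x ⊞ y) ⊞ z ≡ x ⊞ (y ⊞ z))
  (⊞-identityˡ : ∀ x → ⓪ ⊞ x ≡ x) (⊞-self : ∀ x → x ⊞ x ≡ ⓪) where

  ⊞-identityʳ : ∀ x → x ⊞ ⓪ ≡ x
  ⊞-identityʳ x = trans (⊞-comm x ⓪) (⊞-identityˡ x)

  ⊞-cancelˡ : ∀ x y → x ⊞ (x ⊞ y) ≡ y
  ⊞-cancelˡ x y = trans (sym (⊞-assoc x x y)) (trans (cong (_⊞ y) (⊞-self x)) (⊞-identityˡ y))

  ⊞-cancelʳ : ∀ x y → (x ⊞ y) ⊞ y ≡ x
  ⊞-cancelʳ x y = trans (⊞-assoc x y y) (trans (cong (x ⊞_) (⊞-self y)) (⊞-identityʳ x))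

  ⊞-interchange : ∀ w x y z → (w ⊞ x) ⊞ (y ⊞ z) ≡ (w ⊞ y) ⊞ (x ⊞ z)
  ⊞-interchange w x y z = begin
    (w ⊞ x) ⊞ (y ⊞ z) ≡⟨ ⊞-assoc w x (y ⊞ z) ⟩
    w ⊞ (x ⊞ (y ⊞ z)) ≡⟨ cong (w ⊞_) (⊞-assoc x y z) ⟨
    w ⊞ ((x ⊞ y) ⊞ z) ≡⟨ cong (λ u → w ⊞ (u ⊞ z)) (⊞-comm x y) ⟩
    w ⊞ ((y ⊞ x) ⊞ z) ≡⟨ cong (w ⊞_) (⊞-assoc y x z) ⟩
    w ⊞ (y ⊞ (x ⊞ z)) ≡⟨ ⊞-assoc w y (x ⊞ z) ⟨
    (w ⊞ y) ⊞ (x ⊞ z) ∎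

  ⊞≡⓪⇒≡ : ∀ {x y} → x ⊞ y ≡ ⓪ → x ≡ y
  ⊞≡⓪⇒≡ {x} {y} eq = trans (sym (⊞-identityʳ x)) (trans (cong (x ⊞_) (sym eq)) (⊞-cancelˡ x y))

  -- `ψ-⓪` excludes the zero function. As every element is its own inverse, the laws force
  -- `ψ x * ψ x ≡ 1ℤ`, so integers suffice as values.
  record Character : Set where
    field
      ψ      : Fin n → ℤ
      ψ-homo : ∀ x y → ψ (x ⊞ y) ≡ ψ x * ψ y
      ψ-⓪    : ψ ⓪ ≡ 1ℤ

  -- A subgroup maximal among those avoiding a₀ has index two.
  module _ (a₀ : Fin n) (a₀≢⓪ : a₀ ≢ ⓪) where

    record Subgroup : Set where
      field
        mem      : Fin n → Bool
        mem-⓪    : mem ⓪ ≡ true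
        mem-⊞    : ∀ x y → mem x ≡ true → mem y ≡ true → mem (x ⊞ y) ≡ true
        a₀∉      : mem a₀ ≡ false
    open Subgroup

    _⊑_ : Subgroup → Subgroup → Set
    S ⊑ S′ = ∀ x → mem S x ≡ true → mem S′ x ≡ true

    -- The subgroup and its coset by `a₀` together contain `x`. If this holds for all `x`, the index
    -- is two.
    Decides : Subgroup → Fin n → Set
    Decides S x = mem S x ≡ true ⊎ mem S (a₀ ⊞ x) ≡ true

    trivial : Subgroup
    trivial .mem x = does (x ≟ ⓪)
    trivial .mem-⓪ = dec-true (⓪ ≟ ⓪) refl
    trivial .mem-⊞ x y x∈ y∈ with x ≟ ⓪ | y ≟ ⓪
    ... | yes refl | yes refl = dec-true (_ ≟ ⓪) (⊞-identityˡ ⓪)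
    trivial .a₀∉ = dec-false (a₀ ≟ ⓪) a₀≢⓪

    adjoin : ∀ S x → mem S (a₀ ⊞ x) ≡ false → Subgroup
    adjoin S x a₀x∉ .mem y = mem S y ∨ mem S (y ⊞ x)
    adjoin S x a₀x∉ .mem-⓪ rewrite mem-⓪ S = refl
    adjoin S x a₀x∉ .mem-⊞ y z y∈ z∈ with mem S y in Sy | mem S z in Sz
    ... | true  | true  rewrite mem-⊞ S y z Sy Sz = refl
    ... | true  | false = trans (cong (mem S (y ⊞ z) ∨_)
            (trans (cong (mem S) (⊞-assoc y z x)) (mem-⊞ S y (z ⊞ x) Sy z∈))) (∨-zeroʳ _)
    ... | false | true  = trans (cong (mem S (y ⊞ z) ∨_)
            (trans (cong (mem S) (trans (cong (_⊞ x) (⊞-comm y z)) (trans (⊞-assoc z y x) (⊞-comm z (y ⊞ x)))))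
                   (mem-⊞ S (y ⊞ x) z y∈ Sz))) (∨-zeroʳ _)
    ... | false | false = cong (_∨ mem S ((y ⊞ z) ⊞ x))
            (trans (cong (mem S) (trans (sym (⊞-identityʳ _)) (trans (cong ((y ⊞ z) ⊞_) (sym (⊞-self x))) (⊞-interchange y z x x))))
                   (mem-⊞ S (y ⊞ x) (z ⊞ x) y∈ z∈))
    adjoin S x a₀x∉ .a₀∉ rewrite a₀∉ S = a₀x∉

    -- Either `a₀ ⊞ x` already lies in `S`, or the union of `S` and its coset by `x` is a subgroup
    -- that still avoids `a₀`.
    enlarge : ∀ S x → Σ[ S′ ∈ Subgroup ] S ⊑ S′ × Decides S′ x
    enlarge S x with mem S (a₀ ⊞ x) in eq
    ... | true  = S , (λ _ y∈ → y∈) , inj₂ eq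
    ... | false = adjoin S x eq , (λ y y∈ → cong (_∨ mem S (y ⊞ x)) y∈) ,
                  inj₁ (trans (cong (mem S x ∨_) (trans (cong (mem S) (⊞-self x)) (mem-⓪ S))) (∨-zeroʳ _))

    -- Decisions survive enlargement, so one greedy pass over the elements gives maximality.
    enlarge-all : ∀ {m} S (v : Vector (Fin n) m) → Σ[ S′ ∈ Subgroup ] S ⊑ S′ × (∀ i → Decides S′ (v i))
    enlarge-all {zero}  S v = S , (λ _ y∈ → y∈) , λ ()
    enlarge-all {suc m} S v with enlarge S (head v)
    ... | S₁ , S⊑S₁ , dec₁ with enlarge-all S₁ (tail v)
    ...   | S₂ , S₁⊑S₂ , dec₂ = S₂ , (λ x → S₁⊑S₂ x ∘ S⊑S₁ x) ,
              λ { zero → Sum.map (S₁⊑S₂ _) (S₁⊑S₂ _) dec₁ ; (suc i) → dec₂ i }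

    ∃-character : Σ[ χ ∈ Character ] Character.ψ χ a₀ ≡ -1ℤ
    ∃-character with enlarge-all trivial id
    ... | S , _ , dec = record { ψ = ψ ; ψ-homo = ψ-homo ; ψ-⓪ = cong sign (mem-⓪ S) } , cong sign (a₀∉ S)
      where
      sign : Bool → ℤ
      sign true  = 1ℤ
      sign false = -1ℤ
      ψ : Fin n → ℤ
      ψ x = sign (mem S x)
      outside : ∀ {x} → mem S x ≡ false → mem S (a₀ ⊞ x) ≡ true
      outside {x} x∉ with dec x
      ... | inj₁ x∈ = contradiction (trans (sym x∉) x∈) λ ()
      ... | inj₂ y∈ = y∈
      mixed : ∀ x y → mem S x ≡ true → mem S y ≡ false → mem S (x ⊞ y) ≡ false
      mixed x y x∈ y∉ with mem S (x ⊞ y) in eq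
      ... | false = refl
      ... | true  = trans (sym (trans (cong (mem S) (sym (⊞-cancelˡ x y))) (mem-⊞ S x (x ⊞ y) x∈ eq))) y∉
      ψ-homo : ∀ x y → ψ (x ⊞ y) ≡ ψ x * ψ y
      ψ-homo x y with mem S x in Sx | mem S y in Sy
      ... | true  | true  = cong sign (mem-⊞ S x y Sx Sy)
      ... | true  | false = cong sign (mixed x y Sx Sy)
      ... | false | true  = cong sign (trans (cong (mem S) (⊞-comm x y)) (mixed y x Sy Sx))
      ... | false | false = cong sign (trans
        (cong (mem S) (sym (trans (⊞-interchange a₀ x a₀ y) (trans (cong (_⊞ (x ⊞ y)) (⊞-self a₀)) (⊞-identityˡ (x ⊞ y))))))
        (mem-⊞ S (a₀ ⊞ x) (a₀ ⊞ y) (outside Sx) (outside Sy)))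

-- The group ring of GA(1,q) in coordinates

-- The field with q = r + 1 elements on Fin (suc r): zero is 0 and suc i is the i-th power of a generator
-- of the multiplicative group.
module Model (r : ℕ) .{{_ : ℕ.NonZero r}} where

  open Cyclic r public

  infixl 7 _⋆_
  _⋆_ : Fin (suc r) → Fin (suc r) → Fin (suc r)
  zero  ⋆ y     = zero
  suc i ⋆ zero  = zero
  suc i ⋆ suc j = suc (i ⊹ j)

  ⋆-comm : ∀ x y → x ⋆ y ≡ y ⋆ x
  ⋆-comm zero    zero    = refl
  ⋆-comm zero    (suc j) = refl
  ⋆-comm (suc i) zero    = refl
  ⋆-comm (suc i) (suc j) = cong suc (⊹-comm i j)

  ⋆-zeroʳ : ∀ x → x ⋆ zero ≡ zero
  ⋆-zeroʳ x = ⋆-comm x zero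

  ⋆-assoc : ∀ i j y → suc i ⋆ (suc j ⋆ y) ≡ suc (i ⊹ j) ⋆ y
  ⋆-assoc i j zero    = refl
  ⋆-assoc i j (suc k) = cong suc (sym (⊹-assoc i j k))

  ⋆-identityˡ : ∀ y → suc ⓪ ⋆ y ≡ y
  ⋆-identityˡ zero    = refl
  ⋆-identityˡ (suc j) = cong suc (⊹-identityˡ j)

  ⋆-inverseˡ : ∀ i y → suc (⊝ i) ⋆ (suc i ⋆ y) ≡ y
  ⋆-inverseˡ i y = trans (⋆-assoc (⊝ i) i y) (trans (cong (λ z → suc z ⋆ y) (⊹-inverseˡ i)) (⋆-identityˡ y))

  ⋆-inverseʳ : ∀ i y → suc i ⋆ (suc (⊝ i) ⋆ y) ≡ y
  ⋆-inverseʳ i y = trans (⋆-assoc i (⊝ i) y) (trans (cong (λ z → suc z ⋆ y) (⊹-inverseʳ i)) (⋆-identityˡ y))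

  ⋆-integral : ∀ {i y} → suc i ⋆ y ≡ zero → y ≡ zero
  ⋆-integral {y = zero} _ = refl

  -- In exponents of a generator multiplication is explicit, whereas addition amounts to a table of
  -- Zech logarithms; it is therefore the one piece of the field kept as a parameter.
  record Addition : Set where
    infixl 6 _⊞_
    field
      _⊞_         : Fin (suc r) → Fin (suc r) → Fin (suc r)
      ⊞-comm      : ∀ x y → x ⊞ y ≡ y ⊞ x
      ⊞-assoc     : ∀ x y z → (x ⊞ y) ⊞ z ≡ x ⊞ (y ⊞ z)
      ⊞-identityˡ : ∀ x → zero ⊞ x ≡ x
      ⊞-self      : ∀ x → x ⊞ x ≡ zero
      ⋆-distribˡ  : ∀ x y z → x ⋆ (y ⊞ z) ≡ x ⋆ y ⊞ x ⋆ z

  module _ (addition : Addition) where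
    open Addition addition
    open ElementaryAbelian _⊞_ zero ⊞-comm ⊞-assoc ⊞-identityˡ ⊞-self

    Index : Set
    Index = Fin (suc r) × Fin r

    -- (b , i) stands for x ↦ gⁱ x + b; the quotient of (b , i) by (c , j) is (b - gⁱ⁻ʲ c , i - j).
    groupMatrix : (Fin r → Fin (suc r) → ℤ) → Index → Index → ℤ
    groupMatrix α (b , i) (c , j) = α (i ⊖ j) (b ⊞ suc (i ⊖ j) ⋆ c)

    module WithCharacter (character : Character) (ψ-suc⓪ : Character.ψ character (suc ⓪) ≡ -1ℤ) where
      open Character character

      -- Twisting one nontrivial character by the elements of the field lists all of them, as with
      -- the trace pairing. The symmetry in `d` and `y` lets row and column orthogonality share one
      -- proof.
      χ : Fin (suc r) → Fin (suc r) → ℤ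
      χ d y = ψ (d ⋆ y)

      χ-⊞ʳ : ∀ d x y → χ d (x ⊞ y) ≡ χ d x * χ d y
      χ-⊞ʳ d x y = trans (cong ψ (⋆-distribˡ d x y)) (ψ-homo (d ⋆ x) (d ⋆ y))

      χ-comm : ∀ d y → χ d y ≡ χ y d
      χ-comm d y = cong ψ (⋆-comm d y)

      χ-⊞ˡ : ∀ d e y → χ (d ⊞ e) y ≡ χ d y * χ e y
      χ-⊞ˡ d e y = trans (χ-comm (d ⊞ e) y) (trans (χ-⊞ʳ y d e) (cong₂ _*_ (χ-comm y d) (χ-comm y e)))

      -- Translation by `suc ⓪` reverses the sign of every value.
      sum-ψ : sum ψ ≡ 0ℤ
      sum-ψ = double (sum ψ) (begin
        sum ψ                         ≡⟨ sum-reindex (_⊞ suc ⓪) (_⊞ suc ⓪) (λ x → ⊞-cancelʳ x (suc ⓪)) (λ x → ⊞-cancelʳ x (suc ⓪)) ψ ⟨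
        sum (λ x → ψ (x ⊞ suc ⓪))     ≡⟨ sum-cong-≗ (λ x → trans (ψ-homo x (suc ⓪)) (cong (ψ x *_) ψ-suc⓪)) ⟩
        sum (λ x → ψ x * -1ℤ)         ≡⟨ *-distribʳ-sum -1ℤ ψ ⟨
        sum ψ * -1ℤ                   ∎)
        where
        double : ∀ x → x ≡ x * -1ℤ → x ≡ 0ℤ
        double x eq = ℤ.*-cancelˡ-≡ (+ 2) x 0ℤ (trans (two x) (trans (cong (λ z → z + x) eq) (zero′ x)))
          where
          two : ∀ x → + 2 * x ≡ x + x
          two = solve-∀
          zero′ : ∀ x → x * -1ℤ + x ≡ + 2 * 0ℤ
          zero′ = solve-∀

      sum-χ : ∀ y → sum (λ d → χ d y) ≡ + suc r * δ zero y
      sum-χ zero = begin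
        sum (λ d → χ d zero)      ≡⟨ sum-cong-≗ (λ d → trans (cong ψ (⋆-zeroʳ d)) ψ-⓪) ⟩
        sum {suc r} (const 1ℤ)    ≡⟨ sum-const (suc r) 1ℤ ⟩
        + suc r * 1ℤ              ∎
      sum-χ (suc j) = begin
        sum (λ d → χ d (suc j))      ≡⟨ sum-cong-≗ (λ d → χ-comm d (suc j)) ⟩
        sum (λ d → ψ (suc j ⋆ d))    ≡⟨ sum-reindex (suc j ⋆_) (suc (⊝ j) ⋆_) (⋆-inverseˡ j) (⋆-inverseʳ j) ψ ⟩
        sum ψ                        ≡⟨ sum-ψ ⟩
        0ℤ                           ≡⟨ ℤ.*-zeroʳ (+ suc r) ⟨
        + suc r * 0ℤ                 ∎

      -- The matrix of `α` in the representation induced from the character `χ d` of the additive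
      -- group, with the powers of the generator as coset representatives. For `d = zero` the twist
      -- by `⊝ x` disappears.
      component : (Fin r → Fin (suc r) → ℤ) → Fin (suc r) → Matrix ℤ r r
      component α d x a = sum λ b → χ d (suc (⊝ x) ⋆ b) * α (x ⊖ a) b

      intertwiner : Index → Index → ℤ
      intertwiner (d , x) (b , a) = δ x a * χ d (suc (⊝ x) ⋆ b)

      flatten-⊡ : ∀ (M N : Index → Index → ℤ) →
                  flatten M ⊡ flatten N ≋ flatten (λ p q → sum λ b → sum λ i → M p (b , i) * N (b , i) q)
      flatten-⊡ M N p q = sum-remQuot (λ s → M (Fin.remQuot r p) s * N s (Fin.remQuot r q))

      -- Translate `b` by `u = gˣ⁻ʲ c`. Because of the twist, `χ d (g⁻ˣ u)` becomes `χ d (g⁻ʲ c)`,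
      -- which is independent of `b` and `x` and is the entry of the intertwiner on the other side.
      intertwines : ∀ α → flatten intertwiner ⊡ flatten (groupMatrix α) ≋
                          flatten (blockDiagonal (component α)) ⊡ flatten intertwiner
      intertwines α p q = trans (flatten-⊡ intertwiner (groupMatrix α) p q) (trans
        (eq (Fin.remQuot r p) (Fin.remQuot r q)) (sym (flatten-⊡ (blockDiagonal (component α)) intertwiner p q)))
        where
        eq : ∀ s t → sum (λ b → sum λ i → intertwiner s (b , i) * groupMatrix α (b , i) t) ≡
                     sum (λ e → sum λ i → blockDiagonal (component α) s (e , i) * intertwiner (e , i) t)
        eq (d , x) (c , j) = begin
          sum (λ b → sum λ i → δ x i * χ d (suc (⊝ x) ⋆ b) * groupMatrix α (b , i) (c , j))
            ≡⟨ sum-cong-≗ (λ b → trans (sum-cong-≗ λ i → ℤ.*-assoc (δ x i) (χ d (suc (⊝ x) ⋆ b)) (groupMatrix α (b , i) (c , j)))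
                 (sum-δˡ x λ i → χ d (suc (⊝ x) ⋆ b) * groupMatrix α (b , i) (c , j))) ⟩
          sum (λ b → χ d (suc (⊝ x) ⋆ b) * α (x ⊖ j) (b ⊞ u))
            ≡⟨ sum-reindex (_⊞ u) (_⊞ u) (λ b → ⊞-cancelʳ b u) (λ b → ⊞-cancelʳ b u) (λ b → χ d (suc (⊝ x) ⋆ b) * α (x ⊖ j) (b ⊞ u)) ⟨
          sum (λ b → χ d (suc (⊝ x) ⋆ (b ⊞ u)) * α (x ⊖ j) (b ⊞ u ⊞ u))
            ≡⟨ sum-cong-≗ (λ b → trans (cong₂ _*_ (shift b) (cong (α (x ⊖ j)) (⊞-cancelʳ b u)))
                 (rearrange (χ d (suc (⊝ x) ⋆ b)) (χ d (suc (⊝ j) ⋆ c)) (α (x ⊖ j) b))) ⟩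
          sum (λ b → χ d (suc (⊝ x) ⋆ b) * α (x ⊖ j) b * χ d (suc (⊝ j) ⋆ c))
            ≡⟨ *-distribʳ-sum (χ d (suc (⊝ j) ⋆ c)) (λ b → χ d (suc (⊝ x) ⋆ b) * α (x ⊖ j) b) ⟨
          component α d x j * χ d (suc (⊝ j) ⋆ c)
            ≡⟨ sum-δʳ j (λ i → component α d x i * χ d (suc (⊝ i) ⋆ c)) ⟨
          sum (λ i → component α d x i * χ d (suc (⊝ i) ⋆ c) * δ i j)
            ≡⟨ sum-δˡ d (λ e → sum λ i → component α d x i * χ e (suc (⊝ i) ⋆ c) * δ i j) ⟨
          sum (λ e → δ d e * sum λ i → component α d x i * χ e (suc (⊝ i) ⋆ c) * δ i j)
            ≡⟨ sum-cong-≗ (λ e → trans (*-distribˡ-sum (δ d e) (λ i → component α d x i * χ e (suc (⊝ i) ⋆ c) * δ i j))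
                 (sum-cong-≗ λ i → regroup (δ d e) (component α d x i) (χ e (suc (⊝ i) ⋆ c)) (δ i j))) ⟩
          sum (λ e → sum λ i → blockDiagonal (component α) (d , x) (e , i) * intertwiner (e , i) (c , j)) ∎
          where
          u : Fin (suc r)
          u = suc (x ⊖ j) ⋆ c
          u-shift : suc (⊝ x) ⋆ u ≡ suc (⊝ j) ⋆ c
          u-shift = trans (⋆-assoc (⊝ x) (x ⊖ j) c) (cong (λ z → suc z ⋆ c)
            (trans (sym (⊹-assoc (⊝ x) x (⊝ j))) (trans (cong (_⊖ j) (⊹-inverseˡ x)) (⊹-identityˡ (⊝ j)))))
          shift : ∀ b → χ d (suc (⊝ x) ⋆ (b ⊞ u)) ≡ χ d (suc (⊝ x) ⋆ b) * χ d (suc (⊝ j) ⋆ c)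
          shift b = trans (cong (χ d) (⋆-distribˡ (suc (⊝ x)) b u))
            (trans (χ-⊞ʳ d _ _) (cong (λ z → χ d (suc (⊝ x) ⋆ b) * χ d z) u-shift))
          rearrange : ∀ a b c → a * b * c ≡ a * c * b
          rearrange = solve-∀
          regroup : ∀ a b c d → a * (b * c * d) ≡ a * b * (d * c)
          regroup = solve-∀

      -- Orthogonality of characters says that `transpose P ⊡ P` is `q` times the identity. This
      -- allows `det P` to be cancelled in `factorization` without inverting `P`.
      det-intertwiner≢0 : det (flatten intertwiner) ≢ 0ℤ
      det-intertwiner≢0 detP≡0 = power≢0 (suc r ℕ.* r) (begin
        (+ suc r) ^ (suc r ℕ.* r)                            ≡⟨ det-scalar (suc r ℕ.* r) (+ suc r) ⟨
        det {suc r ℕ.* r} (λ p q → + suc r * δ p q)          ≡⟨ det-cong orthogonal ⟨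
        det (transpose P ⊡ P)                                ≡⟨ det-⊡ (transpose P) P ⟩
        det (transpose P) * det P                            ≡⟨ cong (det (transpose P) *_) detP≡0 ⟩
        det (transpose P) * 0ℤ                               ≡⟨ ℤ.*-zeroʳ (det (transpose P)) ⟩
        0ℤ                                                   ∎)
        where
        P : Matrix ℤ (suc r ℕ.* r) (suc r ℕ.* r)
        P = flatten intertwiner
        power≢0 : ∀ n → (+ suc r) ^ n ≢ 0ℤ
        power≢0 zero ()
        power≢0 (suc n) eq with ℤ.i*j≡0⇒i≡0∨j≡0 (+ suc r) eq
        ... | inj₂ eq′ = power≢0 n eq′
        pairing : ∀ s t → sum (λ d → sum λ x → intertwiner (d , x) s * intertwiner (d , x) t) ≡
                  + suc r * (δ (proj₁ s) (proj₁ t) * δ (proj₂ s) (proj₂ t))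
        pairing (b , a) (c , e) = begin
          sum (λ d → sum λ x → δ x a * χ d (suc (⊝ x) ⋆ b) * (δ x e * χ d (suc (⊝ x) ⋆ c)))
            ≡⟨ sum-cong-≗ (λ d → trans (sum-cong-≗ λ x → regroup (δ x a) (χ d (suc (⊝ x) ⋆ b)) (δ x e) (χ d (suc (⊝ x) ⋆ c)))
                 (sum-δʳ a λ x → δ x e * (χ d (suc (⊝ x) ⋆ b) * χ d (suc (⊝ x) ⋆ c)))) ⟩
          sum (λ d → δ a e * (χ d (suc (⊝ a) ⋆ b) * χ d (suc (⊝ a) ⋆ c)))
            ≡⟨ sum-cong-≗ (λ d → cong (δ a e *_) (sym (trans (cong (χ d) (⋆-distribˡ (suc (⊝ a)) b c)) (χ-⊞ʳ d _ _)))) ⟩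
          sum (λ d → δ a e * χ d (suc (⊝ a) ⋆ (b ⊞ c)))
            ≡⟨ *-distribˡ-sum (δ a e) (λ d → χ d (suc (⊝ a) ⋆ (b ⊞ c))) ⟨
          δ a e * sum (λ d → χ d (suc (⊝ a) ⋆ (b ⊞ c)))
            ≡⟨ cong (δ a e *_) (sum-χ (suc (⊝ a) ⋆ (b ⊞ c))) ⟩
          δ a e * (+ suc r * δ zero (suc (⊝ a) ⋆ (b ⊞ c)))
            ≡⟨ cong (λ z → δ a e * (+ suc r * z)) (δ-⇔ (⊞≡⓪⇒≡ ∘ ⋆-integral ∘ sym)
                 (λ b≡c → sym (trans (cong (suc (⊝ a) ⋆_) (trans (cong (_⊞ c) b≡c) (⊞-self c))) (⋆-zeroʳ (suc (⊝ a)))))) ⟩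
          δ a e * (+ suc r * δ b c) ≡⟨ rotate (δ a e) (+ suc r) (δ b c) ⟩
          + suc r * (δ b c * δ a e) ∎
          where
          rotate : ∀ x q y → x * (q * y) ≡ q * (y * x)
          rotate = solve-∀
          regroup : ∀ a b c d → a * b * (c * d) ≡ c * (b * d) * a
          regroup = solve-∀
        orthogonal : transpose P ⊡ P ≋ λ p q → + suc r * δ p q
        orthogonal p q = begin
          sum (λ k → P k p * P k q)
            ≡⟨ sum-remQuot (λ s → intertwiner s (Fin.remQuot r p) * intertwiner s (Fin.remQuot r q)) ⟩
          sum (λ d → sum λ x → intertwiner (d , x) (Fin.remQuot r p) * intertwiner (d , x) (Fin.remQuot r q))
            ≡⟨ pairing (Fin.remQuot r p) (Fin.remQuot r q) ⟩
          + suc r * (δ (proj₁ (Fin.remQuot {suc r} r p)) (proj₁ (Fin.remQuot r q)) * δ (proj₂ (Fin.remQuot {suc r} r p)) (proj₂ (Fin.remQuot {suc r} r q)))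
            ≡⟨ cong (+ suc r *_) (δ-remQuot {suc r} {r} p q) ⟨
          + suc r * δ p q ∎

      -- Multiplying the character by the `t`-th power of the generator only shifts both matrix
      -- indices by `t`.
      det-component-suc : ∀ α t → det (component α (suc t)) ≡ det (component α (suc ⓪))
      det-component-suc α t = begin
        det (component α (suc t))                                  ≡⟨ det-cong shifted ⟨
        det (λ x a → component α (suc ⓪) (x ⊖ t) (a ⊖ t))          ≡⟨ det-reindex (_⊖ t) (_⊹ t) (λ x → ⊖-⊹-cancel x t) (λ x → ⊹-⊖-cancel x t) (component α (suc ⓪)) ⟩
        det (component α (suc ⓪))                                  ∎
        where
        shifted : (λ x a → component α (suc ⓪) (x ⊖ t) (a ⊖ t)) ≋ component α (suc t)
        shifted x a = sum-cong-≗ λ b → cong₂ (λ y z → ψ y * α z b)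
          (begin
            suc ⓪ ⋆ (suc (⊝ (x ⊖ t)) ⋆ b) ≡⟨ ⋆-identityˡ _ ⟩
            suc (⊝ (x ⊖ t)) ⋆ b           ≡⟨ cong (λ z → suc z ⋆ b) (⊝-⊖ x t) ⟩
            suc (t ⊖ x) ⋆ b               ≡⟨ ⋆-assoc t (⊝ x) b ⟨
            suc t ⋆ (suc (⊝ x) ⋆ b)       ∎)
          (⊹-⊖-⊹ x a (⊝ t))

      factorization : ∀ α → det (flatten (groupMatrix α)) ≡ det (component α zero) * det (component α (suc ⓪)) ^ r
      factorization α = ℤ.*-cancelˡ-≡ (det P) _ _ {{ℤ.≢-nonZero det-intertwiner≢0}} (begin
        det P * det (flatten (groupMatrix α))                     ≡⟨ det-⊡ P (flatten (groupMatrix α)) ⟨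
        det (P ⊡ flatten (groupMatrix α))                         ≡⟨ det-cong (intertwines α) ⟩
        det (flatten (blockDiagonal (component α)) ⊡ P)           ≡⟨ det-⊡ (flatten (blockDiagonal (component α))) P ⟩
        det (flatten (blockDiagonal (component α))) * det P       ≡⟨ ℤ.*-comm (det (flatten (blockDiagonal (component α)))) (det P) ⟩
        det P * det (flatten (blockDiagonal (component α)))       ≡⟨ cong (det P *_) (det-blockDiagonal-∷ (component α)) ⟩
        det P * (det (component α zero) * det (flatten (blockDiagonal (component α ∘ suc))))
          ≡⟨ cong (λ z → det P * (det (component α zero) * z))
               (det-blockDiagonal-const (component α ∘ suc) (det (component α (suc ⓪))) (det-component-suc α)) ⟩
        det P * (det (component α zero) * det (component α (suc ⓪)) ^ r) ∎)
        where
        P : Matrix ℤ (suc r ℕ.* r) (suc r ℕ.* r)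
        P = flatten intertwiner

-- Determinants modulo an integer

∣-resp : ∀ {k x y} → x ≡ y → k ∣ₛ x → k ∣ₛ y
∣-resp {k} = subst (k ∣ₛ_)

∣0 : ∀ k → k ∣ₛ 0ℤ
∣0 k = divides 0ℤ (sym (ℤ.*-zeroˡ k))

sum-∣ : ∀ {k} {t : Vector ℤ n} → (∀ i → k ∣ₛ t i) → k ∣ₛ sum t
sum-∣ {zero}  {k} k∣t = ∣0 k
sum-∣ {suc n}     k∣t = ∣m∣n⇒∣m+n (k∣t zero) (sum-∣ (k∣t ∘ suc))

sum-- : ∀ (s t : Vector ℤ n) → sum (λ i → s i - t i) ≡ sum s - sum t
sum-- s t = begin
  sum (λ i → s i - t i)         ≡⟨ sum-cong-≗ (λ i → flip-sign (s i) (t i)) ⟩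
  sum (λ i → -1ℤ * t i + s i)   ≡⟨ sum-linear -1ℤ t s ⟩
  -1ℤ * sum t + sum s           ≡⟨ flip-sign (sum s) (sum t) ⟨
  sum s - sum t                 ∎
  where
  flip-sign : ∀ x y → x - y ≡ -1ℤ * y + x
  flip-sign = solve-∀

*-≡-mod : ∀ {k} a b c d → k ∣ₛ a - b → k ∣ₛ c - d → k ∣ₛ a * c - b * d
*-≡-mod a b c d k∣a-b k∣c-d = ∣-resp (split a b c d) (∣m∣n⇒∣m+n (∣m⇒∣m*n c k∣a-b) (∣n⇒∣m*n b k∣c-d))
  where
  split : ∀ a b c d → (a - b) * c + b * (c - d) ≡ a * c - b * d
  split = solve-∀

det-≡-mod : ∀ {k} {M N : Matrix ℤ n n} → (∀ i j → k ∣ₛ M i j - N i j) → k ∣ₛ det M - det N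
det-≡-mod {zero}  {k} M≡N = ∣0 k
det-≡-mod {suc n} {k} {M} {N} M≡N = ∣-resp
  (sum-- (λ j → -1ℤ ^ toℕ j * M zero j * det (minor j M)) (λ j → -1ℤ ^ toℕ j * N zero j * det (minor j N)))
  (sum-∣ λ j → *-≡-mod (-1ℤ ^ toℕ j * M zero j) (-1ℤ ^ toℕ j * N zero j) (det (minor j M)) (det (minor j N))
    (∣-resp (factor (-1ℤ ^ toℕ j) (M zero j) (N zero j)) (∣n⇒∣m*n (-1ℤ ^ toℕ j) (M≡N zero j)))
    (det-≡-mod {M = minor j M} {minor j N} λ i l → M≡N (suc i) (punchIn j l)))
  where
  factor : ∀ s x y → s * (x - y) ≡ s * x - s * y
  factor = solve-∀

det-∣-row : ∀ {k} (b : Fin n) (M : Matrix ℤ n n) → (∀ j → k ∣ₛ M b j) → k ∣ₛ det M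
det-∣-row {n} {k} b M k∣M[b] = divides (det M′) (begin
  det M             ≡⟨ det-replace-row b (λ i → k * δ i b) M′ M (λ i i≢b j → sym (setRow-≢ b quotients M i≢b j)) row ⟩
  k * δ b b * det M′ ≡⟨ cong (λ z → k * z * det M′) (δ-refl b) ⟩
  k * 1ℤ * det M′   ≡⟨ tidy k (det M′) ⟩
  det M′ * k        ∎)
  where
  quotients : Vector ℤ n
  quotients j = Signed.quotient (k∣M[b] j)
  M′ : Matrix ℤ n n
  M′ = setRow b quotients M
  tidy : ∀ x y → x * 1ℤ * y ≡ y * x
  tidy = solve-∀
  reorder : ∀ x y z → x * y * z ≡ z * x * y
  reorder = solve-∀
  row : ∀ j → M b j ≡ sum λ i → k * δ i b * M′ i j
  row j = begin
    M b j                            ≡⟨ Signed._∣_.equality (k∣M[b] j) ⟩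
    quotients j * k                  ≡⟨ cong (_* k) (setRow-≡ b quotients M j) ⟨
    M′ b j * k                       ≡⟨ sum-δʳ b (λ i → M′ i j * k) ⟨
    sum (λ i → M′ i j * k * δ i b)   ≡⟨ sum-cong-≗ (λ i → reorder k (δ i b) (M′ i j)) ⟨
    sum (λ i → k * δ i b * M′ i j)   ∎

-- Circulant determinants modulo the order

module CirculantModulo (r : ℕ) .{{_ : ℕ.NonZero r}} (r-prime : Prime r) where
  open Cyclic r

  euclid : ∀ x y → + r ∣ₛ x * y → + r ∣ₛ x ⊎ + r ∣ₛ y
  euclid x y r∣xy = Sum.map ∣ᵤ⇒∣ ∣ᵤ⇒∣
    (euclidsLemma ℤ.∣ x ∣ ℤ.∣ y ∣ r-prime (subst (r ℕ.∣_) (ℤ.abs-* x y) (∣⇒∣ᵤ r∣xy)))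

  euclid-^ : ∀ x n → + r ∣ₛ x ^ n → + r ∣ₛ x
  euclid-^ x zero    r∣1 = ∣-resp (ℤ.*-identityʳ x) (∣n⇒∣m*n x r∣1)
  euclid-^ x (suc n) r∣x^n with euclid x (x ^ n) r∣x^n
  ... | inj₁ r∣x   = r∣x
  ... | inj₂ r∣x^n = euclid-^ x n r∣x^n

  -- Adding all columns to the first extracts a factor S; adding all rows to the first of what is left
  -- makes it divisible by r if S is.
  circulant-∣² : ∀ s → + r ∣ₛ sum s → + r * + r ∣ₛ det (circulant s)
  circulant-∣² s r∣S = ∣-resp (sym det≡) (*-∣ r∣S r∣C′)
    where
    S : ℤ
    S = sum s
    *-∣ : ∀ {a b c d} → a ∣ₛ b → c ∣ₛ d → a * c ∣ₛ b * d
    *-∣ {a} {b} {c} {d} (divides x refl) (divides y refl) = divides (x * y) (interchange x a y c)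
      where
      interchange : ∀ x a y c → x * a * (y * c) ≡ x * y * (a * c)
      interchange = solve-∀
    C C′ᵀ : Matrix ℤ r r
    C = circulant s
    C′ᵀ = setRow ⓪ (const 1ℤ) (transpose C)
    det≡ : det C ≡ S * det (transpose C′ᵀ)
    det≡ = det-column-image ⓪ (const 1ℤ) S (const 1ℤ) C refl λ i →
      trans (sum-cong-≗ λ j → ℤ.*-identityʳ (C i j)) (trans (sum-⊖ˡ i s) (sym (ℤ.*-identityʳ S)))
    total : Vector ℤ r
    total j = sum λ i → 1ℤ * C′ᵀ j i
    r∣total : ∀ j → + r ∣ₛ total j
    r∣total j with j ≟ ⓪
    ... | yes _ = ∣-resp (sym (sum-const r 1ℤ)) (divides 1ℤ (ℤ.*-comm (+ r) 1ℤ))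
    ... | no _ = ∣-resp (sym (trans (sum-cong-≗ λ i → ℤ.*-identityˡ (s (i ⊖ j))) (sum-⊖ʳ j s))) r∣S
    r∣C′ : + r ∣ₛ det (transpose C′ᵀ)
    r∣C′ = ∣-resp (trans
      (det-replace-row ⓪ (const 1ℤ) (transpose C′ᵀ) (setRow ⓪ total (transpose C′ᵀ))
        (λ i i≢⓪ → setRow-≢ ⓪ total (transpose C′ᵀ) i≢⓪) (setRow-≡ ⓪ total (transpose C′ᵀ)))
      (ℤ.*-identityˡ (det (transpose C′ᵀ))))
      (det-∣-row ⓪ (setRow ⓪ total (transpose C′ᵀ)) λ j → ∣-resp (sym (setRow-≡ ⓪ total (transpose C′ᵀ) j)) (r∣total j))

  -- The operator `T - 1`, with `T` the cyclic shift.
  Δ : Vector ℤ r → Vector ℤ r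
  Δ w x = w (x ⊖ [ 1 ]) - w x

  Δ^ : ℕ → Vector ℤ r → Vector ℤ r
  Δ^ zero    w = w
  Δ^ (suc n) w = Δ (Δ^ n w)

  -- (-1)ⁿ⁻ᵏ (n choose k)
  signedBinomial : ℕ → ℕ → ℤ
  signedBinomial zero    zero    = 1ℤ
  signedBinomial zero    (suc k) = 0ℤ
  signedBinomial (suc n) zero    = - signedBinomial n zero
  signedBinomial (suc n) (suc k) = signedBinomial n k - signedBinomial n (suc k)

  -- Read with `suc n = r`, this forces the prime `r` to divide the inner coefficients of
  -- `(T - 1)ʳ`.
  absorption : ∀ n k → + suc k * signedBinomial (suc n) (suc k) ≡ + suc n * signedBinomial n k
  absorption zero    zero    = refl
  absorption zero    (suc k) = ℤ.*-zeroʳ (+ suc (suc k))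
  absorption (suc n) zero    = begin
    1ℤ * (b₁ - b₂)     ≡⟨ cong (λ z → 1ℤ * (b₁ - z)) (sym (ℤ.*-identityˡ b₂)) ⟩
    1ℤ * (b₁ - 1ℤ * b₂) ≡⟨ cong (λ z → 1ℤ * (b₁ - z)) (absorption n zero) ⟩
    1ℤ * (- signedBinomial n zero - + suc n * signedBinomial n zero) ≡⟨ collect (+ suc n) (signedBinomial n zero) ⟩
    (1ℤ + + suc n) * - signedBinomial n zero ∎
    where
    b₁ b₂ : ℤ
    b₁ = signedBinomial (suc n) zero
    b₂ = signedBinomial (suc n) 1
    collect : ∀ m b → 1ℤ * (- b - m * b) ≡ (1ℤ + m) * - b
    collect = solve-∀
  absorption (suc n) (suc k) = begin
    (1ℤ + + suc k) * (b₁ - b₂)                     ≡⟨ spread (+ suc k) b₁ b₂ ⟩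
    + suc k * b₁ + b₁ - (1ℤ + + suc k) * b₂        ≡⟨ cong₂ (λ x y → x + b₁ - y) (absorption n k) (absorption n (suc k)) ⟩
    + suc n * signedBinomial n k + b₁ - + suc n * signedBinomial n (suc k)
      ≡⟨ collect (+ suc n) (signedBinomial n k) (signedBinomial n (suc k)) ⟩
    (1ℤ + + suc n) * b₁ ∎
    where
    b₁ b₂ : ℤ
    b₁ = signedBinomial (suc n) (suc k)
    b₂ = signedBinomial (suc n) (suc (suc k))
    spread : ∀ k x y → (1ℤ + k) * (x - y) ≡ k * x + x - (1ℤ + k) * y
    spread = solve-∀
    collect : ∀ m x y → m * x + (x - y) - m * y ≡ (1ℤ + m) * (x - y)
    collect = solve-∀

  -- The binomial expansion of `(T - 1)ⁿ`. The number of terms is left free because the shifted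
  -- summand is expanded with one term fewer than the other, which makes the indices match.
  newton : ∀ n N → n ℕ.< N → ∀ w x →
           Δ^ n w x ≡ sum {N} λ k → signedBinomial n (toℕ k) * w (x ⊖ [ toℕ k ])
  newton zero (suc N) _ w x = sym (begin
    1ℤ * w (x ⊖ ⓪) + sum {N} (λ k → 0ℤ * w (x ⊖ [ suc (toℕ k) ]))
      ≡⟨ cong₂ _+_ (ℤ.*-identityˡ (w (x ⊖ ⓪))) (sum-zero {N} λ k → ℤ.*-zeroˡ (w (x ⊖ [ suc (toℕ k) ]))) ⟩
    w (x ⊖ ⓪) + 0ℤ    ≡⟨ ℤ.+-identityʳ (w (x ⊖ ⓪)) ⟩
    w (x ⊖ ⓪)         ≡⟨ cong w (trans (cong (x ⊹_) ⊝-⓪) (⊹-identityʳ x)) ⟩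
    w x               ∎)
  newton (suc n) (suc N) (ℕ.s≤s n<N) w x = begin
    Δ^ n w (x ⊖ [ 1 ]) - Δ^ n w x
      ≡⟨ cong₂ _-_ (newton n N n<N w (x ⊖ [ 1 ])) (newton n (suc N) (ℕ.m<n⇒m<1+n n<N) w x) ⟩
    sum {N} (λ k → b (toℕ k) * w (x ⊖ [ 1 ] ⊖ [ toℕ k ])) - (b 0 * w (x ⊖ ⓪) + sum {N} (λ k → b (suc (toℕ k)) * w (x ⊖ [ suc (toℕ k) ])))
      ≡⟨ cong (_- (b 0 * w (x ⊖ ⓪) + sum {N} (λ k → b (suc (toℕ k)) * w (x ⊖ [ suc (toℕ k) ]))))
           (sum-cong-≗ {N} λ k → cong (λ z → b (toℕ k) * w z) (⊖-suc (toℕ k))) ⟩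
    sum {N} (λ k → b (toℕ k) * w (x ⊖ [ suc (toℕ k) ])) - (b 0 * w (x ⊖ ⓪) + sum {N} (λ k → b (suc (toℕ k)) * w (x ⊖ [ suc (toℕ k) ])))
      ≡⟨ regroup (sum {N} (λ k → b (toℕ k) * w (x ⊖ [ suc (toℕ k) ]))) (b 0) (w (x ⊖ ⓪)) (sum {N} (λ k → b (suc (toℕ k)) * w (x ⊖ [ suc (toℕ k) ]))) ⟩
    - b 0 * w (x ⊖ ⓪) + (sum {N} (λ k → b (toℕ k) * w (x ⊖ [ suc (toℕ k) ])) - sum {N} (λ k → b (suc (toℕ k)) * w (x ⊖ [ suc (toℕ k) ])))
      ≡⟨ cong (λ z → - b 0 * w (x ⊖ ⓪) + z) (trans
           (sym (sum-- {N} (λ k → b (toℕ k) * w (x ⊖ [ suc (toℕ k) ])) (λ k → b (suc (toℕ k)) * w (x ⊖ [ suc (toℕ k) ]))))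
           (sum-cong-≗ {N} λ k → factor (b (toℕ k)) (b (suc (toℕ k))) (w (x ⊖ [ suc (toℕ k) ])))) ⟩
    - b 0 * w (x ⊖ ⓪) + sum {N} (λ k → (b (toℕ k) - b (suc (toℕ k))) * w (x ⊖ [ suc (toℕ k) ])) ∎
    where
    b : ℕ → ℤ
    b = signedBinomial n
    ⊖-suc : ∀ k → x ⊖ [ 1 ] ⊖ [ k ] ≡ x ⊖ [ suc k ]
    ⊖-suc k = trans (⊹-assoc x (⊝ [ 1 ]) (⊝ [ k ])) (cong (x ⊹_) (trans (⊝-⊹-comm [ 1 ] [ k ]) (cong ⊝_ ([]-+ 1 k))))
    regroup : ∀ s b w t → s - (b * w + t) ≡ - b * w + (s - t)
    regroup = solve-∀
    factor : ∀ b c w → b * w - c * w ≡ (b - c) * w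
    factor = solve-∀

  Δ^-const : ∀ n c x → Δ^ (suc n) (const c) x ≡ 0ℤ
  Δ^-const zero    c x = ℤ.+-inverseʳ c
  Δ^-const (suc n) c x = cong₂ _-_ (Δ^-const n c (x ⊖ [ 1 ])) (Δ^-const n c x)

  ∣-signedBinomial : ∀ k → suc k ℕ.< r → + r ∣ₛ signedBinomial r (suc k)
  ∣-signedBinomial k k<r with euclid (+ suc k) (signedBinomial r (suc k)) r∣product
    where
    r∣product : + r ∣ₛ + suc k * signedBinomial r (suc k)
    r∣product = subst (λ z → + z ∣ₛ + suc k * signedBinomial z (suc k)) (ℕ.suc-pred r)
      (divides (signedBinomial (ℕ.pred r) k) (trans (absorption (ℕ.pred r) k) (ℤ.*-comm (+ suc (ℕ.pred r)) (signedBinomial (ℕ.pred r) k))))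
  ... | inj₁ r∣k = contradiction (ℕ.∣⇒≤ (∣⇒∣ᵤ r∣k)) (ℕ.<⇒≱ k<r)
  ... | inj₂ r∣b = r∣b

  -- Subtracting the constant `w x`, which `Δ` kills, turns every summand into a coefficient times a
  -- difference. The two outer differences vanish, as shifts by 0 and by `r` are trivial, and the
  -- inner coefficients are divisible by `r`.
  Δ^-order-∣ : ∀ w x → + r ∣ₛ Δ^ r w x
  Δ^-order-∣ w x = ∣-resp (sym expansion) (sum-∣ {suc r} term)
    where
    difference : Fin (suc r) → ℤ
    difference k = w (x ⊖ [ toℕ k ]) - w x
    expansion : Δ^ r w x ≡ sum {suc r} λ k → signedBinomial r (toℕ k) * difference k
    expansion = begin
      Δ^ r w x                                  ≡⟨ ℤ.+-identityʳ (Δ^ r w x) ⟨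
      Δ^ r w x - 0ℤ                             ≡⟨ cong (λ z → Δ^ r w x - z)
          (subst (λ z → Δ^ z (const (w x)) x ≡ 0ℤ) (ℕ.suc-pred r) (Δ^-const (ℕ.pred r) (w x) x)) ⟨
      Δ^ r w x - Δ^ r (const (w x)) x           ≡⟨ cong₂ _-_ (newton r (suc r) ℕ.≤-refl w x) (newton r (suc r) ℕ.≤-refl (const (w x)) x) ⟩
      sum {suc r} (λ k → signedBinomial r (toℕ k) * w (x ⊖ [ toℕ k ])) - sum {suc r} (λ k → signedBinomial r (toℕ k) * w x)
        ≡⟨ sum-- {suc r} (λ k → signedBinomial r (toℕ k) * w (x ⊖ [ toℕ k ])) (λ k → signedBinomial r (toℕ k) * w x) ⟨
      sum {suc r} (λ k → signedBinomial r (toℕ k) * w (x ⊖ [ toℕ k ]) - signedBinomial r (toℕ k) * w x)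
        ≡⟨ sum-cong-≗ {suc r} (λ k → factor (signedBinomial r (toℕ k)) (w (x ⊖ [ toℕ k ])) (w x)) ⟩
      sum {suc r} (λ k → signedBinomial r (toℕ k) * difference k) ∎
      where
      factor : ∀ b y z → b * y - b * z ≡ b * (y - z)
      factor = solve-∀
    vanish : ∀ k → [ toℕ k ] ≡ ⓪ → difference k ≡ 0ℤ
    vanish k eq = trans (cong (λ z → w z - w x) (trans (cong (x ⊖_) eq) (trans (cong (x ⊹_) ⊝-⓪) (⊹-identityʳ x)))) (ℤ.+-inverseʳ (w x))
    term : ∀ k → + r ∣ₛ signedBinomial r (toℕ k) * difference k
    term zero = ∣n⇒∣m*n (signedBinomial r 0) (∣-resp (sym (vanish zero refl)) (∣0 (+ r)))
    term (suc k) with ℕ.m≤n⇒m<n∨m≡n (Fin.toℕ<n k)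
    ... | inj₁ k<r = ∣m⇒∣m*n (difference (suc k)) (∣-signedBinomial (toℕ k) k<r)
    ... | inj₂ k≡r = ∣n⇒∣m*n (signedBinomial r (suc (toℕ k)))
      (∣-resp (sym (vanish (suc k) (trans (cong [_] k≡r) [r]≡⓪))) (∣0 (+ r)))

  module _ (s : Vector ℤ r) where
    private
      S : ℤ
      S = sum s

    act : Vector ℤ r → Vector ℤ r
    act w x = sum λ a → circulant s x a * w a

    -- The column space of the circulant over the field with `r` elements, in terms of integer
    -- representatives.
    Image : Vector ℤ r → Set
    Image u = ∃[ y ] ∀ x → + r ∣ₛ act y x - u x

    Image-cong : ∀ {u v} → u ≗ v → Image u → Image v
    Image-cong u≗v (y , y≡u) = y , λ x → ∣-resp (cong (λ z → act y x - z) (u≗v x)) (y≡u x)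

    Image-linear : ∀ c {u v} → Image u → Image v → Image (λ x → c * u x + v x)
    Image-linear c {u} {v} (y , y≡u) (z , z≡v) = (λ a → c * y a + z a) , λ x → ∣-resp
      (trans (regroup c (act y x) (u x) (act z x) (v x))
        (cong (_- (c * u x + v x)) (sym (trans (sum-cong-≗ λ a → expand c (s (x ⊖ a)) (y a) (z a))
          (sum-linear c (λ a → s (x ⊖ a) * y a) (λ a → s (x ⊖ a) * z a))))))
      (∣m∣n⇒∣m+n (∣n⇒∣m*n c (y≡u x)) (z≡v x))
      where
      regroup : ∀ c y u z v → c * (y - u) + (z - v) ≡ c * y + z - (c * u + v)
      regroup = solve-∀
      expand : ∀ c s y z → s * (c * y + z) ≡ c * (s * y) + s * z
      expand = solve-∀

    Image-shift : ∀ {u} → Image u → Image (λ x → u (x ⊖ [ 1 ]))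
    Image-shift {u} (y , y≡u) = (λ a → y (a ⊖ [ 1 ])) , λ x → ∣-resp
      (cong (_- u (x ⊖ [ 1 ])) (trans
        (sym (sum-⊖ʳ [ 1 ] (λ a → s (x ⊖ [ 1 ] ⊖ a) * y a)))
        (sum-cong-≗ λ a → cong (λ z → s z * y (a ⊖ [ 1 ])) (⊹-⊖-⊹ x a (⊝ [ 1 ])))))
      (y≡u (x ⊖ [ 1 ]))

    Image-zero : ∀ {u} → (∀ x → + r ∣ₛ u x) → Image u
    Image-zero {u} r∣u = const 0ℤ , λ x → ∣-resp
      (trans (sym (ℤ.+-identityˡ (- u x))) (cong (_- u x) (sym (sum-zero λ a → ℤ.*-zeroʳ (s (x ⊖ a))))))
      (∣m⇒∣-m (r∣u x))

    Image-act : ∀ u → Image (act u)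
    Image-act u = u , λ x → ∣-resp (sym (ℤ.+-inverseʳ (act u x))) (∣0 (+ r))

    Image-sum : ∀ {m} (c : Vector ℤ m) (u : Fin m → Vector ℤ r) → (∀ i → Image (u i)) → Image (λ x → sum λ i → c i * u i x)
    Image-sum {zero}  c u u∈ = Image-zero λ x → ∣0 (+ r)
    Image-sum {suc m} c u u∈ = Image-linear (c zero) (u∈ zero) (Image-sum (tail c) (tail u) (u∈ ∘ suc))

    -- Modulo Δ the circulant acts as S, and Δʳ ≡ 0; so Sᵏ times the image of Δʳ⁻ᵏ lies in the image of
    -- the circulant by induction on k.
    Image-Δ^ : ∀ k m → k ℕ.+ m ≡ r → ∀ w → Image (λ x → S ^ k * Δ^ m w x)
    Image-Δ^ zero m refl w = Image-zero λ x → ∣n⇒∣m*n (S ^ 0) (Δ^-order-∣ w x)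
    Image-Δ^ (suc k) m eq w = Image-cong equal
      (Image-linear -1ℤ (Image-sum s (λ t x → c * (u (x ⊖ t) - u x)) translate) (Image-linear c (Image-act u) (Image-zero {const 0ℤ} λ x → ∣0 (+ r))))
      where
      c : ℤ
      c = S ^ k
      u : Vector ℤ r
      u = Δ^ m w
      -- `Tᵗ - 1` is a sum of shifts of `T - 1`, and `S ^ k` times `Δ u` is in the image by the
      -- induction hypothesis for `k` and `suc m`.
      translate-ℕ : ∀ t → Image (λ x → c * (u (x ⊖ [ t ]) - u x))
      translate-ℕ zero = Image-zero λ x → ∣-resp
        (sym (trans (cong (λ z → c * (u z - u x)) (trans (cong (x ⊹_) ⊝-⓪) (⊹-identityʳ x))) (trans (cong (c *_) (ℤ.+-inverseʳ (u x))) (ℤ.*-zeroʳ c))))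
        (∣0 (+ r))
      translate-ℕ (suc t) = Image-cong
        (λ x → trans (telescope c (u (x ⊖ [ 1 ] ⊖ [ t ])) (u (x ⊖ [ 1 ])) (u x))
          (cong (λ z → c * (u z - u x)) (trans (⊹-assoc x (⊝ [ 1 ]) (⊝ [ t ])) (cong (x ⊹_) (trans (⊝-⊹-comm [ 1 ] [ t ]) (cong ⊝_ ([]-+ 1 t)))))))
        (Image-linear 1ℤ (Image-shift (translate-ℕ t)) (Image-Δ^ k (suc m) (trans (ℕ.+-suc k m) eq) w))
        where
        telescope : ∀ c x y z → 1ℤ * (c * (x - y)) + c * (y - z) ≡ c * (x - z)
        telescope = solve-∀
      translate : ∀ t → Image (λ x → c * (u (x ⊖ t) - u x))
      translate t = subst (λ z → Image (λ x → c * (u (x ⊖ z) - u x))) ([toℕ] t) (translate-ℕ (toℕ t))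
      equal : ∀ x → -1ℤ * sum (λ t → s t * (c * (u (x ⊖ t) - u x))) + (c * act u x + 0ℤ) ≡ S * c * u x
      equal x = begin
        -1ℤ * sum (λ t → s t * (c * (u (x ⊖ t) - u x))) + (c * act u x + 0ℤ)
          ≡⟨ cong₂ (λ y z → -1ℤ * y + (c * z + 0ℤ)) left right ⟩
        -1ℤ * (c * V + - (c * u x) * S) + (c * V + 0ℤ)  ≡⟨ cancel c V (u x) S ⟩
        S * c * u x ∎
        where
        V : ℤ
        V = sum λ t → s t * u (x ⊖ t)
        right : act u x ≡ V
        right = trans (sym (sum-⊖ˡ x λ a → s (x ⊖ a) * u a)) (sum-cong-≗ λ t → cong (λ z → s z * u (x ⊖ t)) (⊖-⊖ x t))
        left : sum (λ t → s t * (c * (u (x ⊖ t) - u x))) ≡ c * V + - (c * u x) * S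
        left = trans (sum-cong-≗ λ t → spread (s t) c (u (x ⊖ t)) (u x))
          (trans (sum-linear c (λ t → s t * u (x ⊖ t)) (λ t → - (c * u x) * s t)) (cong (λ z → c * V + z) (sym (*-distribˡ-sum (- (c * u x)) s))))
          where
          spread : ∀ s c y z → s * (c * (y - z)) ≡ c * (s * y) + - (c * z) * s
          spread = solve-∀
        cancel : ∀ c V u S → -1ℤ * (c * V + - (c * u) * S) + (c * V + 0ℤ) ≡ S * c * u
        cancel = solve-∀

    -- Preimages of `Sʳ` times the unit vectors form a matrix `Y` with `circulant s ⊡ Y` congruent
    -- to `Sʳ` times the identity modulo `r`. On determinants, `r` then divides a power of `S`.
    sum-∣-of-det : + r ∣ₛ det (circulant s) → + r ∣ₛ S
    sum-∣-of-det r∣det = euclid-^ S r (euclid-^ (S ^ r) r (∣-resp (det-scalar r (S ^ r))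
      (∣-resp (difference (det (circulant s ⊡ Y)) (det {r} λ i j → S ^ r * δ i j))
        (∣m∣n⇒∣m-n (∣-resp (sym (det-⊡ (circulant s) Y)) (∣m⇒∣m*n (det Y) r∣det))
                   (det-≡-mod {M = circulant s ⊡ Y} {λ i j → S ^ r * δ i j} λ i j → ∣-resp (cong (λ z → (circulant s ⊡ Y) i j - S ^ r * z) (δ-sym j i)) (proj₂ (preimage j) i))))))
      where
      preimage : ∀ j → Image (λ x → S ^ r * δ j x)
      preimage j = Image-Δ^ r 0 (ℕ.+-identityʳ r) (δ j)
      Y : Matrix ℤ r r
      Y a j = proj₁ (preimage j) a
      difference : ∀ x y → x - (x - y) ≡ y
      difference = solve-∀

  circulant-dichotomy : ∀ s → ¬ (+ r ∣ₛ det (circulant s)) ⊎ + r * + r ∣ₛ det (circulant s)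
  circulant-dichotomy s with + r Signed.∣? sum s
  ... | yes r∣S = inj₂ (circulant-∣² s r∣S)
  ... | no  r∤S = inj₁ (r∤S ∘ sum-∣-of-det s)

-- The congruence between the components, and Fourier inversion

module Components (r : ℕ) .{{_ : ℕ.NonZero r}} (addition : Model.Addition r) where
  open Model r
  open Addition addition
  open ElementaryAbelian _⊞_ zero ⊞-comm ⊞-assoc ⊞-identityˡ ⊞-self

  module _ (character : Character) (ψ-suc⓪ : Character.ψ character (suc ⓪) ≡ -1ℤ) where
    open Character character
    open WithCharacter addition character ψ-suc⓪

    -- The functions on the dual whose Fourier coefficients are all divisible by q, and those that
    -- preserve them under multiplication. The latter form a ring containing the characters d ↦ χ d y.
    Divisible : Vector ℤ (suc r) → Set
    Divisible v = ∀ c → + suc r ∣ₛ sum λ d → χ d c * v d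

    record Multiplier (u : Vector ℤ (suc r)) : Set where
      constructor multiplier
      field preserves : ∀ v → Divisible v → Divisible (λ d → u d * v d)
    open Multiplier

    Multiplier-const : ∀ k → Multiplier (const k)
    Multiplier-const k .preserves w w∈ c = ∣-resp
      (trans (*-distribˡ-sum k λ d → χ d c * w d) (sum-cong-≗ λ d → swap-factors k (χ d c) (w d)))
      (∣n⇒∣m*n k (w∈ c))
      where
      swap-factors : ∀ k x y → k * (x * y) ≡ x * (k * y)
      swap-factors = solve-∀

    Multiplier-+ : ∀ {u v} → Multiplier u → Multiplier v → Multiplier (λ d → u d + v d)
    Multiplier-+ {u} {v} u∈ v∈ .preserves w w∈ c = ∣-resp
      (trans (sym (∑-distrib-+ (λ d → χ d c * (u d * w d)) (λ d → χ d c * (v d * w d))))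
        (sum-cong-≗ λ d → factor (χ d c) (u d) (v d) (w d)))
      (∣m∣n⇒∣m+n (preserves u∈ w w∈ c) (preserves v∈ w w∈ c))
      where
      factor : ∀ x u v w → x * (u * w) + x * (v * w) ≡ x * ((u + v) * w)
      factor = solve-∀

    Multiplier-* : ∀ {u v} → Multiplier u → Multiplier v → Multiplier (λ d → u d * v d)
    Multiplier-* {u} {v} u∈ v∈ .preserves w w∈ c = ∣-resp
      (sum-cong-≗ λ d → cong (χ d c *_) (sym (ℤ.*-assoc (u d) (v d) (w d))))
      (preserves u∈ (λ d → v d * w d) (preserves v∈ w w∈) c)

    Multiplier-χ : ∀ y → Multiplier (λ d → χ d y)
    Multiplier-χ y .preserves w w∈ c = ∣-resp
      (sum-cong-≗ λ d → trans (cong (_* w d) (χ-⊞ʳ d c y)) (ℤ.*-assoc (χ d c) (χ d y) (w d)))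
      (w∈ (c ⊞ y))

    Multiplier-sum : (u : Fin n → Vector ℤ (suc r)) → (∀ i → Multiplier (u i)) → Multiplier (λ d → sum λ i → u i d)
    Multiplier-sum {zero}  u u∈ = Multiplier-const 0ℤ
    Multiplier-sum {suc n} u u∈ = Multiplier-+ (u∈ zero) (Multiplier-sum (u ∘ suc) (u∈ ∘ suc))

    Multiplier-det : (M : Fin (suc r) → Matrix ℤ n n) → (∀ i j → Multiplier (λ d → M d i j)) → Multiplier (λ d → det (M d))
    Multiplier-det {zero}  M M∈ = Multiplier-const 1ℤ
    Multiplier-det {suc n} M M∈ = Multiplier-sum (λ j d → -1ℤ ^ toℕ j * M d zero j * det (minor j (M d))) λ j →
      Multiplier-* (Multiplier-* (Multiplier-const (-1ℤ ^ toℕ j)) (M∈ zero j))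
                   (Multiplier-det (λ d → minor j (M d)) λ i k → M∈ (suc i) (punchIn j k))

    Divisible-1 : Divisible (const 1ℤ)
    Divisible-1 c = divides (δ zero c) (trans (sum-cong-≗ λ d → ℤ.*-identityʳ (χ d c)) (trans (sum-χ c) (ℤ.*-comm (+ suc r) (δ zero c))))

    component-congruence : ∀ α → + suc r ∣ₛ det (component α (suc ⓪)) - det (component α zero)
    component-congruence α = ∣-resp (solution A B) (∣m∣n⇒∣m-n (divides B (ℤ.*-comm (+ suc r) B)) (∣-resp total
      (preserves (Multiplier-det (component α) (λ x a → Multiplier-sum (λ b d → χ d (suc (⊝ x) ⋆ b) * α (x ⊖ a) b)
          λ b → Multiplier-* (Multiplier-χ (suc (⊝ x) ⋆ b)) (Multiplier-const (α (x ⊖ a) b))))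
        (const 1ℤ) Divisible-1 zero)))
      where
      A B : ℤ
      A = det (component α zero)
      B = det (component α (suc ⓪))
      total : sum (λ d → χ d zero * (det (component α d) * 1ℤ)) ≡ A + + r * B
      total = trans
        (sum-cong-≗ λ d → trans (cong (_* (det (component α d) * 1ℤ)) (trans (cong ψ (⋆-zeroʳ d)) ψ-⓪)) (units (det (component α d))))
        (cong (λ z → A + z) (trans (sum-cong-≗ (det-component-suc α)) (sum-const r B)))
        where
        units : ∀ x → 1ℤ * (x * 1ℤ) ≡ x
        units = solve-∀
      solution : ∀ A B → + suc r * B - (A + + r * B) ≡ B - A
      solution = identity (+ r)
        where
        identity : ∀ r A B → (1ℤ + r) * B - (A + r * B) ≡ B - A
        identity = solve-∀

    -- Fourier inversion: the f-part is supported at b = 0 and contributes to every component, the X-part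
    -- contributes to the nontrivial components only.
    prescribed : Vector ℤ r → Matrix ℤ r r → Fin r → Fin (suc r) → ℤ
    prescribed f X z b = f z * δ zero b + sum λ x → X x (x ⊖ z) * χ (suc (⊝ x)) b

    χ-orthogonal : ∀ d e → sum (λ b → χ d b * χ e b) ≡ + suc r * δ d e
    χ-orthogonal d e = begin
      sum (λ b → χ d b * χ e b)    ≡⟨ sum-cong-≗ (λ b → trans (sym (χ-⊞ˡ d e b)) (χ-comm (d ⊞ e) b)) ⟩
      sum (λ b → χ b (d ⊞ e))      ≡⟨ sum-χ (d ⊞ e) ⟩
      + suc r * δ zero (d ⊞ e)     ≡⟨ cong (+ suc r *_) (δ-⇔ (⊞≡⓪⇒≡ ∘ sym) (λ d≡e → sym (trans (cong (_⊞ e) d≡e) (⊞-self e)))) ⟩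
      + suc r * δ d e              ∎

    -- Orthogonality selects at most one entry of `X`, and none for `e = zero`. The entry comes out
    -- multiplied by `q`, so the inversion needs no division as long as `M₁` is prescribed modulo
    -- `q` by `f`.
    prescribed-coefficient : ∀ f X e z → sum (λ b → χ e b * prescribed f X z b) ≡
                             f z + sum (λ x → X x (x ⊖ z) * (+ suc r * δ e (suc (⊝ x))))
    prescribed-coefficient f X e z = begin
      sum (λ b → χ e b * (f z * δ zero b + sum λ x → X x (x ⊖ z) * χ (suc (⊝ x)) b))
        ≡⟨ sum-cong-≗ (λ b → trans (spread (χ e b) (f z) (δ zero b) (sum λ x → X x (x ⊖ z) * χ (suc (⊝ x)) b))
             (cong (λ s → f z * (δ zero b * χ e b) + s) (trans (*-distribˡ-sum (χ e b) (λ x → X x (x ⊖ z) * χ (suc (⊝ x)) b))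
               (sum-cong-≗ λ x → exchange (χ e b) (X x (x ⊖ z)) (χ (suc (⊝ x)) b))))) ⟩
      sum (λ b → f z * (δ zero b * χ e b) + sum λ x → X x (x ⊖ z) * (χ e b * χ (suc (⊝ x)) b))
        ≡⟨ sum-linear (f z) (λ b → δ zero b * χ e b) (λ b → sum λ x → X x (x ⊖ z) * (χ e b * χ (suc (⊝ x)) b)) ⟩
      f z * sum (λ b → δ zero b * χ e b) + sum (λ b → sum λ x → X x (x ⊖ z) * (χ e b * χ (suc (⊝ x)) b))
        ≡⟨ cong₂ (λ p q → f z * p + q) (trans (sum-δˡ zero (χ e)) (trans (cong ψ (⋆-zeroʳ e)) ψ-⓪))
             (∑-comm (λ b x → X x (x ⊖ z) * (χ e b * χ (suc (⊝ x)) b))) ⟩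
      f z * 1ℤ + sum (λ x → sum λ b → X x (x ⊖ z) * (χ e b * χ (suc (⊝ x)) b))
        ≡⟨ cong₂ _+_ (ℤ.*-identityʳ (f z)) (sum-cong-≗ λ x → trans (sym (*-distribˡ-sum (X x (x ⊖ z)) (λ b → χ e b * χ (suc (⊝ x)) b)))
             (cong (X x (x ⊖ z) *_) (χ-orthogonal e (suc (⊝ x))))) ⟩
      f z + sum (λ x → X x (x ⊖ z) * (+ suc r * δ e (suc (⊝ x)))) ∎
      where
      spread : ∀ c f d s → c * (f * d + s) ≡ f * (d * c) + c * s
      spread = solve-∀
      exchange : ∀ a b c → a * (b * c) ≡ b * (a * c)
      exchange = solve-∀

    prescribed-zero : ∀ f X → component (prescribed f X) zero ≋ (λ x a → f (x ⊖ a))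
    prescribed-zero f X x a = begin
      component (prescribed f X) zero x a            ≡⟨ prescribed-coefficient f X zero (x ⊖ a) ⟩
      f (x ⊖ a) + sum (λ y → X y (y ⊖ (x ⊖ a)) * (+ suc r * 0ℤ))
        ≡⟨ cong (λ s → f (x ⊖ a) + s) (sum-zero λ y → vanish (X y (y ⊖ (x ⊖ a))) (+ suc r)) ⟩
      f (x ⊖ a) + 0ℤ                                 ≡⟨ ℤ.+-identityʳ (f (x ⊖ a)) ⟩
      f (x ⊖ a)                                      ∎
      where
      vanish : ∀ x q → x * (q * 0ℤ) ≡ 0ℤ
      vanish = solve-∀

    prescribed-suc : ∀ f X → component (prescribed f X) (suc ⓪) ≋ (λ x a → f (x ⊖ a) + + suc r * X x a)
    prescribed-suc f X x a = begin
      component (prescribed f X) (suc ⓪) x a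
        ≡⟨ sum-cong-≗ (λ b → cong (λ y → ψ y * prescribed f X (x ⊖ a) b) (⋆-identityˡ (suc (⊝ x) ⋆ b))) ⟩
      sum (λ b → χ (suc (⊝ x)) b * prescribed f X (x ⊖ a) b) ≡⟨ prescribed-coefficient f X (suc (⊝ x)) (x ⊖ a) ⟩
      f (x ⊖ a) + sum (λ y → X y (y ⊖ (x ⊖ a)) * (+ suc r * δ (⊝ x) (⊝ y)))
        ≡⟨ cong (λ s → f (x ⊖ a) + s) (sum-cong-≗ λ y → trans
             (cong (λ d → X y (y ⊖ (x ⊖ a)) * (+ suc r * d)) (δ-⇔ (λ eq → trans (sym (⊝-involutive x)) (trans (cong ⊝_ eq) (⊝-involutive y))) (cong ⊝_)))
             (reorder (X y (y ⊖ (x ⊖ a))) (+ suc r) (δ x y))) ⟩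
      f (x ⊖ a) + sum (λ y → δ x y * (+ suc r * X y (y ⊖ (x ⊖ a))))
        ≡⟨ cong (λ s → f (x ⊖ a) + s) (sum-δˡ x (λ y → + suc r * X y (y ⊖ (x ⊖ a)))) ⟩
      f (x ⊖ a) + + suc r * X x (x ⊖ (x ⊖ a))
        ≡⟨ cong (λ y → f (x ⊖ a) + + suc r * X x y) (⊖-⊖ x a) ⟩
      f (x ⊖ a) + + suc r * X x a ∎
      where
      reorder : ∀ x q d → x * (q * d) ≡ d * (q * x)
      reorder = solve-∀

-- Unimodular matrices

record Spanned (N : Matrix ℤ n n) (u : Vector ℤ n) : Set where
  constructor spanned
  field
    coefficients : Vector ℤ n
    combines     : ∀ i → sum (λ j → N i j * coefficients j) ≡ u i

Spanned-resp : {N : Matrix ℤ n n} {u v : Vector ℤ n} → u ≗ v → Spanned N u → Spanned N v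
Spanned-resp u≗v (spanned y Ny≡u) = spanned y λ i → trans (Ny≡u i) (u≗v i)

Spanned-linear : {N : Matrix ℤ n n} {u v : Vector ℤ n} (c : ℤ) → Spanned N u → Spanned N v → Spanned N (λ i → c * u i + v i)
Spanned-linear {N = N} {u} {v} c (spanned y Ny≡u) (spanned z Nz≡v) = spanned (λ j → c * y j + z j) λ i → begin
  sum (λ j → N i j * (c * y j + z j))              ≡⟨ sum-cong-≗ (λ j → expand c (N i j) (y j) (z j)) ⟩
  sum (λ j → c * (N i j * y j) + N i j * z j)      ≡⟨ sum-linear c (λ j → N i j * y j) (λ j → N i j * z j) ⟩
  c * sum (λ j → N i j * y j) + sum (λ j → N i j * z j) ≡⟨ cong₂ (λ s t → c * s + t) (Ny≡u i) (Nz≡v i) ⟩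
  c * u i + v i                                    ∎
  where
  expand : ∀ c x y z → x * (c * y + z) ≡ c * (x * y) + x * z
  expand = solve-∀

Spanned-column : (N : Matrix ℤ n n) (j : Fin n) → Spanned N (λ i → N i j)
Spanned-column N j = spanned (λ k → δ k j) λ i → sum-δʳ j (N i)

Spanned-0 : {N : Matrix ℤ n n} → Spanned N (const 0ℤ)
Spanned-0 {N = N} = spanned (const 0ℤ) λ i → sum-zero λ j → ℤ.*-zeroʳ (N i j)

Spanned-+ : {N : Matrix ℤ n n} {u v : Vector ℤ n} → Spanned N u → Spanned N v → Spanned N (λ i → u i + v i)
Spanned-+ {u = u} {v} u∈ v∈ = Spanned-resp (λ i → cong (λ z → z + v i) (ℤ.*-identityˡ (u i))) (Spanned-linear 1ℤ u∈ v∈)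

Spanned-- : {N : Matrix ℤ n n} {u v : Vector ℤ n} → Spanned N u → Spanned N v → Spanned N (λ i → u i - v i)
Spanned-- {u = u} {v} u∈ v∈ = Spanned-resp (λ i → commute (u i) (v i)) (Spanned-linear -1ℤ v∈ u∈)
  where
  commute : ∀ x y → -1ℤ * y + x ≡ x - y
  commute = solve-∀

Spanned-* : {N : Matrix ℤ n n} {u : Vector ℤ n} (c : ℤ) → Spanned N u → Spanned N (λ i → c * u i)
Spanned-* {u = u} c u∈ = Spanned-resp (λ i → ℤ.+-identityʳ (c * u i)) (Spanned-linear c u∈ Spanned-0)

Spanned-sum : {N : Matrix ℤ n n} (u : Fin m → Vector ℤ n) → (∀ k → Spanned N (u k)) → Spanned N (λ i → sum λ k → u k i)
Spanned-sum {m = zero}  u u∈ = Spanned-0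
Spanned-sum {m = suc m} u u∈ = Spanned-+ (u∈ zero) (Spanned-sum (u ∘ suc) (u∈ ∘ suc))

unit-square : ∀ x y → x * y ≡ 1ℤ → x * x ≡ 1ℤ
unit-square x y xy≡1 with x | ℕ.m*n≡1⇒m≡1 ℤ.∣ x ∣ ℤ.∣ y ∣ (trans (sym (ℤ.abs-* x y)) (cong ℤ.∣_∣ xy≡1))
... | + .1       | refl = refl
... | -[1+ .0 ]  | refl = refl

-- The coefficient vectors of the unit vectors assemble into an integral right inverse of `N`.
unimodular : (N : Matrix ℤ n n) → (∀ j → Spanned N (λ i → δ i j)) → det N * det N ≡ 1ℤ
unimodular {n} N e∈ = unit-square (det N) (det Y) (begin
  det N * det Y   ≡⟨ det-⊡ N Y ⟨
  det (N ⊡ Y)     ≡⟨ det-cong {M = N ⊡ Y} {δ} (λ i j → Spanned.combines (e∈ j) i) ⟩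
  det (δ {n})     ≡⟨ det-δ n ⟩
  1ℤ              ∎)
  where
  Y : Matrix ℤ n n
  Y i j = Spanned.coefficients (e∈ j) i

sum-δ : ∀ (c : Fin n) → sum (λ i → δ i c) ≡ 1ℤ
sum-δ c = trans (sum-cong-≗ λ i → sym (ℤ.*-identityˡ (δ i c))) (sum-δʳ c (const 1ℤ))

telescope : ∀ n (F : ℕ → ℤ) → sum {n} (λ j → F (toℕ j) - F (suc (toℕ j))) ≡ F 0 - F n
telescope zero    F = sym (ℤ.+-inverseʳ (F 0))
telescope (suc n) F = trans (cong (λ z → F 0 - F 1 + z) (telescope n (F ∘ suc))) (collapse (F 0) (F 1) (F (suc n)))
  where
  collapse : ∀ x y z → x - y + (y - z) ≡ x - z
  collapse = solve-∀

-- Prescribing circulant determinants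

module Realizations (r : ℕ) .{{_ : ℕ.NonZero r}} where
  open Cyclic r

  -- One pair `f`, `X` has to serve both components: `y = 0` gives `M₀` and `y = B - A` gives `M₁`.
  record Realization (A : ℤ) : Set where
    field
      f    : Vector ℤ r
      X    : Matrix ℤ r r
      σ    : ℤ
      σ²≡1 : σ * σ ≡ 1ℤ
      det≡ : ∀ y → det (λ x a → f (x ⊖ a) + y * X x a) ≡ (A + y) * σ

  -- If the columns of X other than b vanish, then so does the dependence on y once column b is replaced by w.
  realization : ∀ (b : Fin r) (f v w : Vector ℤ r) (X : Matrix ℤ r r) (A : ℤ) →
                v b ≡ 1ℤ → (∀ x a → a ≢ b → X x a ≡ 0ℤ) →
                (∀ y x → sum (λ a → (f (x ⊖ a) + y * X x a) * v a) ≡ (A + y) * w x) →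
                (∀ c → Spanned (transpose (setRow b w (transpose (circulant f)))) (λ x → δ x c)) →
                Realization A
  realization b f v w X A v[b] X≡0 eigen e∈ = record
    { f = f ; X = X ; σ = det N ; σ²≡1 = unimodular N e∈
    ; det≡ = λ y → trans (det-column-image b v (A + y) w (λ x a → f (x ⊖ a) + y * X x a) v[b] (eigen y))
        (cong ((A + y) *_) (det-cong (independent y)))
    }
    where
    N : Matrix ℤ r r
    N = transpose (setRow b w (transpose (circulant f)))
    independent : ∀ y → transpose (setRow b w (transpose (λ x a → f (x ⊖ a) + y * X x a))) ≋ N
    independent y i j with j ≟ b
    ... | yes _  = refl
    ... | no j≢b = trans (cong (λ z → f (i ⊖ j) + y * z) (X≡0 i j j≢b)) (trans (cong (λ z → f (i ⊖ j) + z) (ℤ.*-zeroʳ y)) (ℤ.+-identityʳ (f (i ⊖ j))))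

  δ-⊖ : ∀ x a c → δ (x ⊖ a) c ≡ δ x (c ⊹ a)
  δ-⊖ x a c = δ-⇔ (λ eq → trans (sym (⊖-⊹-cancel x a)) (cong (_⊹ a) eq)) (λ eq → trans (cong (_⊖ a) eq) (⊹-⊖-cancel c a))

  -- Values of `A` prime to `r`

  module CoprimeCase (t : ℕ) (m : ℤ) (r-prime : Prime r) (0<t : 0 ℕ.< t) (t<r : t ℕ.< r) where

    ι f : Vector ℤ r
    ι z = sum {t} λ j → δ z [ toℕ j ]
    f z = ι z + m

    sum-ι : sum ι ≡ + t
    sum-ι = begin
      sum (λ z → sum {t} λ j → δ z [ toℕ j ])   ≡⟨ ∑-comm (λ z (j : Fin t) → δ z [ toℕ j ]) ⟩
      sum {t} (λ j → sum λ z → δ z [ toℕ j ])   ≡⟨ sum-cong-≗ {t} (λ j → sum-δ [ toℕ j ]) ⟩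
      sum {t} (const 1ℤ)                        ≡⟨ sum-const t 1ℤ ⟩
      + t * 1ℤ                                  ≡⟨ ℤ.*-identityʳ (+ t) ⟩
      + t                                       ∎

    eigen : ∀ y x → sum (λ a → (f (x ⊖ a) + y * δ a ⓪) * 1ℤ) ≡ (+ t + m * + r + y) * 1ℤ
    eigen y x = begin
      sum (λ a → (ι (x ⊖ a) + m + y * δ a ⓪) * 1ℤ)  ≡⟨ sum-cong-≗ (λ a → reorder (ι (x ⊖ a)) m y (δ a ⓪)) ⟩
      sum (λ a → y * δ a ⓪ + (ι (x ⊖ a) + m))       ≡⟨ sum-linear y (λ a → δ a ⓪) (λ a → ι (x ⊖ a) + m) ⟩
      y * sum (λ a → δ a ⓪) + sum (λ a → ι (x ⊖ a) + m)
        ≡⟨ cong₂ (λ p q → y * p + q) (sum-δ ⓪) (trans (∑-distrib-+ (λ a → ι (x ⊖ a)) (const m))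
             (cong₂ _+_ (trans (sum-⊖ˡ x ι) sum-ι) (sum-const r m))) ⟩
      y * 1ℤ + (+ t + + r * m)                      ≡⟨ tidy y (+ t) (+ r) m ⟩
      (+ t + m * + r + y) * 1ℤ                      ∎
      where
      reorder : ∀ i m y d → (i + m + y * d) * 1ℤ ≡ y * d + (i + m)
      reorder = solve-∀
      tidy : ∀ y t r m → y * 1ℤ + (t + r * m) ≡ (t + m * r + y) * 1ℤ
      tidy = solve-∀

    N : Matrix ℤ r r
    N = transpose (setRow ⓪ (const 1ℤ) (transpose (circulant f)))

    one∈ : Spanned N (const 1ℤ)
    one∈ = Spanned-resp (setRow-≡ ⓪ (const 1ℤ) (transpose (circulant f))) (Spanned-column N ⓪)

    interval : Fin r → Vector ℤ r
    interval a x = ι (x ⊖ a)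

    interval∈-≢ : ∀ a → a ≢ ⓪ → Spanned N (interval a)
    interval∈-≢ a a≢⓪ = Spanned-resp (λ x → cancel (ι (x ⊖ a)) m)
      (Spanned-linear (- m) one∈ (Spanned-resp (setRow-≢ ⓪ (const 1ℤ) (transpose (circulant f)) a≢⓪) (Spanned-column N a)))
      where
      cancel : ∀ i m → - m * 1ℤ + (i + m) ≡ i
      cancel = solve-∀

    -- The intervals of length t cover every residue t times.
    interval∈-⓪ : Spanned N (interval ⓪)
    interval∈-⓪ = Spanned-resp value (Spanned-- (Spanned-* (+ t) one∈) (Spanned-sum others others∈))
      where
      others : Fin r → Vector ℤ r
      others a x = -1ℤ * (interval a x * δ a ⓪) + interval a x
      others∈ : ∀ a → Spanned N (others a)
      others∈ a with a ≟ ⓪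
      ... | yes refl = Spanned-resp (λ x → sym (trans (cong (λ z → -1ℤ * (interval ⓪ x * z) + interval ⓪ x) (δ-refl ⓪)) (vanish (interval ⓪ x)))) Spanned-0
        where
        vanish : ∀ i → -1ℤ * (i * 1ℤ) + i ≡ 0ℤ
        vanish = solve-∀
      ... | no a≢⓪ = Spanned-resp (λ x → sym (trans (cong (λ z → -1ℤ * (interval a x * z) + interval a x) (δ-≢ a≢⓪)) (keep (interval a x)))) (interval∈-≢ a a≢⓪)
        where
        keep : ∀ i → -1ℤ * (i * 0ℤ) + i ≡ i
        keep = solve-∀
      value : ∀ x → + t * 1ℤ - sum (λ a → others a x) ≡ interval ⓪ x
      value x = begin
        + t * 1ℤ - sum (λ a → others a x)   ≡⟨ cong (λ z → + t * 1ℤ - z) (sum-linear -1ℤ (λ a → interval a x * δ a ⓪) (λ a → interval a x)) ⟩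
        + t * 1ℤ - (-1ℤ * sum (λ a → interval a x * δ a ⓪) + sum (λ a → interval a x))
          ≡⟨ cong₂ (λ p q → + t * 1ℤ - (-1ℤ * p + q)) (sum-δʳ ⓪ (λ a → interval a x)) (trans (sum-⊖ˡ x ι) sum-ι) ⟩
        + t * 1ℤ - (-1ℤ * interval ⓪ x + + t) ≡⟨ cancel (+ t) (interval ⓪ x) ⟩
        interval ⓪ x ∎
        where
        cancel : ∀ t i → t * 1ℤ - (-1ℤ * i + t) ≡ i
        cancel = solve-∀

    interval∈ : ∀ a → Spanned N (interval a)
    interval∈ a with a ≟ ⓪
    ... | yes refl = interval∈-⓪
    ... | no a≢⓪   = interval∈-≢ a a≢⓪

    -- Translation of unit vectors by `z` is invisible modulo the column lattice of `N`. Such `z`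
    -- form a subgroup of the cyclic group.
    Period : Fin r → Set
    Period z = ∀ a → Spanned N (λ x → δ x a - δ x (z ⊹ a))

    Period-⊹ : ∀ {y z} → Period y → Period z → Period (y ⊹ z)
    Period-⊹ {y} {z} y∈ z∈ a = Spanned-resp
      (λ x → trans (collapse (δ x a) (δ x (z ⊹ a)) (δ x (y ⊹ (z ⊹ a)))) (cong (λ c → δ x a - δ x c) (sym (⊹-assoc y z a))))
      (Spanned-+ (z∈ a) (y∈ (z ⊹ a)))
      where
      collapse : ∀ x y z → x - y + (y - z) ≡ x - z
      collapse = solve-∀

    Period-⊝ : ∀ {z} → Period z → Period (⊝ z)
    Period-⊝ {z} z∈ a = Spanned-resp
      (λ x → trans (flip (δ x (⊝ z ⊹ a)) (δ x (z ⊹ (⊝ z ⊹ a)))) (cong (λ c → δ x c - δ x (⊝ z ⊹ a))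
        (trans (sym (⊹-assoc z (⊝ z) a)) (trans (cong (_⊹ a) (⊹-inverseʳ z)) (⊹-identityˡ a)))))
      (Spanned-* -1ℤ (z∈ (⊝ z ⊹ a)))
      where
      flip : ∀ x y → -1ℤ * (x - y) ≡ y - x
      flip = solve-∀

    Period-⓪ : Period ⓪
    Period-⓪ a = Spanned-resp (λ x → sym (trans (cong (λ c → δ x a - δ x c) (⊹-identityˡ a)) (ℤ.+-inverseʳ (δ x a)))) Spanned-0

    Period-* : ∀ k n → Period [ k ] → Period [ n ℕ.* k ]
    Period-* k zero    k∈ = Period-⓪
    Period-* k (suc n) k∈ = subst Period ([]-+ k (n ℕ.* k)) (Period-⊹ {[ k ]} {[ n ℕ.* k ]} k∈ (Period-* k n k∈))

    -- Two neighbouring intervals of length `t` differ only at their end points, which are `t`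
    -- apart.
    Period-t : Period [ t ]
    Period-t a = Spanned-resp value (Spanned-- (interval∈ a) (interval∈ ([ 1 ] ⊹ a)))
      where
      value : ∀ x → interval a x - interval ([ 1 ] ⊹ a) x ≡ δ x a - δ x ([ t ] ⊹ a)
      value x = begin
        interval a x - interval ([ 1 ] ⊹ a) x
          ≡⟨ cong₂ _-_ (sum-cong-≗ {t} λ j → δ-⊖ x a [ toℕ j ])
                       (sum-cong-≗ {t} λ j → trans (δ-⊖ x ([ 1 ] ⊹ a) [ toℕ j ]) (cong (δ x) (successor (toℕ j)))) ⟩
        sum {t} (λ j → F (toℕ j)) - sum {t} (λ j → F (suc (toℕ j)))  ≡⟨ sum-- {t} (λ j → F (toℕ j)) (λ j → F (suc (toℕ j))) ⟨
        sum {t} (λ j → F (toℕ j) - F (suc (toℕ j)))                  ≡⟨ telescope t F ⟩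
        δ x (⓪ ⊹ a) - δ x ([ t ] ⊹ a)                                ≡⟨ cong (λ c → δ x c - δ x ([ t ] ⊹ a)) (⊹-identityˡ a) ⟩
        δ x a - δ x ([ t ] ⊹ a)                                      ∎
        where
        F : ℕ → ℤ
        F j = δ x ([ j ] ⊹ a)
        successor : ∀ j → [ j ] ⊹ ([ 1 ] ⊹ a) ≡ [ suc j ] ⊹ a
        successor j = trans (sym (⊹-assoc [ j ] [ 1 ] a)) (cong (_⊹ a) (trans ([]-+ j 1) (cong [_] (ℕ.+-comm j 1))))

    bézout : Bézout.Identity 1 r t
    bézout = coprime-Bézout (prime⇒coprime r-prime {{ℕ.>-nonZero 0<t}} t<r)

    -- `t` generates the integers modulo `r`: in the two cases of Bézout's identity `y * t` is 1 or
    -- -1 modulo `r`.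
    Period-1 : Period [ 1 ]
    Period-1 with bézout
    ... | Bézout.-+ x y eq = subst Period ([]-≡ (trans (cong (ℕ._% r) (sym eq)) (ℕ.[m+kn]%n≡m%n 1 x r))) (Period-* t y Period-t)
    ... | Bézout.+- x y eq = subst Period (⊹-cancelʳ [ y ℕ.* t ] _ _ (trans (⊹-inverseˡ [ y ℕ.* t ]) (sym wrapped))) (Period-⊝ {[ y ℕ.* t ]} (Period-* t y Period-t))
      where
      wrapped : [ 1 ] ⊹ [ y ℕ.* t ] ≡ ⓪
      wrapped = trans ([]-+ 1 (y ℕ.* t)) ([]-≡ (trans (cong (ℕ._% r) eq) (trans (ℕ.m*n%n≡0 x r) (sym (ℕ.m*n%n≡0 0 r)))))

    translate∈ : ∀ c → Spanned N (λ x → δ x ⓪ - δ x c)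
    translate∈ c = subst (λ z → Spanned N (λ x → δ x ⓪ - δ x z))
      (trans (⊹-identityʳ [ toℕ c ℕ.* 1 ]) (trans (cong [_] (ℕ.*-identityʳ (toℕ c))) ([toℕ] c)))
      (Period-* 1 (toℕ c) Period-1 ⓪)

    -- Modulo the lattice all unit vectors now coincide, so an interval counts as `t` copies of the
    -- one at `⓪`. In the same way the all-ones vector counts as `r` copies, and coprimality leaves
    -- a single copy in `origin∈`.
    t-multiple∈ : Spanned N (λ x → + t * δ x ⓪)
    t-multiple∈ = Spanned-resp value (Spanned-+ interval∈-⓪ (Spanned-sum {m = t} (λ j x → δ x ⓪ - δ x [ toℕ j ]) (λ j → translate∈ [ toℕ j ])))
      where
      value : ∀ x → interval ⓪ x + sum {t} (λ j → δ x ⓪ - δ x [ toℕ j ]) ≡ + t * δ x ⓪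
      value x = trans (cong₂ _+_ (cong ι (trans (cong (x ⊹_) ⊝-⓪) (⊹-identityʳ x)))
          (trans (sum-- {t} (const (δ x ⓪)) (λ j → δ x [ toℕ j ])) (cong (λ z → z - ι x) (sum-const t (δ x ⓪)))))
        (cancel (ι x) (+ t * δ x ⓪))
        where
        cancel : ∀ x y → x + (y - x) ≡ y
        cancel = solve-∀

    r-multiple∈ : Spanned N (λ x → + r * δ x ⓪)
    r-multiple∈ = Spanned-resp value (Spanned-+ one∈ (Spanned-sum (λ c x → δ x ⓪ - δ x c) translate∈))
      where
      value : ∀ x → 1ℤ + sum (λ c → δ x ⓪ - δ x c) ≡ + r * δ x ⓪
      value x = trans (cong (λ z → 1ℤ + z) (trans (sum-- (const (δ x ⓪)) (λ c → δ x c))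
          (cong₂ _-_ (sum-const r (δ x ⓪)) (trans (sum-cong-≗ λ c → δ-sym x c) (sum-δ x)))))
        (cancel (+ r * δ x ⓪))
        where
        cancel : ∀ y → 1ℤ + (y - 1ℤ) ≡ y
        cancel = solve-∀

    origin∈ : Spanned N (λ x → δ x ⓪)
    origin∈ with bézout
    ... | Bézout.-+ x y eq = Spanned-resp (λ z → trans (regroup (+ y) (+ t) (+ x) (+ r) (δ z ⓪)) (trans (cong (_* δ z ⓪) coefficient) (ℤ.*-identityˡ (δ z ⓪))))
        (Spanned-- (Spanned-* (+ y) t-multiple∈) (Spanned-* (+ x) r-multiple∈))
      where
      regroup : ∀ y t x r d → y * (t * d) - x * (r * d) ≡ (y * t - x * r) * d
      regroup = solve-∀
      coefficient : + y * + t - + x * + r ≡ 1ℤ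
      coefficient = trans (cong₂ _-_ (trans (sym (ℤ.pos-* y t)) (trans (cong +_ (sym eq)) (cong (λ z → 1ℤ + z) (ℤ.pos-* x r)))) refl) (cancel (+ x * + r))
        where
        cancel : ∀ z → 1ℤ + z - z ≡ 1ℤ
        cancel = solve-∀
    ... | Bézout.+- x y eq = Spanned-resp (λ z → trans (regroup (+ y) (+ t) (+ x) (+ r) (δ z ⓪)) (trans (cong (_* δ z ⓪) coefficient) (ℤ.*-identityˡ (δ z ⓪))))
        (Spanned-- (Spanned-* (+ x) r-multiple∈) (Spanned-* (+ y) t-multiple∈))
      where
      regroup : ∀ y t x r d → x * (r * d) - y * (t * d) ≡ (x * r - y * t) * d
      regroup = solve-∀
      coefficient : + x * + r - + y * + t ≡ 1ℤ
      coefficient = trans (cong₂ _-_ (trans (sym (ℤ.pos-* x r)) (trans (cong +_ (sym eq)) (cong (λ z → 1ℤ + z) (ℤ.pos-* y t)))) refl) (cancel (+ y * + t))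
        where
        cancel : ∀ z → 1ℤ + z - z ≡ 1ℤ
        cancel = solve-∀

    coprimeRealization : Realization (+ t + m * + r)
    coprimeRealization = realization ⓪ f (const 1ℤ) (const 1ℤ) (λ x a → δ a ⓪) (+ t + m * + r) refl (λ x a → δ-≢) eigen
      λ c → Spanned-resp (λ x → cancel (δ x ⓪) (δ x c)) (Spanned-- origin∈ (translate∈ c))
      where
      cancel : ∀ x y → x - (x - y) ≡ y
      cancel = solve-∀

  -- Multiples of the square of `r`

  module SquareCase (h : ℕ) (r≡ : r ≡ suc (h ℕ.+ h)) (0<h : 0 ℕ.< h) (m : ℤ) where

    R H : ℤ
    R = + r
    H = + h

    R≡ : R ≡ 1ℤ + (H + H)
    R≡ = cong +_ r≡

    toℕ-[]-< : ∀ {n} → n ℕ.≤ h ℕ.+ h → toℕ [ n ] ≡ n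
    toℕ-[]-< {n} n≤2h = trans (toℕ-[] n) (ℕ.m<n⇒m%n≡m (subst (n ℕ.<_) (sym r≡) (ℕ.s≤s n≤2h)))

    last : Fin r
    last = [ h ℕ.+ h ]

    pred-⊹ : ∀ n → [ suc n ] ⊖ [ 1 ] ≡ [ n ]
    pred-⊹ n = trans (cong (_⊖ [ 1 ]) (trans (cong [_] (ℕ.+-comm 1 n)) (sym ([]-+ n 1)))) (⊹-⊖-cancel [ n ] [ 1 ])

    ⓪⊖1≡last : ⓪ ⊖ [ 1 ] ≡ last
    ⓪⊖1≡last = trans (cong (_⊖ [ 1 ]) (trans (sym [r]≡⓪) (cong [_] r≡))) (pred-⊹ (h ℕ.+ h))

    -- circ f v is x ↦ v x - v (x - 1) + m Σ v. Since Σ v = r, the slope - m r of v cancels the last term; step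
    -- contributes m r² at h, and its drop at 0 offsets the wrap-around of ramp.
    f v w ramp step : Vector ℤ r
    f z = δ z ⓪ - δ z [ 1 ] + m
    ramp x = + suc (toℕ x)
    step x = sum {suc h} λ j → δ x [ h ℕ.+ toℕ j ]
    v x = 1ℤ - m * R * ramp x + m * (R * R) * step x
    w x = δ x [ h ]

    -- The row is the support of `w` and the column is a place where `v` equals 1, so that `X` maps
    -- `v` to `w`.
    X : Matrix ℤ r r
    X x a = δ x [ h ] * δ a last

    ramp-difference : ∀ x → ramp x - ramp (x ⊖ [ 1 ]) ≡ 1ℤ - R * δ x ⓪
    ramp-difference x = subst (λ z → ramp z - ramp (z ⊖ [ 1 ]) ≡ 1ℤ - R * δ z ⓪) ([toℕ] x) (at (toℕ x) (ℕ.s≤s⁻¹ (subst (toℕ x ℕ.<_) r≡ (Fin.toℕ<n x))))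
      where
      at : ∀ n → n ℕ.≤ h ℕ.+ h → ramp [ n ] - ramp ([ n ] ⊖ [ 1 ]) ≡ 1ℤ - R * δ [ n ] ⓪
      at zero _ = begin
        ramp ⓪ - ramp (⓪ ⊖ [ 1 ])        ≡⟨ cong₂ (λ p q → + suc p - + suc q) (toℕ-[]-< ℕ.z≤n) (trans (cong toℕ ⓪⊖1≡last) (toℕ-[]-< ℕ.≤-refl)) ⟩
        1ℤ - + suc (h ℕ.+ h)             ≡⟨ cong (λ z → 1ℤ - + z) r≡ ⟨
        1ℤ - R                           ≡⟨ cong (λ z → 1ℤ - z) (trans (cong (R *_) (δ-refl ⓪)) (ℤ.*-identityʳ R)) ⟨
        1ℤ - R * δ ⓪ ⓪                   ∎
      at (suc n) n<2h = begin
        ramp [ suc n ] - ramp ([ suc n ] ⊖ [ 1 ])  ≡⟨ cong₂ (λ p q → + suc p - + suc q) (toℕ-[]-< n<2h) (trans (cong toℕ (pred-⊹ n)) (toℕ-[]-< (ℕ.<⇒≤ n<2h))) ⟩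
        1ℤ + + suc n - + suc n                     ≡⟨ cancel (+ suc n) R ⟩
        1ℤ - R * 0ℤ                                ≡⟨ cong (λ z → 1ℤ - R * z) (δ-≢ λ eq → ℕ.1+n≢0 (trans (sym (toℕ-[]-< n<2h)) (trans (cong toℕ eq) (toℕ-[]-< ℕ.z≤n)))) ⟨
        1ℤ - R * δ [ suc n ] ⓪                     ∎
        where
        cancel : ∀ x R → 1ℤ + x - x ≡ 1ℤ - R * 0ℤ
        cancel = solve-∀

    step-difference : ∀ x → step x - step (x ⊖ [ 1 ]) ≡ δ x [ h ] - δ x ⓪
    step-difference x = begin
      step x - step (x ⊖ [ 1 ])
        ≡⟨ cong (λ z → step x - z) (sum-cong-≗ {suc h} λ j → trans (δ-⊖ x [ 1 ] [ h ℕ.+ toℕ j ]) (cong (δ x) (successor (toℕ j)))) ⟩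
      sum {suc h} (λ j → F (toℕ j)) - sum {suc h} (λ j → F (suc (toℕ j)))  ≡⟨ sum-- {suc h} (λ j → F (toℕ j)) (λ j → F (suc (toℕ j))) ⟨
      sum {suc h} (λ j → F (toℕ j) - F (suc (toℕ j)))                      ≡⟨ telescope (suc h) F ⟩
      δ x [ h ℕ.+ 0 ] - δ x [ h ℕ.+ suc h ]
        ≡⟨ cong₂ (λ p q → δ x p - δ x q) (cong [_] (ℕ.+-identityʳ h)) (trans (cong [_] (trans (ℕ.+-suc h h) (sym r≡))) [r]≡⓪) ⟩
      δ x [ h ] - δ x ⓪ ∎
      where
      F : ℕ → ℤ
      F j = δ x [ h ℕ.+ j ]
      successor : ∀ j → [ h ℕ.+ j ] ⊹ [ 1 ] ≡ [ h ℕ.+ suc j ]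
      successor j = trans ([]-+ (h ℕ.+ j) 1) (cong [_] (trans (ℕ.+-comm (h ℕ.+ j) 1) (sym (ℕ.+-suc h j))))

    ⓪≢ : ∀ {n} → n ℕ.≤ h ℕ.+ h → 0 ℕ.< n → ⓪ ≢ [ n ]
    ⓪≢ n≤2h 0<n eq = ℕ.<⇒≢ 0<n (trans (sym (toℕ-[]-< ℕ.z≤n)) (trans (cong toℕ eq) (toℕ-[]-< n≤2h)))

    step-⓪ : step ⓪ ≡ 0ℤ
    step-⓪ = sum-zero {suc h} λ j → δ-≢ (⓪≢ (ℕ.+-monoʳ-≤ h (ℕ.s≤s⁻¹ (Fin.toℕ<n j))) (ℕ.m≤n⇒m≤n+o (toℕ j) 0<h))

    v-last : v last ≡ 1ℤ
    v-last = begin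
      1ℤ - m * R * ramp last + m * (R * R) * step last
        ≡⟨ cong₂ (λ p q → 1ℤ - m * R * p + m * (R * R) * q) (cong +_ (trans (cong suc (toℕ-[]-< ℕ.≤-refl)) (sym r≡))) step-last ⟩
      1ℤ - m * R * R + m * (R * R) * 1ℤ ≡⟨ cancel m R ⟩
      1ℤ ∎
      where
      cancel : ∀ m R → 1ℤ - m * R * R + m * (R * R) * 1ℤ ≡ 1ℤ
      cancel = solve-∀
      isolate : ∀ x y → y ≡ x - (x - y)
      isolate = solve-∀
      step-last : step last ≡ 1ℤ
      step-last = begin
        step last                               ≡⟨ cong step ⓪⊖1≡last ⟨
        step (⓪ ⊖ [ 1 ])                        ≡⟨ isolate (step ⓪) (step (⓪ ⊖ [ 1 ])) ⟩
        step ⓪ - (step ⓪ - step (⓪ ⊖ [ 1 ]))    ≡⟨ cong₂ _-_ step-⓪ (step-difference ⓪) ⟩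
        0ℤ - (δ ⓪ [ h ] - δ ⓪ ⓪)                ≡⟨ cong₂ (λ p q → 0ℤ - (p - q)) (δ-≢ (⓪≢ (ℕ.m≤m+n h h) 0<h)) (δ-refl ⓪) ⟩
        1ℤ                                      ∎

    sum-ramp : sum ramp ≡ R * (1ℤ + H)
    sum-ramp = ℤ.*-cancelˡ-≡ (+ 2) (sum ramp) (R * (1ℤ + H)) (begin
      + 2 * sum ramp                                        ≡⟨ isolate (+ 2) (sum ramp) ⟩
      - (- + 2 * sum ramp)                                  ≡⟨ cong -_ (*-distribˡ-sum (- + 2) ramp) ⟩
      - sum (λ i → - + 2 * ramp i)                          ≡⟨ cong -_ (sum-cong-≗ {r} λ i → step² (+ toℕ i)) ⟩
      - sum {r} (λ i → F (toℕ i) - F (suc (toℕ i)))             ≡⟨ cong -_ (telescope r F) ⟩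
      - (0ℤ - R * (1ℤ + R))                                 ≡⟨ cong (λ z → - (0ℤ - R * (1ℤ + z))) R≡ ⟩
      - (0ℤ - R * (1ℤ + (1ℤ + (H + H))))                    ≡⟨ tidy R H ⟩
      + 2 * (R * (1ℤ + H))                                  ∎)
      where
      F : ℕ → ℤ
      F n = + n * (1ℤ + + n)
      isolate : ∀ c x → c * x ≡ - (- c * x)
      isolate = solve-∀
      step² : ∀ n → - + 2 * (1ℤ + n) ≡ n * (1ℤ + n) - (1ℤ + n) * (1ℤ + (1ℤ + n))
      step² = solve-∀
      tidy : ∀ R H → - (0ℤ - R * (1ℤ + (1ℤ + (H + H)))) ≡ + 2 * (R * (1ℤ + H))
      tidy = solve-∀

    sum-step : sum step ≡ 1ℤ + H
    sum-step = begin
      sum (λ x → sum {suc h} λ j → δ x [ h ℕ.+ toℕ j ]) ≡⟨ ∑-comm (λ x (j : Fin (suc h)) → δ x [ h ℕ.+ toℕ j ]) ⟩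
      sum {suc h} (λ j → sum λ x → δ x [ h ℕ.+ toℕ j ]) ≡⟨ sum-cong-≗ {suc h} (λ j → sum-δ [ h ℕ.+ toℕ j ]) ⟩
      sum {suc h} (const 1ℤ)                            ≡⟨ sum-const (suc h) 1ℤ ⟩
      + suc h * 1ℤ                                      ≡⟨ ℤ.*-identityʳ (+ suc h) ⟩
      1ℤ + H                                            ∎

    -- `ramp` has mean `1 + h` and `step` is supported on `1 + h` places, so their contributions
    -- cancel. This is what fixes the jump of `step`, and with it the support of `w`, at the middle
    -- position `h`.
    sum-v : sum v ≡ R
    sum-v = begin
      sum v                                      ≡⟨ sum-cong-≗ (λ x → reorder (m * R) (m * (R * R)) (ramp x) (step x)) ⟩
      sum (λ x → m * (R * R) * step x + (- (m * R) * ramp x + 1ℤ))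
        ≡⟨ trans (sum-linear (m * (R * R)) step (λ x → - (m * R) * ramp x + 1ℤ))
                 (cong (λ z → m * (R * R) * sum step + z) (sum-linear (- (m * R)) ramp (const 1ℤ))) ⟩
      m * (R * R) * sum step + (- (m * R) * sum ramp + sum {r} (const 1ℤ))
        ≡⟨ cong₂ (λ p q → m * (R * R) * p + (- (m * R) * q + sum {r} (const 1ℤ))) sum-step sum-ramp ⟩
      m * (R * R) * (1ℤ + H) + (- (m * R) * (R * (1ℤ + H)) + sum {r} (const 1ℤ))
        ≡⟨ cong (λ z → m * (R * R) * (1ℤ + H) + (- (m * R) * (R * (1ℤ + H)) + z)) (sum-const r 1ℤ) ⟩
      m * (R * R) * (1ℤ + H) + (- (m * R) * (R * (1ℤ + H)) + R * 1ℤ) ≡⟨ cancel m R H ⟩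
      R ∎
      where
      reorder : ∀ a b x y → 1ℤ - a * x + b * y ≡ b * y + (- a * x + 1ℤ)
      reorder = solve-∀
      cancel : ∀ m R H → m * (R * R) * (1ℤ + H) + (- (m * R) * (R * (1ℤ + H)) + R * 1ℤ) ≡ R
      cancel = solve-∀

    f-⊖ : ∀ x a → f (x ⊖ a) ≡ δ x a - δ x ([ 1 ] ⊹ a) + m
    f-⊖ x a = cong₂ (λ p q → p - q + m) (trans (δ-⊖ x a ⓪) (cong (δ x) (⊹-identityˡ a))) (δ-⊖ x a [ 1 ])

    eigen : ∀ y x → sum (λ a → (f (x ⊖ a) + y * X x a) * v a) ≡ (m * (R * R) + y) * w x
    eigen y x = begin
      sum (λ a → (f (x ⊖ a) + y * X x a) * v a)
        ≡⟨ sum-cong-≗ (λ a → trans (cong (λ z → (z + y * X x a) * v a) (trans (f-⊖ x a) (cong (λ z → δ x a - z + m)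
             (trans (cong (δ x) (⊹-comm [ 1 ] a)) (sym (δ-⊖ x [ 1 ] a))))))
             (spread (δ x a) (δ (x ⊖ [ 1 ]) a) m y (δ x [ h ]) (δ a last) (v a))) ⟩
      sum (λ a → -1ℤ * (δ (x ⊖ [ 1 ]) a * v a) + (m * v a + (y * δ x [ h ] * (v a * δ a last) + δ x a * v a)))
        ≡⟨ trans (sum-linear -1ℤ (λ a → δ (x ⊖ [ 1 ]) a * v a) (λ a → m * v a + (y * δ x [ h ] * (v a * δ a last) + δ x a * v a)))
          (cong (λ z → -1ℤ * sum (λ a → δ (x ⊖ [ 1 ]) a * v a) + z) (trans
            (sum-linear m v (λ a → y * δ x [ h ] * (v a * δ a last) + δ x a * v a))
            (cong (λ z → m * sum v + z) (sum-linear (y * δ x [ h ]) (λ a → v a * δ a last) (λ a → δ x a * v a))))) ⟩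
      -1ℤ * sum (λ a → δ (x ⊖ [ 1 ]) a * v a) + (m * sum v + (y * δ x [ h ] * sum (λ a → v a * δ a last) + sum (λ a → δ x a * v a)))
        ≡⟨ cong₂ (λ p q → -1ℤ * p + (m * sum v + q)) (sum-δˡ (x ⊖ [ 1 ]) v)
             (cong₂ (λ p q → y * δ x [ h ] * p + q) (trans (sum-δʳ last v) v-last) (sum-δˡ x v)) ⟩
      -1ℤ * v (x ⊖ [ 1 ]) + (m * sum v + (y * δ x [ h ] * 1ℤ + v x))
        ≡⟨ cong (λ z → -1ℤ * v (x ⊖ [ 1 ]) + (m * z + (y * δ x [ h ] * 1ℤ + v x))) sum-v ⟩
      -1ℤ * v (x ⊖ [ 1 ]) + (m * R + (y * δ x [ h ] * 1ℤ + v x))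
        ≡⟨ collect m R (ramp x) (ramp (x ⊖ [ 1 ])) (step x) (step (x ⊖ [ 1 ])) (y * δ x [ h ]) ⟩
      m * R * (1ℤ - (ramp x - ramp (x ⊖ [ 1 ]))) + m * (R * R) * (step x - step (x ⊖ [ 1 ])) + y * δ x [ h ]
        ≡⟨ cong₂ (λ p q → m * R * (1ℤ - p) + m * (R * R) * q + y * δ x [ h ]) (ramp-difference x) (step-difference x) ⟩
      m * R * (1ℤ - (1ℤ - R * δ x ⓪)) + m * (R * R) * (δ x [ h ] - δ x ⓪) + y * δ x [ h ]
        ≡⟨ cancel m R (δ x ⓪) (δ x [ h ]) y ⟩
      (m * (R * R) + y) * w x ∎
      where
      spread : ∀ d e m y k l v → (d - e + m + y * (k * l)) * v ≡ -1ℤ * (e * v) + (m * v + (y * k * (v * l) + d * v))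
      spread = solve-∀
      collect : ∀ m R p q s t z → -1ℤ * (1ℤ - m * R * q + m * (R * R) * t) + (m * R + (z * 1ℤ + (1ℤ - m * R * p + m * (R * R) * s))) ≡
                m * R * (1ℤ - (p - q)) + m * (R * R) * (s - t) + z
      collect = solve-∀
      cancel : ∀ m R d k y → m * R * (1ℤ - (1ℤ - R * d)) + m * (R * R) * (k - d) + y * k ≡ (m * (R * R) + y) * k
      cancel = solve-∀

    N : Matrix ℤ r r
    N = transpose (setRow last w (transpose (circulant f)))

    column∈ : ∀ n → suc n ℕ.≤ h ℕ.+ h → Spanned N (λ x → δ x [ n ] - δ x [ suc n ] + m)
    column∈ n n<2h = Spanned-resp
      (λ x → trans (setRow-≢ last w (transpose (circulant f)) {[ n ]} n≢last x)
        (trans (f-⊖ x [ n ]) (cong (λ c → δ x [ n ] - δ x c + m) ([]-+ 1 n))))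
      (Spanned-column N [ n ])
      where
      n≢last : [ n ] ≢ last
      n≢last eq = ℕ.<⇒≢ n<2h (trans (sym (toℕ-[]-< (ℕ.<⇒≤ n<2h))) (trans (cong toℕ eq) (toℕ-[]-< ℕ.≤-refl)))

    -- Starting from the replaced column `δ` at `h`, each further column moves the unit vector by
    -- one place and changes the constant by `m`; this is the accumulated result.
    shifted : ℕ → Vector ℤ r
    shifted n x = δ x [ n ] + m * (H - + n)

    shifted∈-h : Spanned N (shifted h)
    shifted∈-h = Spanned-resp
      (λ x → trans (setRow-≡ last w (transpose (circulant f)) x) (add-zero (δ x [ h ]) m H))
      (Spanned-column N last)
      where
      add-zero : ∀ d m H → d ≡ d + m * (H - H)
      add-zero = solve-∀

    shifted∈-up : ∀ k → k ℕ.≤ h → Spanned N (shifted (h ℕ.+ k))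
    shifted∈-up zero    _   = subst (Spanned N ∘ shifted) (sym (ℕ.+-identityʳ h)) shifted∈-h
    shifted∈-up (suc k) k<h = subst (Spanned N ∘ shifted) (sym (ℕ.+-suc h k)) (Spanned-resp
      (λ x → advance (δ x [ h ℕ.+ k ]) (δ x [ suc (h ℕ.+ k) ]) m H (+ (h ℕ.+ k)))
      (Spanned-- (shifted∈-up k (ℕ.<⇒≤ k<h)) (column∈ (h ℕ.+ k) (subst (ℕ._≤ h ℕ.+ h) (ℕ.+-suc h k) (ℕ.+-monoʳ-≤ h k<h)))))
      where
      advance : ∀ d e m H n → d + m * (H - n) - (d - e + m) ≡ e + m * (H - (1ℤ + n))
      advance = solve-∀

    shifted∈-down : ∀ k n → n ℕ.+ k ≡ h → Spanned N (shifted n)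
    shifted∈-down zero    n eq = subst (Spanned N ∘ shifted) (trans (sym eq) (ℕ.+-identityʳ n)) shifted∈-h
    shifted∈-down (suc k) n eq = Spanned-resp
      (λ x → retreat (δ x [ n ]) (δ x [ suc n ]) m H (+ n))
      (Spanned-+ (shifted∈-down k (suc n) eq′) (column∈ n (ℕ.≤-trans (subst (suc n ℕ.≤_) eq′ (ℕ.m≤m+n (suc n) k)) (ℕ.m≤m+n h h))))
      where
      eq′ : suc n ℕ.+ k ≡ h
      eq′ = trans (sym (ℕ.+-suc n k)) eq
      retreat : ∀ d e m H n → e + m * (H - (1ℤ + n)) + (d - e + m) ≡ d + m * (H - n)
      retreat = solve-∀

    shifted∈ : ∀ (i : Fin r) → Spanned N (shifted (toℕ i))
    shifted∈ i with ℕ.≤-total (toℕ i) h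
    ... | inj₁ i≤h = shifted∈-down (h ∸ toℕ i) (toℕ i) (ℕ.m+[n∸m]≡n i≤h)
    ... | inj₂ h≤i = subst (Spanned N ∘ shifted) (ℕ.m+[n∸m]≡n h≤i) (shifted∈-up (toℕ i ∸ h)
      (ℕ.m≤n+o⇒m∸n≤o (toℕ i) h (ℕ.s≤s⁻¹ (subst (toℕ i ℕ.<_) r≡ (Fin.toℕ<n i)))))

    -- The constants `m * (H - n)` for `n` from 0 to `2h` are symmetric about zero, so they cancel
    -- in the sum of all `shifted` vectors. Subtracting multiples of the all-ones vector then
    -- isolates the unit vectors.
    one∈ : Spanned N (const 1ℤ)
    one∈ = Spanned-resp total (Spanned-sum {m = r} (λ i → shifted (toℕ i)) shifted∈)
      where
      total : ∀ x → sum {r} (λ i → shifted (toℕ i) x) ≡ 1ℤ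
      total x = begin
        sum {r} (λ i → δ x [ toℕ i ] + m * (H - + toℕ i))
          ≡⟨ sum-cong-≗ {r} (λ i → trans (cong (λ c → δ x c + m * (H - + toℕ i)) ([toℕ] i))
               (trans (cong (λ d → d + m * (H - + toℕ i)) (δ-sym x i)) (reorder (δ i x) m H (+ toℕ i)))) ⟩
        sum (λ i → - m * ramp i + (δ i x + m * (1ℤ + H)))
          ≡⟨ trans (sum-linear (- m) ramp (λ i → δ i x + m * (1ℤ + H))) (cong₂ (λ p q → - m * p + q) sum-ramp
               (trans (∑-distrib-+ (λ i → δ i x) (const (m * (1ℤ + H)))) (cong₂ _+_ (sum-δ x) (sum-const r (m * (1ℤ + H)))))) ⟩
        - m * (R * (1ℤ + H)) + (1ℤ + R * (m * (1ℤ + H))) ≡⟨ cancel m R H ⟩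
        1ℤ ∎
        where
        reorder : ∀ d m H n → d + m * (H - n) ≡ - m * (1ℤ + n) + (d + m * (1ℤ + H))
        reorder = solve-∀
        cancel : ∀ m R H → - m * (R * (1ℤ + H)) + (1ℤ + R * (m * (1ℤ + H))) ≡ 1ℤ
        cancel = solve-∀

    squareRealization : Realization (m * (R * R))
    squareRealization = realization last f v w X (m * (R * R)) v-last
      (λ x a a≢last → trans (cong (δ x [ h ] *_) (δ-≢ a≢last)) (ℤ.*-zeroʳ (δ x [ h ]))) eigen
      λ c → Spanned-resp (λ x → trans (cancel (δ x [ toℕ c ]) (m * (H - + toℕ c))) (cong (δ x) ([toℕ] c)))
              (Spanned-- (shifted∈ c) (Spanned-* (m * (H - + toℕ c)) one∈))
      where
      cancel : ∀ d k → d + k - k * 1ℤ ≡ d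
      cancel = solve-∀

  realize : Prime r → (h : ℕ) → r ≡ suc (h ℕ.+ h) → 0 ℕ.< h →
            ∀ A → ¬ (+ r ∣ₛ A) ⊎ + r * + r ∣ₛ A → Realization A
  realize r-prime h r≡ 0<h A (inj₁ r∤A) =
    subst Realization (sym A≡) (CoprimeCase.coprimeRealization (A ℤ.%ℕ r) (A ℤ./ℕ r) r-prime
      (ℕ.n≢0⇒n>0 λ t≡0 → r∤A (divides (A ℤ./ℕ r) (trans A≡ (trans (cong (λ t → + t + (A ℤ./ℕ r) * + r) t≡0) (ℤ.+-identityˡ ((A ℤ./ℕ r) * + r))))))
      (ℤ.n%ℕd<d A r))
    where
    A≡ : A ≡ + (A ℤ.%ℕ r) + (A ℤ./ℕ r) * + r
    A≡ = ℤ.a≡a%ℕn+[a/ℕn]*n A r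
  realize r-prime h r≡ 0<h A (inj₂ (divides m A≡)) = subst Realization (sym A≡) (SquareCase.squareRealization h r≡ 0<h m)

-- The determinants in coordinates

^-distribʳ-* : ∀ x y n → (x * y) ^ n ≡ x ^ n * y ^ n
^-distribʳ-* x y zero    = refl
^-distribʳ-* x y (suc n) = trans (cong (x * y *_) (^-distribʳ-* x y n)) (interchange x y (x ^ n) (y ^ n))
  where
  interchange : ∀ a b c d → a * b * (c * d) ≡ a * c * (b * d)
  interchange = solve-∀

module Spectrum (r : ℕ) .{{_ : ℕ.NonZero r}} (r-prime : Prime r)
  (h : ℕ) (r≡ : r ≡ suc (h ℕ.+ h)) (0<h : 0 ℕ.< h) (addition : Model.Addition r) where
  open Model r
  open Addition addition
  open ElementaryAbelian _⊞_ zero ⊞-comm ⊞-assoc ⊞-identityˡ ⊞-self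
  open Components r addition
  open Realizations r

  Factors : ℤ → Set
  Factors D = ∃[ A ] ∃[ B ] D ≡ A * B ^ r × (¬ (+ r ∣ₛ A) ⊎ + r * + r ∣ₛ A) × + suc r ∣ₛ B - A

  private
    character : Σ[ χ ∈ Character ] Character.ψ χ (suc ⓪) ≡ -1ℤ
    character = ∃-character (suc ⓪) λ ()

  open Character (proj₁ character)
  open WithCharacter addition (proj₁ character) (proj₂ character)

  factors : ∀ α → Factors (det (flatten (groupMatrix addition α)))
  factors α = det (component α zero) , det (component α (suc ⓪)) , factorization α ,
    subst (λ z → ¬ (+ r ∣ₛ z) ⊎ + r * + r ∣ₛ z) (sym (det-cong circular)) (CirculantModulo.circulant-dichotomy r r-prime s) ,
    component-congruence (proj₁ character) (proj₂ character) α
    where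
    s : Vector ℤ r
    -- The factor `ψ zero`, which is 1, is kept so that `circular` holds definitionally.
    s z = sum λ b → ψ zero * α z b
    circular : component α zero ≋ circulant s
    circular x a = refl

  attained : ∀ D → Factors D → ∃[ α ] D ≡ det (flatten (groupMatrix addition α))
  attained D (A , B , D≡ , r∤A⊎r²∣A , divides k B-A≡) = prescribed′ , sym (begin
    det (flatten (groupMatrix addition prescribed′))                     ≡⟨ factorization prescribed′ ⟩
    det (component prescribed′ zero) * det (component prescribed′ (suc ⓪)) ^ r ≡⟨ cong₂ (λ x y → x * y ^ r) det₀ det₁ ⟩
    A * σ * (B * σ) ^ r                                                  ≡⟨ cong (A * σ *_) (^-distribʳ-* B σ r) ⟩
    A * σ * (B ^ r * σ ^ r)                                              ≡⟨ regroup A σ (B ^ r) (σ ^ r) ⟩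
    A * B ^ r * (σ * σ ^ r)                                              ≡⟨ cong (A * B ^ r *_) σ^[r+1] ⟩
    A * B ^ r * 1ℤ                                                       ≡⟨ ℤ.*-identityʳ (A * B ^ r) ⟩
    A * B ^ r                                                            ≡⟨ D≡ ⟨
    D                                                                    ∎)
    where
    open Realization (realize r-prime h r≡ 0<h A r∤A⊎r²∣A)
    X′ : Matrix ℤ r r
    -- Here `k` is `(B - A) / q`. Since `prescribed-suc` contributes a factor `q`, the parameter `y`
    -- in `det≡` becomes `B - A`.
    X′ x a = k * X x a
    prescribed′ : Fin r → Fin (suc r) → ℤ
    prescribed′ = prescribed (proj₁ character) (proj₂ character) f X′
    det₀ : det (component prescribed′ zero) ≡ A * σ
    det₀ = begin
      det (component prescribed′ zero)          ≡⟨ det-cong (λ x a → trans (prescribed-zero (proj₁ character) (proj₂ character) f X′ x a) (sym (drop (f (x ⊖ a)) (X x a)))) ⟩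
      det (λ x a → f (x ⊖ a) + 0ℤ * X x a)      ≡⟨ det≡ 0ℤ ⟩
      (A + 0ℤ) * σ                              ≡⟨ cong (_* σ) (ℤ.+-identityʳ A) ⟩
      A * σ                                     ∎
      where
      drop : ∀ f x → f + 0ℤ * x ≡ f
      drop = solve-∀
    det₁ : det (component prescribed′ (suc ⓪)) ≡ B * σ
    det₁ = begin
      det (component prescribed′ (suc ⓪))
        ≡⟨ det-cong (λ x a → trans (prescribed-suc (proj₁ character) (proj₂ character) f X′ x a) (cong (λ z → f (x ⊖ a) + z) (swap-factors (+ suc r) k (X x a)))) ⟩
      det (λ x a → f (x ⊖ a) + k * + suc r * X x a)  ≡⟨ det≡ (k * + suc r) ⟩
      (A + k * + suc r) * σ                          ≡⟨ cong (λ z → (A + z) * σ) B-A≡ ⟨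
      (A + (B - A)) * σ                              ≡⟨ cong (_* σ) (recombine A B) ⟩
      B * σ                                          ∎
      where
      swap-factors : ∀ q k x → q * (k * x) ≡ k * q * x
      swap-factors = solve-∀
      recombine : ∀ A B → A + (B - A) ≡ B
      recombine = solve-∀
    regroup : ∀ a s b t → a * s * (b * t) ≡ a * b * (s * t)
    regroup = solve-∀
    σ^[r+1] : σ * σ ^ r ≡ 1ℤ
    σ^[r+1] = begin
      σ * σ ^ r                       ≡⟨ cong (λ n → σ * σ ^ n) r≡ ⟩
      σ * (σ * σ ^ (h ℕ.+ h))         ≡⟨ ℤ.*-assoc σ σ (σ ^ (h ℕ.+ h)) ⟨
      σ * σ * σ ^ (h ℕ.+ h)           ≡⟨ cong₂ _*_ σ²≡1 (ℤ.^-distribˡ-+-* σ h h) ⟩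
      1ℤ * (σ ^ h * σ ^ h)            ≡⟨ cong (1ℤ *_) (^-distribʳ-* σ σ h) ⟨
      1ℤ * (σ * σ) ^ h                ≡⟨ cong (λ z → 1ℤ * z ^ h) σ²≡1 ⟩
      1ℤ * 1ℤ ^ h                     ≡⟨ cong (1ℤ *_) (ℤ.^-zeroˡ h) ⟩
      1ℤ                              ∎

-- Finite fields with a prime number of units

injective⇒surjective : (f : Fin n → Fin n) → (∀ {i j} → f i ≡ f j → i ≡ j) → ∀ y → ∃[ x ] f x ≡ y
injective⇒surjective {suc n} f f-injective y with Fin.any? (λ x → f x ≟ y)
... | yes found = found
... | no missed = contradiction (Fin.injective⇒≤ {f = λ x → punchOut (avoids x)} (λ {i} {j} eq → f-injective (Fin.punchOut-injective (avoids i) (avoids j) eq))) ℕ.1+n≰n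
  where
  avoids : ∀ x → y ≢ f x
  avoids x y≡fx = missed (x , sym y≡fx)

third : (i j : Fin n) → i ≢ j → 2 ℕ.< n → ∃[ k ] k ≢ i × k ≢ j
third {suc (suc (suc n))} i j i≢j _ = punchIn i (punchIn (punchOut i≢j) zero) , Fin.punchInᵢ≢i i _ ,
  λ eq → Fin.punchInᵢ≢i (punchOut i≢j) zero (Fin.punchIn-injective i _ _ (trans eq (sym (Fin.punchIn-punchOut i≢j))))
third {suc zero}       i j i≢j (ℕ.s≤s ())
third {suc (suc zero)} i j i≢j (ℕ.s≤s (ℕ.s≤s ()))

module FiniteField {c ℓ₁ ℓ₂} (F : HeytingField c ℓ₁ ℓ₂) (r : ℕ) .{{_ : ℕ.NonZero r}} (r-prime : Prime r)
  (h : ℕ) (r≡ : r ≡ suc (h ℕ.+ h)) (0<h : 0 ℕ.< h)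
  (enumeration : Enumeration (HeytingField.setoid F) (suc r)) where

  private
    module F = HeytingField F
    module E = Inverse enumeration

  commutativeRing : CommutativeRing c ℓ₁
  commutativeRing = record { isCommutativeRing = F.isCommutativeRing }

  open CommutativeRing commutativeRing using (semiring; *-commutativeMonoid; *-monoid; ring)
  open import Algebra.Properties.Semiring.Exp semiring using (^-homo-*; ^-assocʳ; ^-congˡ) renaming (_^_ to _^F_)
  import Algebra.Properties.CommutativeMonoid.Sum *-commutativeMonoid as Product′
  open HeytingCommutativeRingProperties F.heytingCommutativeRing using (x-0≈x; 1#0)
  open RingProperties ring using (-1*x≈-x; -‿involutive)
  open import Relation.Binary.Reasoning.Setoid F.setoid using (step-≈-⟩; step-≈-⟨)
    renaming (begin_ to begin≈_; _∎ to _∎≈)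

  from-injective : ∀ {x y} → E.from x ≡ E.from y → x F.≈ y
  from-injective {x} {y} eq = F.trans (F.sym (E.strictlyInverseˡ x)) (F.trans (E.to-cong eq) (E.strictlyInverseˡ y))

  _≈?_ : ∀ x y → Dec (x F.≈ y)
  x ≈? y = map′ from-injective E.from-cong (E.from x ≟ E.from y)

  Unit : F.Carrier → Set _
  Unit x = ∃[ y ] y F.* x F.≈ F.1#

  #0⇒unit : ∀ {x} → x F.# F.0# → Unit x
  #0⇒unit {x} x#0 with F.#⇒invertible x#0
  ... | y , yx≈1 , _ = y , F.trans (F.*-congˡ (F.sym (x-0≈x x))) yx≈1

  unit⇒#0 : ∀ {x} → Unit x → x F.# F.0#
  unit⇒#0 {x} (y , yx≈1) = F.invertible⇒# (y , F.trans (F.*-congˡ (x-0≈x x)) yx≈1 , F.trans (F.*-comm _ y) (F.trans (F.*-congˡ (x-0≈x x)) yx≈1))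

  #0⇒≉0 : ∀ {x} → x F.# F.0# → ¬ x F.≈ F.0#
  #0⇒≉0 {x} x#0 x≈0 = proj₂ (F.tight x F.0#) x≈0 x#0

  -- Finiteness makes invertibility decidable, so tightness yields an inverse.
  ≉0⇒unit : ∀ {x} → ¬ x F.≈ F.0# → Unit x
  ≉0⇒unit {x} x≉0 with Fin.any? (λ i → (E.to i F.* x) ≈? F.1#)
  ... | yes (i , eq) = E.to i , eq
  ... | no ¬unit = contradiction (proj₁ (F.tight x F.0#) λ x#0 → let (y , yx≈1) = #0⇒unit x#0 in
          ¬unit (E.from y , F.trans (F.*-congʳ (E.strictlyInverseˡ y)) yx≈1)) x≉0

  unit-* : ∀ {x y} → Unit x → Unit y → Unit (x F.* y)
  unit-* {x} {y} (x′ , x′x≈1) (y′ , y′y≈1) = y′ F.* x′ , (begin≈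
    y′ F.* x′ F.* (x F.* y)   ≈⟨ F.*-assoc y′ x′ (x F.* y) ⟩
    y′ F.* (x′ F.* (x F.* y)) ≈⟨ F.*-congˡ (F.*-assoc x′ x y) ⟨
    y′ F.* (x′ F.* x F.* y)   ≈⟨ F.*-congˡ (F.*-congʳ x′x≈1) ⟩
    y′ F.* (F.1# F.* y)       ≈⟨ F.*-congˡ (F.*-identityˡ y) ⟩
    y′ F.* y                  ≈⟨ y′y≈1 ⟩
    F.1#                      ∎≈)

  unit-1 : Unit F.1#
  unit-1 = F.1# , F.*-identityˡ F.1#

  unit-^ : ∀ {x} n → Unit x → Unit (x ^F n)
  unit-^ zero    x∈ = unit-1
  unit-^ (suc n) x∈ = unit-* x∈ (unit-^ n x∈)

  unit-cancelˡ : ∀ {x y z} → Unit x → x F.* y F.≈ x F.* z → y F.≈ z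
  unit-cancelˡ {x} {y} {z} (x′ , x′x≈1) eq = begin≈
    y                 ≈⟨ expand y ⟩
    x′ F.* (x F.* y)  ≈⟨ F.*-congˡ eq ⟩
    x′ F.* (x F.* z)  ≈⟨ expand z ⟨
    z                 ∎≈
    where
    expand : ∀ w → w F.≈ x′ F.* (x F.* w)
    expand w = F.trans (F.sym (F.*-identityˡ w)) (F.trans (F.*-congʳ (F.sym x′x≈1)) (F.*-assoc x′ x w))

  unit⇒≉0 : ∀ {x} → Unit x → ¬ x F.≈ F.0#
  unit⇒≉0 = #0⇒≉0 ∘ unit⇒#0

  unit-inverse : ∀ {x} ((y , _) : Unit x) → Unit y
  unit-inverse {x} (y , yx≈1) = x , F.trans (F.*-comm x y) yx≈1

  origin : Fin (suc r)
  origin = E.from F.0#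

  unit : Fin r → F.Carrier
  unit i = E.to (punchIn origin i)

  unit-isUnit : ∀ i → Unit (unit i)
  unit-isUnit i = ≉0⇒unit λ u≈0 → Fin.punchInᵢ≢i origin i (trans (sym (E.strictlyInverseʳ (punchIn origin i))) (E.from-cong u≈0))

  unit-injective : ∀ {i j} → unit i F.≈ unit j → i ≡ j
  unit-injective {i} {j} eq = Fin.punchIn-injective origin i j
    (trans (sym (E.strictlyInverseʳ (punchIn origin i))) (trans (E.from-cong eq) (E.strictlyInverseʳ (punchIn origin j))))

  origin≢ : ∀ {x} → Unit x → origin ≢ E.from x
  origin≢ x∈ eq = unit⇒≉0 x∈ (from-injective (sym eq))

  multiply : ∀ {x} → Unit x → Fin r → Fin r
  multiply x∈ i = punchOut (origin≢ (unit-* x∈ (unit-isUnit i)))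

  unit-multiply : ∀ {x} (x∈ : Unit x) i → unit (multiply x∈ i) F.≈ x F.* unit i
  unit-multiply {x} x∈ i = F.trans (E.to-cong (Fin.punchIn-punchOut (origin≢ (unit-* x∈ (unit-isUnit i))))) (E.strictlyInverseˡ (x F.* unit i))

  multiply-inverse : ∀ {x y} (x∈ : Unit x) (y∈ : Unit y) → y F.* x F.≈ F.1# → ∀ i → multiply y∈ (multiply x∈ i) ≡ i
  multiply-inverse {x} {y} x∈ y∈ yx≈1 i = unit-injective (begin≈
    unit (multiply y∈ (multiply x∈ i)) ≈⟨ unit-multiply y∈ (multiply x∈ i) ⟩
    y F.* unit (multiply x∈ i)         ≈⟨ F.*-congˡ (unit-multiply x∈ i) ⟩
    y F.* (x F.* unit i)               ≈⟨ F.*-assoc y x (unit i) ⟨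
    y F.* x F.* unit i                 ≈⟨ F.*-congʳ yx≈1 ⟩
    F.1# F.* unit i                    ≈⟨ F.*-identityˡ (unit i) ⟩
    unit i                             ∎≈)

  product-isUnit : ∀ {n} (v : Vector F.Carrier n) → (∀ i → Unit (v i)) → Unit (Product′.sum v)
  product-isUnit {zero}  v v∈ = unit-1
  product-isUnit {suc n} v v∈ = unit-* (v∈ zero) (product-isUnit (v ∘ suc) (v∈ ∘ suc))

  -- Multiplication by `x` permutes the `r` units; compare the product of all units before and
  -- after.
  fermat : ∀ {x} → Unit x → x ^F r F.≈ F.1#
  fermat {x} x∈@(y , yx≈1) = unit-cancelˡ (product-isUnit unit unit-isUnit) (begin≈
    Π F.* x ^F r                                        ≈⟨ F.*-comm Π (x ^F r) ⟩
    x ^F r F.* Π                                        ≈⟨ F.*-congʳ (Product′.sum-replicate r) ⟨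
    Product′.sum {r} (λ _ → x) F.* Π                    ≈⟨ Product′.∑-distrib-+ (λ _ → x) unit ⟨
    Product′.sum (λ i → x F.* unit i)                   ≈⟨ Product′.sum-cong-≋ (unit-multiply x∈) ⟨
    Product′.sum (λ i → unit (multiply x∈ i))           ≈⟨ Product′.sum-permute unit (permutation (multiply x∈) (multiply y∈)
        (multiply-inverse y∈ x∈ (F.trans (F.*-comm x y) yx≈1)) (multiply-inverse x∈ y∈ yx≈1)) ⟨
    Π                                                   ≈⟨ F.*-identityʳ Π ⟨
    Π F.* F.1#                                          ∎≈)
    where
    Π : F.Carrier
    Π = Product′.sum unit
    y∈ : Unit y
    y∈ = unit-inverse x∈

  1^ : ∀ n → F.1# ^F n F.≈ F.1#
  1^ zero    = F.refl
  1^ (suc n) = F.trans (F.*-identityˡ _) (1^ n)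

  ^-periodic : ∀ {x} → Unit x → ∀ m n → x ^F (m ℕ.+ n ℕ.* r) F.≈ x ^F m
  ^-periodic {x} x∈ m n = begin≈
    x ^F (m ℕ.+ n ℕ.* r)           ≈⟨ ^-homo-* x m (n ℕ.* r) ⟩
    x ^F m F.* x ^F (n ℕ.* r)      ≈⟨ F.*-congˡ (F.reflexive (cong (x ^F_) (ℕ.*-comm n r))) ⟩
    x ^F m F.* x ^F (r ℕ.* n)      ≈⟨ F.*-congˡ (^-assocʳ x r n) ⟨
    x ^F m F.* (x ^F r) ^F n       ≈⟨ F.*-congˡ (^-congˡ n (fermat x∈)) ⟩
    x ^F m F.* F.1# ^F n           ≈⟨ F.*-congˡ (1^ n) ⟩
    x ^F m F.* F.1#                ≈⟨ F.*-identityʳ (x ^F m) ⟩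
    x ^F m                         ∎≈

  -- r is odd, so -1 = (-1)ʳ = 1.
  x+x≈0 : ∀ x → x F.+ x F.≈ F.0#
  x+x≈0 x = begin≈
    x F.+ x                  ≈⟨ F.+-congˡ (F.*-identityˡ x) ⟨
    x F.+ F.1# F.* x         ≈⟨ F.+-congˡ (F.*-congʳ (fermat -1∈)) ⟨
    x F.+ -1# ^F r F.* x     ≈⟨ F.+-congˡ (F.*-congʳ odd-power) ⟩
    x F.+ -1# F.* x          ≈⟨ F.+-congˡ (-1*x≈-x x) ⟩
    x F.+ F.- x              ≈⟨ F.-‿inverseʳ x ⟩
    F.0#                     ∎≈
    where
    -1# : F.Carrier
    -1# = F.- F.1#
    -1*-1≈1 : -1# F.* -1# F.≈ F.1#
    -1*-1≈1 = F.trans (-1*x≈-x -1#) (-‿involutive F.1#)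
    -1∈ : Unit -1#
    -1∈ = -1# , -1*-1≈1
    even-power : ∀ n → -1# ^F (n ℕ.+ n) F.≈ F.1#
    even-power zero    = F.refl
    even-power (suc n) = begin≈
      -1# F.* -1# ^F (n ℕ.+ suc n)          ≈⟨ F.*-congˡ (F.reflexive (cong (-1# ^F_) (ℕ.+-suc n n))) ⟩
      -1# F.* (-1# F.* -1# ^F (n ℕ.+ n))    ≈⟨ F.*-assoc -1# -1# _ ⟨
      -1# F.* -1# F.* -1# ^F (n ℕ.+ n)      ≈⟨ F.*-cong -1*-1≈1 (even-power n) ⟩
      F.1# F.* F.1#                         ≈⟨ F.*-identityˡ F.1# ⟩
      F.1#                                  ∎≈
    odd-power : -1# ^F r F.≈ -1#
    odd-power = F.trans (F.reflexive (cong (-1# ^F_) r≡)) (F.trans (F.*-congˡ (even-power h)) (F.*-identityʳ -1#))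

  -- Being different from 1 is enough for generating, because the number of units is prime. Such a
  -- unit exists as the field has more than two elements.
  generator : ∃[ g ] Unit g × ¬ g F.≈ F.1#
  generator with third origin (E.from F.1#) (origin≢ unit-1)
                   (subst (λ n → 2 ℕ.< suc n) (sym r≡) (ℕ.s≤s (ℕ.s≤s (ℕ.m≤n⇒m≤n+o h 0<h))))
  ... | k , k≢0 , k≢1 = E.to k , ≉0⇒unit (λ eq → k≢0 (trans (sym (E.strictlyInverseʳ k)) (E.from-cong eq))) ,
                          λ eq → k≢1 (trans (sym (E.strictlyInverseʳ k)) (E.from-cong eq))

  g : F.Carrier
  g = proj₁ generator

  g∈ : Unit g
  g∈ = proj₁ (proj₂ generator)

  -- By Bézout, `g ^F d ≈ 1` and `g ^F r ≈ 1` with `d` and `r` coprime would give `g ≈ 1`.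
  g^≉1 : ∀ d → 0 ℕ.< d → d ℕ.< r → ¬ g ^F d F.≈ F.1#
  g^≉1 d 0<d d<r g^d≈1 with coprime-Bézout (prime⇒coprime r-prime {{ℕ.>-nonZero 0<d}} d<r)
  ... | Bézout.-+ x y eq = proj₂ (proj₂ generator) (begin≈
        g                      ≈⟨ F.*-identityʳ g ⟨
        g ^F 1                 ≈⟨ ^-periodic g∈ 1 x ⟨
        g ^F (1 ℕ.+ x ℕ.* r)   ≈⟨ F.reflexive (cong (g ^F_) (trans eq (ℕ.*-comm y d))) ⟩
        g ^F (d ℕ.* y)         ≈⟨ ^-assocʳ g d y ⟨
        (g ^F d) ^F y          ≈⟨ ^-congˡ y g^d≈1 ⟩
        F.1# ^F y              ≈⟨ 1^ y ⟩
        F.1#                   ∎≈)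
  ... | Bézout.+- x y eq = proj₂ (proj₂ generator) (begin≈
        g                            ≈⟨ F.*-identityʳ g ⟨
        g F.* F.1#                   ≈⟨ F.*-congˡ (1^ y) ⟨
        g F.* F.1# ^F y              ≈⟨ F.*-congˡ (^-congˡ y g^d≈1) ⟨
        g F.* (g ^F d) ^F y          ≈⟨ F.*-congˡ (^-assocʳ g d y) ⟩
        g ^F (1 ℕ.+ d ℕ.* y)         ≈⟨ F.reflexive (cong (g ^F_) (trans (cong suc (ℕ.*-comm d y)) eq)) ⟩
        g ^F (0 ℕ.+ x ℕ.* r)         ≈⟨ ^-periodic g∈ 0 x ⟩
        F.1#                         ∎≈)

  g^-injective-≤ : ∀ (i j : Fin r) → toℕ i ℕ.≤ toℕ j → g ^F toℕ i F.≈ g ^F toℕ j → i ≡ j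
  g^-injective-≤ i j i≤j eq with ℕ.m≤n⇒m<n∨m≡n i≤j
  ... | inj₂ i≡j = Fin.toℕ-injective i≡j
  ... | inj₁ i<j = contradiction
          (unit-cancelˡ (unit-^ (toℕ i) g∈) (begin≈
            g ^F toℕ i F.* g ^F (toℕ j ∸ toℕ i)   ≈⟨ ^-homo-* g (toℕ i) (toℕ j ∸ toℕ i) ⟨
            g ^F (toℕ i ℕ.+ (toℕ j ∸ toℕ i))      ≈⟨ F.reflexive (cong (g ^F_) (ℕ.m+[n∸m]≡n i≤j)) ⟩
            g ^F toℕ j                            ≈⟨ eq ⟨
            g ^F toℕ i                            ≈⟨ F.*-identityʳ _ ⟨
            g ^F toℕ i F.* F.1#                   ∎≈))
          (g^≉1 (toℕ j ∸ toℕ i) (ℕ.m<n⇒0<n∸m i<j) (ℕ.≤-<-trans (ℕ.m∸n≤m (toℕ j) (toℕ i)) (Fin.toℕ<n j)))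

  g^-injective : ∀ (i j : Fin r) → g ^F toℕ i F.≈ g ^F toℕ j → i ≡ j
  g^-injective i j eq with ℕ.≤-total (toℕ i) (toℕ j)
  ... | inj₁ i≤j = g^-injective-≤ i j i≤j eq
  ... | inj₂ j≤i = sym (g^-injective-≤ j i j≤i (F.sym eq))

  φ : Fin (suc r) → F.Carrier
  φ zero    = F.0#
  φ (suc i) = g ^F toℕ i

  φ-suc-unit : ∀ i → Unit (φ (suc i))
  φ-suc-unit i = unit-^ (toℕ i) g∈

  φ-injective : ∀ {x y} → φ x F.≈ φ y → x ≡ y
  φ-injective {zero}  {zero}  eq = refl
  φ-injective {zero}  {suc j} eq = contradiction (F.sym eq) (unit⇒≉0 (φ-suc-unit j))
  φ-injective {suc i} {zero}  eq = contradiction eq (unit⇒≉0 (φ-suc-unit i))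
  φ-injective {suc i} {suc j} eq = cong suc (g^-injective i j eq)

  φ-surjective : ∀ y → ∃[ x ] φ x F.≈ y
  φ-surjective y with injective⇒surjective (λ x → E.from (φ x)) (λ eq → φ-injective (from-injective eq)) (E.from y)
  ... | x , eq = x , from-injective eq

  φ⁻¹ : F.Carrier → Fin (suc r)
  φ⁻¹ y = proj₁ (φ-surjective y)

  φ-φ⁻¹ : ∀ y → φ (φ⁻¹ y) F.≈ y
  φ-φ⁻¹ y = proj₂ (φ-surjective y)

  open Model r

  φ-⋆ : ∀ x y → φ (x ⋆ y) F.≈ φ x F.* φ y
  φ-⋆ zero    y       = F.sym (F.zeroˡ (φ y))
  φ-⋆ (suc i) zero    = F.sym (F.zeroʳ (φ (suc i)))
  φ-⋆ (suc i) (suc j) = begin≈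
    g ^F toℕ (i ⊹ j)                     ≈⟨ F.reflexive (cong (g ^F_) (toℕ-[] s)) ⟩
    g ^F (s ℕ.% r)                       ≈⟨ ^-periodic g∈ (s ℕ.% r) (s ℕ./ r) ⟨
    g ^F (s ℕ.% r ℕ.+ (s ℕ./ r) ℕ.* r)   ≈⟨ F.reflexive (cong (g ^F_) (ℕ.m≡m%n+[m/n]*n s r)) ⟨
    g ^F s                               ≈⟨ ^-homo-* g (toℕ i) (toℕ j) ⟩
    g ^F toℕ i F.* g ^F toℕ j            ∎≈
    where
    s : ℕ
    s = toℕ i ℕ.+ toℕ j

  addition : Addition
  addition = record
    { _⊞_         = _⊞_
    ; ⊞-comm      = λ x y → φ-injective (F.trans (φ-⊞ x y) (F.trans (F.+-comm (φ x) (φ y)) (F.sym (φ-⊞ y x))))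
    ; ⊞-assoc     = λ x y z → φ-injective (begin≈
        φ ((x ⊞ y) ⊞ z)           ≈⟨ F.trans (φ-⊞ (x ⊞ y) z) (F.+-congʳ (φ-⊞ x y)) ⟩
        φ x F.+ φ y F.+ φ z       ≈⟨ F.+-assoc (φ x) (φ y) (φ z) ⟩
        φ x F.+ (φ y F.+ φ z)     ≈⟨ F.trans (φ-⊞ x (y ⊞ z)) (F.+-congˡ (φ-⊞ y z)) ⟨
        φ (x ⊞ (y ⊞ z))           ∎≈)
    ; ⊞-identityˡ = λ x → φ-injective (F.trans (φ-⊞ zero x) (F.+-identityˡ (φ x)))
    ; ⊞-self      = λ x → φ-injective (F.trans (φ-⊞ x x) (x+x≈0 (φ x)))
    ; ⋆-distribˡ  = λ x y z → φ-injective (begin≈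
        φ (x ⋆ (y ⊞ z))                     ≈⟨ F.trans (φ-⋆ x (y ⊞ z)) (F.*-congˡ (φ-⊞ y z)) ⟩
        φ x F.* (φ y F.+ φ z)               ≈⟨ F.distribˡ (φ x) (φ y) (φ z) ⟩
        φ x F.* φ y F.+ φ x F.* φ z         ≈⟨ F.trans (φ-⊞ (x ⋆ y) (x ⋆ z)) (F.+-cong (φ-⋆ x y) (φ-⋆ x z)) ⟨
        φ (x ⋆ y ⊞ x ⋆ z)                   ∎≈)
    }
    where
    infixl 6 _⊞_
    _⊞_ : Fin (suc r) → Fin (suc r) → Fin (suc r)
    x ⊞ y = φ⁻¹ (φ x F.+ φ y)
    φ-⊞ : ∀ x y → φ (x ⊞ y) F.≈ φ x F.+ φ y
    φ-⊞ x y = φ-φ⁻¹ (φ x F.+ φ y)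

  φ-⊞ : ∀ x y → φ (Addition._⊞_ addition x y) F.≈ φ x F.+ φ y
  φ-⊞ x y = φ-φ⁻¹ (φ x F.+ φ y)

  -- Coordinates on the affine group

  private
    module G = Group (GA₁ F)
  open GeneralAffine F using (Affine; affine)
  open Affine
  open Addition addition

  κ : Index addition → Affine
  κ (b , i) = affine (φ (suc i)) (φ b) (unit⇒#0 (φ-suc-unit i))

  log : ∀ {x} → x F.# F.0# → ∃[ i ] φ (suc i) F.≈ x
  log {x} x#0 with φ-surjective x
  ... | zero  , 0≈x = contradiction (F.sym 0≈x) (#0⇒≉0 x#0)
  ... | suc i , eq  = i , eq

  κ⁻¹ : Affine → Index addition
  κ⁻¹ y = φ⁻¹ (b y) , proj₁ (log (a#0 y))

  κ-κ⁻¹ : ∀ y → κ (κ⁻¹ y) G.≈ y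
  κ-κ⁻¹ y = proj₂ (log (a#0 y)) , φ-φ⁻¹ (b y)

  κ-injective : ∀ {s t} → κ s G.≈ κ t → s ≡ t
  κ-injective (a≈ , b≈) = cong₂ _,_ (φ-injective b≈) (Fin.suc-injective (φ-injective a≈))

  κ⁻¹-unique : ∀ {s y} → κ s G.≈ y → κ⁻¹ y ≡ s
  κ⁻¹-unique {s} {y} eq = κ-injective (G.trans {κ (κ⁻¹ y)} {y} {κ s} (κ-κ⁻¹ y) (G.sym {κ s} {y} eq))

  κ⁻¹-cong : ∀ {x y} → x G.≈ y → κ⁻¹ x ≡ κ⁻¹ y
  κ⁻¹-cong {x} {y} eq = κ⁻¹-unique {κ⁻¹ y} {x} (G.trans {κ (κ⁻¹ y)} {y} {x} (κ-κ⁻¹ y) (G.sym {x} {y} eq))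

  quotient : Index addition → Index addition → Index addition
  quotient (b , i) (c , j) = b ⊞ suc (i ⊖ j) ⋆ c , i ⊖ j

  -- The quotient formula is checked by multiplying back, which avoids computing an inverse in the
  -- affine group. Characteristic two enters through `⊞-cancelʳ`: the translation part of a quotient
  -- is a sum instead of a difference.
  κ-quotient-∙ : ∀ s t → κ (quotient s t) G.∙ κ t G.≈ κ s
  κ-quotient-∙ (b , i) (c , j) =
    F.trans (F.sym (φ-⋆ (suc (i ⊖ j)) (suc j))) (F.reflexive (cong (φ ∘ suc) (⊖-⊹-cancel i j))) ,
    (begin≈
      φ (suc (i ⊖ j)) F.* φ c F.+ φ (b ⊞ u)   ≈⟨ F.+-congʳ (φ-⋆ (suc (i ⊖ j)) c) ⟨
      φ u F.+ φ (b ⊞ u)                       ≈⟨ φ-⊞ u (b ⊞ u) ⟨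
      φ (u ⊞ (b ⊞ u))                         ≈⟨ F.reflexive (cong φ (trans (⊞-comm u (b ⊞ u)) (⊞-cancelʳ b u))) ⟩
      φ b                                     ∎≈)
    where
    open ElementaryAbelian _⊞_ zero ⊞-comm ⊞-assoc ⊞-identityˡ ⊞-self using (⊞-cancelʳ)
    u : Fin (suc r)
    u = suc (i ⊖ j) ⋆ c

  κ-quotient : ∀ s t {x y} → κ s G.≈ x → κ t G.≈ y → x G.∙ y G.⁻¹ G.≈ κ (quotient s t)
  κ-quotient s t {x} {y} s≈x t≈y = G.sym {κ (quotient s t)} {x G.∙ y G.⁻¹} (x≈z//y (κ (quotient s t)) y x (G.trans {κ (quotient s t) G.∙ y} {κ (quotient s t) G.∙ κ t} {x}
    (G.∙-congˡ {κ (quotient s t)} {y} {κ t} (G.sym {κ t} {y} t≈y)) (G.trans {κ (quotient s t) G.∙ κ t} {κ s} {x} (κ-quotient-∙ s t) s≈x)))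
    where open GroupProperties (GA₁ F) using (x≈z//y)

  toCoordinates : ∀ {D} → IsIntegerGroupDeterminant (GA₁ F) D → ∃[ α ] D ≡ det (flatten (groupMatrix addition α))
  toCoordinates {D} (n , listing , coefficient , D≡) = α , (begin
    D                                                        ≡⟨ D≡ ⟩
    det M                                                    ≡⟨ det-reindex σ σ⁻¹ σ⁻¹∘σ σ∘σ⁻¹ M ⟨
    det (λ p q → M (σ p) (σ q))                              ≡⟨ det-cong (λ p q → Func.cong coefficient
      (κ-quotient (Fin.remQuot r p) (Fin.remQuot r q) {L.to (σ p)} {L.to (σ q)} (listed (Fin.remQuot r p)) (listed (Fin.remQuot r q)))) ⟩
    det (flatten (groupMatrix addition α))                   ∎)
    where
    module L = Inverse listing
    α : Fin r → Fin (suc r) → ℤ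
    α z y = Func.to coefficient (κ (y , z))
    M : Matrix ℤ n n
    M i j = Func.to coefficient (L.to i G.∙ L.to j G.⁻¹)
    σ : Fin (suc r ℕ.* r) → Fin n
    σ p = L.from (κ (Fin.remQuot r p))
    σ⁻¹ : Fin n → Fin (suc r ℕ.* r)
    σ⁻¹ i = let (b , z) = κ⁻¹ (L.to i) in Fin.combine b z
    listed : ∀ s → κ s G.≈ L.to (L.from (κ s))
    listed s = G.sym {L.to (L.from (κ s))} {κ s} (L.strictlyInverseˡ (κ s))
    σ⁻¹∘σ : ∀ p → σ⁻¹ (σ p) ≡ p
    σ⁻¹∘σ p = trans (cong (λ s → Fin.combine (proj₁ s) (proj₂ s)) (κ⁻¹-unique {Fin.remQuot r p} {L.to (σ p)} (listed (Fin.remQuot r p)))) (Fin.combine-remQuot r p)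
    σ∘σ⁻¹ : ∀ i → σ (σ⁻¹ i) ≡ i
    σ∘σ⁻¹ i = trans (L.from-cong (G.trans {κ (Fin.remQuot r (σ⁻¹ i))} {κ (κ⁻¹ (L.to i))} {L.to i}
      (G.reflexive (cong κ (Fin.remQuot-combine (proj₁ (κ⁻¹ (L.to i))) (proj₂ (κ⁻¹ (L.to i)))))) (κ-κ⁻¹ (L.to i)))) (L.strictlyInverseʳ i)

  fromCoordinates : ∀ α → IsIntegerGroupDeterminant (GA₁ F) (det (flatten (groupMatrix addition α)))
  fromCoordinates α = suc r ℕ.* r , listing , coefficient , det-cong λ p q →
    cong (λ s → α (proj₂ s) (proj₁ s)) (sym (κ⁻¹-unique
      {quotient (Fin.remQuot r p) (Fin.remQuot r q)} {κ (Fin.remQuot r p) G.∙ κ (Fin.remQuot r q) G.⁻¹}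
      (G.sym {κ (Fin.remQuot r p) G.∙ κ (Fin.remQuot r q) G.⁻¹} {κ (quotient (Fin.remQuot r p) (Fin.remQuot r q))}
        (κ-quotient (Fin.remQuot r p) (Fin.remQuot r q) {κ (Fin.remQuot r p)} {κ (Fin.remQuot r q)} (G.refl {κ (Fin.remQuot r p)}) (G.refl {κ (Fin.remQuot r q)})))))
    where
    coefficient : ℤ[ GA₁ F ]
    coefficient = record
      { to   = λ x → α (proj₂ (κ⁻¹ x)) (proj₁ (κ⁻¹ x))
      ; cong = λ {x} {y} x≈y → cong (λ s → α (proj₂ s) (proj₁ s)) (κ⁻¹-cong {x} {y} x≈y)
      }
    index : Affine → Fin (suc r ℕ.* r)
    index x = Fin.combine (proj₁ (κ⁻¹ x)) (proj₂ (κ⁻¹ x))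
    listing : Enumeration G.setoid (suc r ℕ.* r)
    listing = record
      { to        = λ p → κ (Fin.remQuot r p)
      ; from      = index
      ; to-cong   = λ p≡q → G.reflexive (cong (λ p → κ (Fin.remQuot r p)) p≡q)
      ; from-cong = λ {x} {y} x≈y → cong (λ s → Fin.combine (proj₁ s) (proj₂ s)) (κ⁻¹-cong {x} {y} x≈y)
      ; inverse   =
          (λ {x} {p} p≡ → G.trans {κ (Fin.remQuot r p)} {κ (κ⁻¹ x)} {x}
            (G.reflexive (cong κ (trans (cong (Fin.remQuot r) p≡) (Fin.remQuot-combine (proj₁ (κ⁻¹ x)) (proj₂ (κ⁻¹ x)))))) (κ-κ⁻¹ x)) ,
          (λ {p} {x} x≈ → trans (cong (λ s → Fin.combine (proj₁ s) (proj₂ s))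
            (κ⁻¹-unique {Fin.remQuot r p} {x} (G.sym {x} {κ (Fin.remQuot r p)} x≈))) (Fin.combine-remQuot r p))
      }

-- From coordinates to the group

module Equivalence {c ℓ₁ ℓ₂} (F : HeytingField c ℓ₁ ℓ₂) (r : ℕ) .{{_ : ℕ.NonZero r}} (r-prime : Prime r)
  (h : ℕ) (r≡ : r ≡ suc (h ℕ.+ h)) (0<h : 0 ℕ.< h)
  (enumeration : Enumeration (HeytingField.setoid F) (suc r)) where
  open FiniteField F r r-prime h r≡ 0<h enumeration using (addition; toCoordinates; fromCoordinates)
  open Spectrum r r-prime h r≡ 0<h addition using (Factors; factors; attained)

  necessity : ∀ {D} → IsIntegerGroupDeterminant (GA₁ F) D → Factors D
  necessity det-D = subst Factors (sym (proj₂ (toCoordinates det-D))) (factors (proj₁ (toCoordinates det-D)))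

  sufficiency : ∀ {D} → Factors D → IsIntegerGroupDeterminant (GA₁ F) D
  sufficiency {D} D∈ = subst (IsIntegerGroupDeterminant (GA₁ F)) (sym (proj₂ (attained D D∈))) (fromCoordinates (proj₁ (attained D D∈)))

-- The witness is `2ᵏ⁻¹ - 1`, that is `(r - 1) / 2`; it is positive because `k` is at least 2.
2^k≡2+2h : ∀ k → 2 ≤ k → ∃[ h ] 2 ^ℕ k ≡ suc (suc (h ℕ.+ h)) × 0 ℕ.< h
2^k≡2+2h (suc (suc k)) _ = ℕ.pred (2 ^ℕ suc k) , double (2 ^ℕ suc k) (ℕ.m^n>0 2 (suc k)) ,
  ℕ.pred-mono-≤ (ℕ.*-monoʳ-≤ 2 (ℕ.m^n>0 2 k))
  where
  double : ∀ m → 0 ℕ.< m → 2 ℕ.* m ≡ suc (suc (ℕ.pred m ℕ.+ ℕ.pred m))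
  double (suc m) _ = cong suc (trans (ℕ.+-suc m (m ℕ.+ 0)) (cong (λ z → suc (m ℕ.+ z)) (ℕ.+-identityʳ m)))
2^k≡2+2h (suc zero) (ℕ.s≤s ())

determinants : ∀ (q r h : ℕ) → q ≡ suc r → r ≡ suc (h ℕ.+ h) → 0 ℕ.< h → Prime r →
    ∀ {c ℓ₁ ℓ₂} (F : HeytingField c ℓ₁ ℓ₂) → Enumeration (HeytingField.setoid F) q →
    ∀ (D : ℤ) →
    IsIntegerGroupDeterminant (GA₁ F) D ⇔
    (∃[ A ] ∃[ B ] (D ≡ A * B ^ (q ∸ 1)) × ((¬ (+ r ∣ A)) ⊎ ((+ r) ^ 2 ∣ A)) × (+ q ∣ B - A))
determinants _ r h refl r≡ 0<h r-prime F enumeration D = mk⇔ (unsigned ∘ necessity) (sufficiency ∘ signed)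
  where
  open Equivalence F r {{prime⇒nonZero r-prime}} r-prime h r≡ 0<h enumeration
  r²≡ : + r * + r ≡ (+ r) ^ 2
  r²≡ = cong (+ r *_) (sym (ℤ.*-identityʳ (+ r)))
  unsigned : ∃[ A ] ∃[ B ] D ≡ A * B ^ r × (¬ (+ r ∣ₛ A) ⊎ + r * + r ∣ₛ A) × + suc r ∣ₛ B - A →
             ∃[ A ] ∃[ B ] (D ≡ A * B ^ r) × ((¬ (+ r ∣ A)) ⊎ ((+ r) ^ 2 ∣ A)) × (+ suc r ∣ B - A)
  unsigned (A , B , D≡ , r∤A⊎r²∣A , q∣B-A) =
    A , B , D≡ , Sum.map (_∘ ∣ᵤ⇒∣) (λ r²∣A → subst (_∣ A) r²≡ (∣⇒∣ᵤ r²∣A)) r∤A⊎r²∣A , ∣⇒∣ᵤ q∣B-A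
  signed : ∃[ A ] ∃[ B ] (D ≡ A * B ^ r) × ((¬ (+ r ∣ A)) ⊎ ((+ r) ^ 2 ∣ A)) × (+ suc r ∣ B - A) →
           ∃[ A ] ∃[ B ] D ≡ A * B ^ r × (¬ (+ r ∣ₛ A) ⊎ + r * + r ∣ₛ A) × + suc r ∣ₛ B - A
  signed (A , B , D≡ , r∤A⊎r²∣A , q∣B-A) =
    A , B , D≡ , Sum.map (_∘ ∣⇒∣ᵤ) (λ r²∣A → ∣ᵤ⇒∣ (subst (_∣ A) (sym r²≡) r²∣A)) r∤A⊎r²∣A , ∣ᵤ⇒∣ q∣B-A

theorem4 : ∀ (k q r : ℕ) → 2 ≤ k → q ≡ 2 ^ℕ k → r ≡ q ∸ 1 → Prime r →
    ∀ {c ℓ₁ ℓ₂} (F : HeytingField c ℓ₁ ℓ₂) → Enumeration (HeytingField.setoid F) q →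
    ∀ (D : ℤ) →
    IsIntegerGroupDeterminant (GA₁ F) D ⇔
    (∃[ A ] ∃[ B ] (D ≡ A * B ^ (q ∸ 1)) × ((¬ (+ r ∣ A)) ⊎ ((+ r) ^ 2 ∣ A)) × (+ q ∣ B - A))
theorem4 k q r 2≤k q≡2^k r≡q∸1 r-prime F enumeration D =
  determinants q r h q≡1+r (ℕ.suc-injective (trans (sym q≡1+r) q≡2+2h)) 0<h r-prime F enumeration D
  where
  h : ℕ
  h = proj₁ (2^k≡2+2h k 2≤k)
  0<h : 0 ℕ.< h
  0<h = proj₂ (proj₂ (2^k≡2+2h k 2≤k))
  q≡2+2h : q ≡ suc (suc (h ℕ.+ h))
  q≡2+2h = trans q≡2^k (proj₁ (proj₂ (2^k≡2+2h k 2≤k)))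
  q≡1+r : q ≡ suc r
  q≡1+r = trans q≡2+2h (cong suc (sym (trans r≡q∸1 (cong (_∸ 1) q≡2+2h))))
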